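{- There exists $n_0$ such that for every integer $n\ge n_0$ and every positive integer $r<(\ln n)^{1/5}$ the following holds: every $n$-uniform hypergraph $H=(V,E)$ with $|V|$ divisible by $r$ and $$|E|\le 0.01\left(\frac{n}{\ln n}\right)^{\frac{r-1}{r}} r^{n-1}$$ admits an equitable $r$-coloring.
   Context: A vertex coloring of a hypergraph is proper if no edge is monochromatic. A hypergraph is equitably $r$-colorable (admits an equitable $r$-coloring) if there is a proper coloring of its vertices with $r$ colors such that the sizes of any two color classes differ by at most one. A hypergraph is $n$-uniform if every edge has exactly $n$ vertices. -}

module Defs where

open import Data.Nat as ℕ using (ℕ; zero; suc)
open import Data.Integer using (+_)
open import Data.Rational using (ℚ; 0ℚ; 1ℚ; _/_; _+_; _*_; _≤_)
open import Data.Fin using (Fin; _≟_)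
open import Data.Fin.Subset using (Subset; _∈_; ∣_∣)
open import Data.Vec using (tabulate)
open import Data.List using (List; length)
open import Data.List.Relation.Unary.All using (All)
open import Data.List.Relation.Unary.Unique.Propositional using (Unique)
open import Data.Product using (Σ; ∃; _×_)
open import Relation.Nullary using (¬_; does)
open import Relation.Binary.PropositionalEquality using (_≡_)

ℕ→ℚ : ℕ → ℚ
ℕ→ℚ n = + n / 1

_^ℚ_ : ℚ → ℕ → ℚ
t ^ℚ zero  = 1ℚ
t ^ℚ suc k = (t ^ℚ k) * t

expTerm : ℚ → ℕ → ℚ
expTerm t zero    = 1ℚ
expTerm t (suc j) = expTerm t j * t * (+ 1 / suc j)

expPartial : ℚ → ℕ → ℚ
expPartial t zero    = 0ℚ
expPartial t (suc k) = expPartial t k + expTerm t k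

-- For a rational t ≥ 0 and n ≥ 1:  t ≤ ln n  ⇔  e^t ≤ n
-- ⇔ every partial sum of the exponential series at t is ≤ n.
_≤ln_ : ℚ → ℕ → Set
t ≤ln n = ∀ k → expPartial t k ≤ ℕ→ℚ n

record Hypergraph (N : ℕ) : Set where
  field
    edges  : List (Subset N)
    unique : Unique edges
open Hypergraph public

Uniform : ∀ {N} → ℕ → Hypergraph N → Set
Uniform n H = All (λ e → ∣ e ∣ ≡ n) (edges H)

numEdges : ∀ {N} → Hypergraph N → ℕ
numEdges H = length (edges H)

Monochromatic : ∀ {N r} → (Fin N → Fin r) → Subset N → Set
Monochromatic c e = ∃ λ j → ∀ v → v ∈ e → c v ≡ j

Proper : ∀ {N r} → Hypergraph N → (Fin N → Fin r) → Set
Proper H c = All (λ e → ¬ Monochromatic c e) (edges H)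

colorClass : ∀ {N r} → (Fin N → Fin r) → Fin r → Subset N
colorClass c i = tabulate (λ v → does (c v ≟ i))

Equitable : ∀ {N r} → (Fin N → Fin r) → Set
Equitable c = ∀ i j → ∣ colorClass c i ∣ ℕ.≤ ∣ colorClass c j ∣ ℕ.+ 1

EquitablyColorable : ∀ {N} → (r : ℕ) → Hypergraph N → Set
EquitablyColorable {N} r H = Σ (Fin N → Fin r) λ c → Proper H c × Equitable c

{-# OPTIONS --safe #-}
module Submission where

-- If |V| is at most about n² r / ln n, a random balanced colouring works: sampling without
-- replacement makes a monochromatic edge rarer by a factor exp (- n² (r - 1) / 2|V|).  The choice is
-- made vertex by vertex, by the method of conditional expectations.
--
-- Otherwise set aside a reservoir R of o(n) vertices with Σ (2r)^|e ∩ R| ≤ 2|E|.  It then suffices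
-- to colour V ∖ R almost equitably without monochromatic e ∖ R, because the vertices of R, coloured
-- arbitrarily, repair the class sizes.  Give the vertices independent random weights, order them by
-- weight, and start from the colouring by r blocks of consecutive ranks.  As in the greedy colouring
-- of Cherkashin and Kozik, call e₁, …, eₘ a chain if the last vertex of each edge is the first
-- vertex of the next one.  With positive probability the weights of no edge lie in an interval
-- shorter than a block by 5 log₄ n / n of its length, no chain has r edges, and at most |R| / r of
-- the chains of m < r edges lie in m consecutive blocks.  A vertex that starts a chain of j edges is
-- moved down until j colours lie above its own, and a vertex that ends a chain climbing one block per
-- edge is moved up by one colour.  No vertex is forced both ways, since this would give a chain of r
-- edges; so no monochromatic edge survives, and few vertices have changed colour.

open import Defs
open import Data.Empty using (⊥; ⊥-elim)
open import Data.Fin using (Fin; zero; suc; toℕ; fromℕ<)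
open import Data.Fin.Properties using (any?; all?; toℕ-injective; toℕ<n; toℕ-fromℕ<) renaming (_≟_ to _≟F_; suc-injective to suc-injectiveF)
open import Data.Fin.Subset using (Subset; inside; outside; ∣_∣; _∈_; _∉_; _∩_; _∪_; _─_; ∁; ⁅_⁆) renaming (⊥ to ∅)
open import Data.Fin.Subset.Properties using (_∈?_; drop-there; x∈p∩q⁺; x∈p∩q⁻; x∈p∪q⁺; x∈p∪q⁻; p─q⊆p; p─⊥≡p; ∩-comm; ∩-zeroʳ; ∪-identityʳ; x∈∁p⇒x∉p; x∉p⇒x∈∁p; x∈⁅x⁆; x∈⁅y⁆⇒x≡y; ∣⁅x⁆∣≡1; ∣⊥∣≡0; ∣p∣≤n; ∣∁p∣≡n∸∣p∣; p⊆q⇒∣p∣≤∣q∣)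
import Data.Integer as ℤ
import Data.Integer.Properties as ℤₚ
open import Data.List using (List; []; _∷_; _++_; map; concatMap; length)
open import Data.List.Membership.Propositional using (find; lose) renaming (_∈_ to _∈ₗ_)
open import Data.List.Membership.Propositional.Properties using (∈-map⁻; ∈-map⁺; ∈-concatMap⁺; ∈-concatMap⁻)
open import Data.List.Properties using (length-++)
open import Data.List.Relation.Unary.All using (All; []; _∷_) renaming (map to mapAll; lookup to lookupAll; tabulate to tabulateAll)
open import Data.List.Relation.Unary.All.Properties using (++⁺)
open import Data.List.Relation.Unary.Any using (Any; here; there) renaming (any? to anyₗ?)
open import Data.Nat
open import Data.Nat.Divisibility using (_∣_; divides)
open import Data.Nat.DivMod using (m/n*n≤m; m≡m%n+[m/n]*n; m%n<n; m<n*o⇒m/o<n; m≥n⇒m/n>0)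
open import Data.Nat.ListAction using (sum; product)
open import Data.Nat.Properties
open import Data.Nat.Tactic.RingSolver using (solve-∀)
open import Data.Product using (∃; ∃₂; Σ; _×_; _,_; proj₁; proj₂)
open import Data.Rational using (ℚ; 0ℚ; 1ℚ; ½; toℚᵘ; nonNegative) renaming (_+_ to _+ℚ_; _*_ to _*ℚ_; _≤_ to _≤ℚ_; _<_ to _<ℚ_; _/_ to _/ℚ_)
import Data.Rational.Properties as ℚₚ
open import Data.Rational.Solver using (module +-*-Solver)
import Data.Rational.Unnormalised as ℚᵘ
import Data.Rational.Unnormalised.Properties as ℚᵘₚ
open import Data.Sum using (_⊎_; inj₁; inj₂)
open import Data.Unit using (⊤; tt)
open import Data.Vec using (Vec; []; _∷_; lookup; tabulate; here; there)
open import Function using (_∘_; case_of_; it)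
open import Relation.Binary.Definitions using (tri<; tri≈; tri>)
open import Relation.Binary.PropositionalEquality
open import Relation.Nullary using (¬_; Dec; yes; no; does)
open import Relation.Nullary.Decidable using (_×-dec_; _→-dec_; _⊎-dec_; ¬?; decidable-stable)

-- Equal class sizes call for blocks cut by rank, while independence is available for weights only;
-- passing from one to the other costs a tolerance `δ` at every block boundary. This tolerance
-- multiplies the probability of a chain inside prescribed blocks by up to `2 ^ g`, where `4 ^ g`,
-- with `g` about log₄ n / r, stands for n^(1/r); that much the bound on |E| can absorb. On the
-- other hand Chebyshev needs |V| `δ`² to be of the order r L² at least, for L the range of the
-- weights, and this is where many vertices are needed. With |V| at least of order n² / ln n both
-- demands are met once log₄ n ≥ 2²⁰ r⁴; the fifth power in the hypothesis on r leaves a factor r to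
-- pay for that constant.
--
-- An edge that loses k vertices to the reservoir becomes up to (2r)^k times as likely to do harm,
-- whence the weights (2r)^|e ∩ R|. For r ≥ 2 the constant 0.01 matters only for chains of r edges:
-- after the doubling of |E| it yields 50^r in the denominator, against a numerator of order 48^r
-- with 48 = 6 * 4 * 2, where 6 comes from the spread of the edges, 4 from r^r / r! and 2 from a
-- leftover factor r.

private variable 𝓐 𝓑 : Set

-- Finite sums and boxes

∑ : List 𝓐 → (𝓐 → ℕ) → ℕ
∑ []       f = 0
∑ (x ∷ xs) f = f x + ∑ xs f

∑-mono : ∀ (xs : List 𝓐) {f g : 𝓐 → ℕ} → (∀ {x} → x ∈ₗ xs → f x ≤ g x) → ∑ xs f ≤ ∑ xs g
∑-mono []       h = z≤n
∑-mono (x ∷ xs) h = +-mono-≤ (h (here refl)) (∑-mono xs (h ∘ there))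

∑-cong : ∀ (xs : List 𝓐) {f g : 𝓐 → ℕ} → (∀ x → f x ≡ g x) → ∑ xs f ≡ ∑ xs g
∑-cong []       h = refl
∑-cong (x ∷ xs) h = cong₂ _+_ (h x) (∑-cong xs h)

∑-+ : ∀ (xs : List 𝓐) (f g : 𝓐 → ℕ) → ∑ xs (λ x → f x + g x) ≡ ∑ xs f + ∑ xs g
∑-+ []       f g = refl
∑-+ (x ∷ xs) f g rewrite ∑-+ xs f g = eq (f x) (g x) (∑ xs f) (∑ xs g)
  where eq : ∀ a b c d → a + b + (c + d) ≡ a + c + (b + d)
        eq = solve-∀

∑-*ˡ : ∀ (xs : List 𝓐) c (f : 𝓐 → ℕ) → ∑ xs (λ x → c * f x) ≡ c * ∑ xs f
∑-*ˡ []       c f = sym (*-zeroʳ c)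
∑-*ˡ (x ∷ xs) c f rewrite ∑-*ˡ xs c f = sym (*-distribˡ-+ c (f x) (∑ xs f))

∑-*ʳ : ∀ (xs : List 𝓐) c (f : 𝓐 → ℕ) → ∑ xs (λ x → f x * c) ≡ ∑ xs f * c
∑-*ʳ xs c f = trans (∑-cong xs (λ x → *-comm (f x) c)) (trans (∑-*ˡ xs c f) (*-comm c _))

∑-const : ∀ (xs : List 𝓐) c → ∑ xs (λ _ → c) ≡ length xs * c
∑-const []       c = refl
∑-const (x ∷ xs) c = cong (c +_) (∑-const xs c)

∑-zero : ∀ (xs : List 𝓐) → ∑ xs (λ _ → 0) ≡ 0
∑-zero xs = trans (∑-const xs 0) (*-zeroʳ (length xs))

∑-swap : ∀ (xs : List 𝓐) (ys : List 𝓑) (f : 𝓐 → 𝓑 → ℕ) →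
         ∑ xs (λ x → ∑ ys (f x)) ≡ ∑ ys (λ y → ∑ xs (λ x → f x y))
∑-swap []       ys f = sym (∑-zero ys)
∑-swap (x ∷ xs) ys f rewrite ∑-swap xs ys f = sym (∑-+ ys (f x) (λ y → ∑ xs (λ x → f x y)))

∑-++ : ∀ (xs ys : List 𝓐) (f : 𝓐 → ℕ) → ∑ (xs ++ ys) f ≡ ∑ xs f + ∑ ys f
∑-++ []       ys f = refl
∑-++ (x ∷ xs) ys f rewrite ∑-++ xs ys f = sym (+-assoc (f x) _ _)

∑-map : ∀ (h : 𝓐 → 𝓑) (xs : List 𝓐) (f : 𝓑 → ℕ) → ∑ (map h xs) f ≡ ∑ xs (f ∘ h)
∑-map h []       f = refl
∑-map h (x ∷ xs) f = cong (f (h x) +_) (∑-map h xs f)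

∑-concatMap : ∀ (h : 𝓐 → List 𝓑) (xs : List 𝓐) (f : 𝓑 → ℕ) →
              ∑ (concatMap h xs) f ≡ ∑ xs (λ x → ∑ (h x) f)
∑-concatMap h []       f = refl
∑-concatMap h (x ∷ xs) f = trans (∑-++ (h x) _ f) (cong (∑ (h x) f +_) (∑-concatMap h xs f))

∑-∈ : ∀ {xs : List 𝓐} {x} (f : 𝓐 → ℕ) → x ∈ₗ xs → f x ≤ ∑ xs f
∑-∈ f (here refl) = m≤m+n _ _
∑-∈ f (there p)   = ≤-trans (∑-∈ f p) (m≤n+m _ _)

-- The averaging principle. Every probabilistic choice in the proof is an application of it, with
-- counts in place of probabilities.
∑-<⇒∃ : ∀ (xs : List 𝓐) {f g : 𝓐 → ℕ} → ∑ xs f < ∑ xs g → ∃ λ x → x ∈ₗ xs × f x < g x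
∑-<⇒∃ []       ()
∑-<⇒∃ (x ∷ xs) {f} {g} lt with f x <? g x
... | yes p = x , here refl , p
... | no ¬p = let (y , y∈ , q) = ∑-<⇒∃ xs rest in y , there y∈ , q
  where rest : ∑ xs f < ∑ xs g
        rest = +-cancelˡ-< (g x) _ _ (≤-<-trans (+-monoˡ-≤ (∑ xs f) (≮⇒≥ ¬p)) lt)

ind : Dec 𝓐 → ℕ
ind (yes _) = 1
ind (no  _) = 0

ind-mono : (d : Dec 𝓐) (d′ : Dec 𝓑) → (𝓐 → 𝓑) → ind d ≤ ind d′
ind-mono (yes a) (yes b) h = ≤-refl
ind-mono (yes a) (no ¬b) h = ⊥-elim (¬b (h a))
ind-mono (no _)  _       h = z≤n

ind≤1 : (d : Dec 𝓐) → ind d ≤ 1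
ind≤1 (yes _) = ≤-refl
ind≤1 (no  _) = z≤n

ind-yes : (d : Dec 𝓐) → 𝓐 → ind d ≡ 1
ind-yes (yes _) a = refl
ind-yes (no ¬a) a = ⊥-elim (¬a a)

ind-no : (d : Dec 𝓐) → ¬ 𝓐 → ind d ≡ 0
ind-no (yes a) ¬a = ⊥-elim (¬a a)
ind-no (no _)  ¬a = refl

ind-× : (d : Dec 𝓐) (d′ : Dec 𝓑) → ind (d ×-dec d′) ≡ ind d * ind d′
ind-× (yes _) (yes _) = refl
ind-× (yes _) (no _)  = refl
ind-× (no _)  _       = refl

ind-bound : ∀ (d : Dec 𝓐) {k} → (𝓐 → 1 ≤ k) → ind d ≤ k
ind-bound (yes a) h = h a
ind-bound (no _)  h = z≤n

-- A count of zero needs no bound, so one of the counted elements may be assumed to be at hand.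
-- Typically it makes the indicator on the right equal to 1.
∑-ind-witness : ∀ (xs : List 𝓐) {P : 𝓐 → Set} (P? : ∀ x → Dec (P x)) {k} →
                (∀ x → x ∈ₗ xs → P x → ∑ xs (λ x → ind (P? x)) ≤ k) → ∑ xs (λ x → ind (P? x)) ≤ k
∑-ind-witness xs P? {k} h with ∑ xs (λ x → ind (P? x)) ≤? k
... | yes p = p
... | no ¬p with ∑-<⇒∃ xs {λ _ → 0} (≤-<-trans (≤-reflexive (∑-zero xs)) (≤-<-trans z≤n (≰⇒> ¬p)))
...   | x , x∈ , lt with P? x
...     | yes px = h x x∈ px
...     | no  _  = ⊥-elim (n≮0 lt)

range : ℕ → ℕ → List ℕ
range s zero    = []
range s (suc k) = s ∷ range (suc s) k

∈-range⁺ : ∀ s k {x} → s ≤ x → x < s + k → x ∈ₗ range s k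
∈-range⁺ s zero    s≤x x< = ⊥-elim (<-irrefl refl (<-≤-trans x< (≤-trans (≤-reflexive (+-identityʳ s)) s≤x)))
∈-range⁺ s (suc k) {x} s≤x x< with s ≟ x
... | yes refl = here refl
... | no  s≢x  = there (∈-range⁺ (suc s) k (≤∧≢⇒< s≤x s≢x) (≤-trans x< (≤-reflexive (+-suc s k))))

∈-range⁻ : ∀ s k {x} → x ∈ₗ range s k → s ≤ x × x < s + k
∈-range⁻ s (suc k) (here refl) = ≤-refl , m<m+n s (s≤s z≤n)
∈-range⁻ s (suc k) (there p)   =
  let (a , b) = ∈-range⁻ (suc s) k p in <⇒≤ a , ≤-trans b (≤-reflexive (sym (+-suc s k)))

length-range : ∀ s k → length (range s k) ≡ k
length-range s zero    = refl
length-range s (suc k) = cong suc (length-range (suc s) k)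

inInterval? : ∀ lo len a → Dec (lo ≤ a × a < lo + len)
inInterval? lo len a = (lo ≤? a) ×-dec (a <? lo + len)

∑-interval≤ : ∀ lo len s k → ∑ (range s k) (λ a → ind (inInterval? lo len a)) ≤ len
∑-interval≤ lo len = below
  where
  above : ∀ s k → lo ≤ s → ∑ (range s k) (λ a → ind (inInterval? lo len a)) ≤ lo + len ∸ s
  above s zero    lo≤s = z≤n
  above s (suc k) lo≤s with inInterval? lo len s
  ... | yes (_ , s<) = ≤-trans (s≤s (above (suc s) k (m≤n⇒m≤1+n lo≤s)))
                               (≤-reflexive (sym (+-∸-assoc 1 s<)))
  ... | no  _ = ≤-trans (above (suc s) k (m≤n⇒m≤1+n lo≤s)) (∸-monoʳ-≤ (lo + len) (n≤1+n s))
  below : ∀ s k → ∑ (range s k) (λ a → ind (inInterval? lo len a)) ≤ len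
  below s zero    = z≤n
  below s (suc k) = case (lo ≤? s)
    where
    case : Dec (lo ≤ s) → ∑ (range s (suc k)) (λ a → ind (inInterval? lo len a)) ≤ len
    case (yes lo≤s) = ≤-trans (above s (suc k) lo≤s)
                        (≤-trans (∸-monoʳ-≤ (lo + len) lo≤s) (≤-reflexive (m+n∸m≡n lo len)))
    case (no lo≰s) = ≤-trans (≤-reflexive (cong (_+ ∑ (range (suc s) k) (λ a → ind (inInterval? lo len a)))
                                            (ind-no (inInterval? lo len s) (lo≰s ∘ proj₁))))
                             (below (suc s) k)

fins : ∀ N → List (Fin N)
fins zero    = []
fins (suc N) = zero ∷ map suc (fins N)

∑-fins : ∀ N (f : Fin (suc N) → ℕ) → ∑ (fins (suc N)) f ≡ f zero + ∑ (fins N) (f ∘ suc)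
∑-fins N f = cong (f zero +_) (∑-map suc (fins N) f)

∈-fins : ∀ {N} (v : Fin N) → v ∈ₗ fins N
∈-fins zero    = here refl
∈-fins (suc v) = there (∈-map⁺ suc (∈-fins v))

length-fins : ∀ N → length (fins N) ≡ N
length-fins N = trans (sym (*-identityʳ _)) (trans (sym (∑-const (fins N) 1)) (go N))
  where go : ∀ N → ∑ (fins N) (λ _ → 1) ≡ N
        go zero    = refl
        go (suc N) = trans (∑-fins N (λ _ → 1)) (cong suc (go N))

∑-fins-≤1 : ∀ {N} {P : Fin N → Set} (P? : ∀ v → Dec (P v)) →
            (∀ {u v} → P u → P v → u ≡ v) → ∑ (fins N) (λ v → ind (P? v)) ≤ 1
∑-fins-≤1 {zero}  P? uniq = z≤n
∑-fins-≤1 {suc N} P? uniq rewrite ∑-fins N (λ v → ind (P? v)) with P? zero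
... | no  _ = ∑-fins-≤1 (P? ∘ suc) (λ p q → suc-injectiveF (uniq p q))
... | yes p = s≤s (≤-trans (∑-mono (fins N) (λ {v} _ → ≤-reflexive (ind-no (P? (suc v)) (λ q → 0≢s (uniq p q)))))
                           (≤-reflexive (∑-zero (fins N))))
  where 0≢s : ∀ {v : Fin N} → ¬ (Fin.zero ≡ suc v)
        0≢s ()

∣∣-∑ : ∀ {N} (p : Subset N) → ∣ p ∣ ≡ ∑ (fins N) (λ v → ind (v ∈? p))
∣∣-∑ []                = refl
∣∣-∑ {suc N} (b ∷ p) = trans (step b) (sym (∑-fins N (λ v → ind (v ∈? (b ∷ p)))))
  where
  tl : ∀ b → ∑ (fins N) (λ v → ind (v ∈? p)) ≡ ∑ (fins N) (λ v → ind (suc v ∈? (b ∷ p)))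
  tl b = ∑-cong (fins N) (λ v → ≤-antisym (ind-mono (v ∈? p) (suc v ∈? (b ∷ p)) there)
                                          (ind-mono (suc v ∈? (b ∷ p)) (v ∈? p) drop-there))
  step : ∀ b → ∣ b ∷ p ∣ ≡ ind (zero ∈? (b ∷ p)) + ∑ (fins N) (λ v → ind (suc v ∈? (b ∷ p)))
  step inside  = cong suc (trans (∣∣-∑ p) (tl inside))
  step outside = trans (∣∣-∑ p) (tl outside)

∏ : List 𝓐 → (𝓐 → ℕ) → ℕ
∏ []       f = 1
∏ (x ∷ xs) f = f x * ∏ xs f

-- The sample space: independent uniform weights for `N` vertices, each word having probability 1 /
-- `L ^ N`.
words : ℕ → (N : ℕ) → List (Vec ℕ N)
words L zero    = [] ∷ []
words L (suc N) = concatMap (λ a → map (a ∷_) (words L N)) (range 0 L)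

∑-words : ∀ L N (f : Vec ℕ (suc N) → ℕ) →
          ∑ (words L (suc N)) f ≡ ∑ (range 0 L) (λ a → ∑ (words L N) (λ x → f (a ∷ x)))
∑-words L N f = trans (∑-concatMap _ (range 0 L) f)
                      (∑-cong (range 0 L) (λ a → ∑-map (a ∷_) (words L N) f))

∑-words-const : ∀ L N c → ∑ (words L N) (λ _ → c) ≡ L ^ N * c
∑-words-const L zero    c = refl
∑-words-const L (suc N) c = begin
  ∑ (words L (suc N)) (λ _ → c)  ≡⟨ ∑-words L N (λ _ → c) ⟩
  ∑ (range 0 L) (λ _ → ∑ (words L N) (λ _ → c))  ≡⟨ ∑-const (range 0 L) _ ⟩
  length (range 0 L) * ∑ (words L N) (λ _ → c)  ≡⟨ cong₂ _*_ (length-range 0 L) (∑-words-const L N c) ⟩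
  L * (L ^ N * c)  ≡⟨ sym (*-assoc L (L ^ N) c) ⟩
  L * L ^ N * c  ∎
  where open ≡-Reasoning

words-< : ∀ L N {x : Vec ℕ N} → x ∈ₗ words L N → ∀ v → lookup x v < L
words-< L (suc N) x∈ v with ∈-concatMap⁻ (λ a → map (a ∷_) (words L N)) {xs = range 0 L} x∈
... | p = go (range 0 L) (λ q → proj₂ (∈-range⁻ 0 L q)) p v
  where
  go : ∀ as → (∀ {a} → a ∈ₗ as → a < L) → ∀ {x} → Any (λ a → x ∈ₗ map (a ∷_) (words L N)) as →
       ∀ v → lookup x v < L
  go (a ∷ as) h (here q) v with ∈-map⁻ (a ∷_) q
  go (a ∷ as) h (here q) zero    | y , y∈ , refl = h (here refl)
  go (a ∷ as) h (here q) (suc v) | y , y∈ , refl = words-< L N y∈ v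
  go (a ∷ as) h (there q) v = go as (h ∘ there) q v

Box : ℕ → Set
Box N = Fin N → ℕ × ℕ

InBox : ∀ {N} → Box N → Vec ℕ N → Set
InBox I x = ∀ v → proj₁ (I v) ≤ lookup x v × lookup x v < proj₁ (I v) + proj₂ (I v)

inBox? : ∀ {N} (I : Box N) x → Dec (InBox I x)
inBox? I x = all? (λ v → inInterval? (proj₁ (I v)) (proj₂ (I v)) (lookup x v))

volume : ∀ {N} → Box N → ℕ
volume {N} I = ∏ (fins N) (proj₂ ∘ I)

∏-map : ∀ (h : 𝓐 → 𝓑) (xs : List 𝓐) (f : 𝓑 → ℕ) → ∏ (map h xs) f ≡ ∏ xs (f ∘ h)
∏-map h []       f = refl
∏-map h (x ∷ xs) f = cong (f (h x) *_) (∏-map h xs f)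

-- Only an upper bound, because the intervals of a box may reach beyond `L`.
∑-box≤ : ∀ L {N} (I : Box N) → ∑ (words L N) (λ x → ind (inBox? I x)) ≤ volume I
∑-box≤ L {zero}  I = ≤-trans (≤-reflexive (+-identityʳ _)) (ind≤1 (inBox? I []))
∑-box≤ L {suc N} I = begin
  ∑ (words L (suc N)) (λ x → ind (inBox? I x))
    ≡⟨ ∑-words L N _ ⟩
  ∑ (range 0 L) (λ a → ∑ (words L N) (λ x → ind (inBox? I (a ∷ x))))
    ≤⟨ ∑-mono (range 0 L) (λ {a} _ → ∑-mono (words L N) (λ {x} _ → split a x)) ⟩
  ∑ (range 0 L) (λ a → ∑ (words L N) (λ x → ind (hd? a) * ind (inBox? (I ∘ suc) x)))
    ≡⟨ ∑-cong (range 0 L) (λ a → ∑-*ˡ (words L N) (ind (hd? a)) _) ⟩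
  ∑ (range 0 L) (λ a → ind (hd? a) * ∑ (words L N) (λ x → ind (inBox? (I ∘ suc) x)))
    ≡⟨ ∑-*ʳ (range 0 L) _ (λ a → ind (hd? a)) ⟩
  ∑ (range 0 L) (λ a → ind (hd? a)) * ∑ (words L N) (λ x → ind (inBox? (I ∘ suc) x))
    ≤⟨ *-mono-≤ (∑-interval≤ (proj₁ (I zero)) (proj₂ (I zero)) 0 L) (∑-box≤ L (I ∘ suc)) ⟩
  proj₂ (I zero) * ∏ (fins N) (proj₂ ∘ I ∘ suc)
    ≡⟨ cong (proj₂ (I zero) *_) (sym (∏-map suc (fins N) (proj₂ ∘ I))) ⟩
  volume I ∎
  where
  open ≤-Reasoning
  hd? : ∀ a → Dec _
  hd? a = inInterval? (proj₁ (I zero)) (proj₂ (I zero)) a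
  split : ∀ a x → ind (inBox? I (a ∷ x)) ≤ ind (hd? a) * ind (inBox? (I ∘ suc) x)
  split a x = ≤-trans (ind-mono (inBox? I (a ∷ x)) (hd? a ×-dec inBox? (I ∘ suc) x) (λ h → h zero , h ∘ suc))
                      (≤-reflexive (ind-× (hd? a) (inBox? (I ∘ suc) x)))

-- Chains of edges and the recolouring

tuples : List 𝓐 → ℕ → List (List 𝓐)
tuples es zero    = [] ∷ []
tuples es (suc m) = concatMap (λ e → map (e ∷_) (tuples es m)) es

∈-tuples : ∀ {es t : List 𝓐} → All (_∈ₗ es) t → t ∈ₗ tuples es (length t)
∈-tuples []          = here refl
∈-tuples {es = es} {t = e ∷ t} (e∈ ∷ all) =
  ∈-concatMap⁺ (λ e → map (e ∷_) (tuples es (length t))) (lose e∈ (∈-map⁺ (e ∷_) (∈-tuples all)))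

length-tuples : ∀ {es t : List 𝓐} m → t ∈ₗ tuples es m → length t ≡ m
length-tuples zero (here refl) = refl
length-tuples {es = es} (suc m) t∈ with find (∈-concatMap⁻ (λ e → map (e ∷_) (tuples es m)) {xs = es} t∈)
... | e , _ , q with ∈-map⁻ (e ∷_) q
...   | t′ , t′∈ , refl = cong suc (length-tuples m t′∈)

module Ordered {N : ℕ} (key X : Fin N → ℕ) (lam : ℕ) where

  First Last : Subset N → Fin N → Set
  First e u = u ∈ e × (∀ w → w ∈ e → key u ≤ key w)
  Last  e v = v ∈ e × (∀ w → w ∈ e → key w ≤ key v)

  first? : ∀ e u → Dec (First e u)
  first? e u = (u ∈? e) ×-dec all? (λ w → (w ∈? e) →-dec (key u ≤? key w))

  last? : ∀ e v → Dec (Last e v)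
  last? e v = (v ∈? e) ×-dec all? (λ w → (w ∈? e) →-dec (key w ≤? key v))

  -- Demanding weight spread `lam` from every edge leaves the links little freedom; this is what
  -- keeps the expected number of chains small.
  Chain : Fin N → Fin N → List (Subset N) → Set
  Chain u v []      = u ≡ v
  Chain u v (e ∷ t) = ∃ λ w → First e u × Last e w × X u + lam ≤ X w × Chain w v t

  chain? : ∀ u v t → Dec (Chain u v t)
  chain? u v []      = u ≟F v
  chain? u v (e ∷ t) = any? (λ w → first? e u ×-dec last? e w ×-dec (X u + lam ≤? X w) ×-dec chain? w v t)

  Spans : ℕ → ℕ → List (Subset N) → Fin N → Fin N → Set
  Spans a b t u v = Chain u v t × a ≤ X u × X v ≤ b

  spans? : ∀ a b t u v → Dec (Spans a b t u v)
  spans? a b t u v = chain? u v t ×-dec (a ≤? X u) ×-dec (X v ≤? b)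

  ChainIn : ℕ → ℕ → List (Subset N) → Set
  ChainIn a b t = ∃₂ λ u v → Spans a b t u v

  chainIn? : ∀ a b t → Dec (ChainIn a b t)
  chainIn? a b t = any? (λ u → any? (λ v → spans? a b t u v))

  chain-snoc : ∀ {u w v} t {e} → Chain u w t → First e w → Last e v → X w + lam ≤ X v →
               Chain u v (t ++ e ∷ [])
  chain-snoc []       refl f l x = _ , f , l , x , refl
  chain-snoc (e′ ∷ t) (w′ , f′ , l′ , x′ , c) f l x = w′ , f′ , l′ , x′ , chain-snoc t c f l x

  first-unique : (∀ {u v} → key u ≡ key v → u ≡ v) → ∀ {e u v} → First e u → First e v → u ≡ v
  first-unique inj (u∈ , fu) (v∈ , fv) = inj (≤-antisym (fu _ v∈) (fv _ u∈))

  last-unique : (∀ {u v} → key u ≡ key v → u ≡ v) → ∀ {e u v} → Last e u → Last e v → u ≡ v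
  last-unique inj (u∈ , fu) (v∈ , fv) = inj (≤-antisym (fv _ u∈) (fu _ v∈))

  chain-end-unique : (∀ {u v} → key u ≡ key v → u ≡ v) → ∀ t {u v u′ v′} → 1 ≤ length t →
                     Chain u v t → Chain u′ v′ t → v ≡ v′
  chain-end-unique inj (e ∷ []) _ (w , _ , l , _ , refl) (w′ , _ , l′ , _ , refl) = last-unique inj l l′
  chain-end-unique inj (e ∷ e′ ∷ t) _ (_ , _ , _ , _ , c) (_ , _ , _ , _ , c′) =
    chain-end-unique inj (e′ ∷ t) (s≤s z≤n) c c′

  ∑-starts≤ : (∀ {u v} → key u ≡ key v → u ≡ v) → ∀ a b t → 1 ≤ length t →
              ∑ (fins N) (λ u → ind (any? (spans? a b t u))) ≤ ind (chainIn? a b t)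
  ∑-starts≤ inj a b [] ()
  ∑-starts≤ inj a b (e ∷ t) _ =
    ∑-ind-witness (fins N) (λ u → any? (spans? a b (e ∷ t) u)) (λ u _ p →
      ≤-trans (∑-fins-≤1 (λ u → any? (spans? a b (e ∷ t) u))
                (λ { (_ , (_ , f , _) , _) (_ , (_ , f′ , _) , _) → first-unique inj f f′ }))
              (≤-reflexive (sym (ind-yes (chainIn? a b (e ∷ t)) (u , p)))))

  ∑-ends≤ : (∀ {u v} → key u ≡ key v → u ≡ v) → ∀ a b t → 1 ≤ length t →
            ∑ (fins N) (λ v → ind (any? (λ u → spans? a b t u v))) ≤ ind (chainIn? a b t)
  ∑-ends≤ inj a b t 1≤ =
    ∑-ind-witness (fins N) (λ v → any? (λ u → spans? a b t u v)) (λ v _ p →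
      ≤-trans (∑-fins-≤1 (λ v → any? (λ u → spans? a b t u v))
                (λ { (_ , c , _) (_ , c′ , _) → chain-end-unique inj t 1≤ c c′ }))
              (≤-reflexive (sym (ind-yes (chainIn? a b t) (proj₁ p , v , proj₂ p)))))

-- The deterministic half of the argument. `K` is the ideal block length on the scale of the weights
-- and `ν` the initial block of a vertex; `ν-lower` and `ν-upper` express that the true block
-- boundaries are within `δ` of the ideal ones. `lam` is slightly smaller than `K`, and `wide`
-- measures how slightly.
module Recolour
  {N : ℕ} (key X : Fin N → ℕ) (lam : ℕ)
  (es : List (Subset N)) (s K δ : ℕ) (ν : Fin N → ℕ)
  (ν≤s : ∀ v → ν v ≤ s)
  (lam≤K : lam ≤ K)
  (ν-lower : ∀ v k → k ≤ ν v → k * K ≤ X v + δ)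
  (ν-upper : ∀ v k → ν v < k → X v ≤ k * K + δ)
  (X-top : ∀ v → X v ≤ suc s * K + δ)
  (wide : ∀ i → i ≤ s → i * K + δ + δ < suc i * lam)
  (first-exists : ∀ {e} → e ∈ₗ es → ∃ (Ordered.First key X lam e))
  (last-exists : ∀ {e} → e ∈ₗ es → ∃ (Ordered.Last key X lam e))
  (long : ∀ {e} → e ∈ₗ es → ∀ {u v} → Ordered.First key X lam e u → Ordered.Last key X lam e v → X u + lam ≤ X v)
  (no-chain : ∀ t → All (_∈ₗ es) t → length t ≡ suc s → ∀ u v → ¬ Ordered.Chain key X lam u v t)
  where

  open Ordered key X lam

  Top : ℕ → Fin N → Set
  Top zero    u = ⊤
  Top (suc j) u = Any (λ e → First e u × ∃ λ w → Last e w × Top j w) es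

  top? : ∀ j u → Dec (Top j u)
  top? zero    u = yes tt
  top? (suc j) u = anyₗ? (λ e → first? e u ×-dec any? (λ w → last? e w ×-dec top? j w)) es

  top-chain : ∀ j u → Top j u → ∃ λ t → All (_∈ₗ es) t × length t ≡ j × ∃ λ v → Chain u v t
  top-chain zero    u _ = [] , [] , refl , u , refl
  top-chain (suc j) u p with find p
  ... | e , e∈ , f , w , l , tp with top-chain j w tp
  ...   | t , all , len , v , c = e ∷ t , e∈ ∷ all , cong suc len , v , w , f , l , long e∈ f l , c

  heightUpTo : ℕ → Fin N → ℕ
  heightUpTo zero    v = 0
  heightUpTo (suc k) v with top? (suc k) v
  ... | yes _ = suc k
  ... | no  _ = heightUpTo k v

  heightUpTo-top : ∀ k v → Top (heightUpTo k v) v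
  heightUpTo-top zero    v = tt
  heightUpTo-top (suc k) v with top? (suc k) v
  ... | yes p = p
  ... | no  _ = heightUpTo-top k v

  heightUpTo-≤ : ∀ k v → heightUpTo k v ≤ k
  heightUpTo-≤ zero    v = z≤n
  heightUpTo-≤ (suc k) v with top? (suc k) v
  ... | yes p = ≤-refl
  ... | no  _ = m≤n⇒m≤1+n (heightUpTo-≤ k v)

  heightUpTo-max : ∀ k v j → j ≤ k → Top j v → j ≤ heightUpTo k v
  heightUpTo-max zero    v j j≤ p = j≤
  heightUpTo-max (suc k) v j j≤ p with top? (suc k) v
  ... | yes _ = j≤
  ... | no ¬q with j ≟ suc k
  ...   | yes refl = ⊥-elim (¬q p)
  ...   | no j≢    = heightUpTo-max k v j (s≤s⁻¹ (≤∧≢⇒< j≤ j≢)) p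

  height : Fin N → ℕ
  height = heightUpTo s

  -- Below the top colour s there must be room for a whole chain starting at v.
  c₀ : Fin N → ℕ
  c₀ v = ν v ⊓ (s ∸ height v)

  c₀+height≤s : ∀ v → c₀ v + height v ≤ s
  c₀+height≤s v = ≤-trans (+-monoˡ-≤ (height v) (m⊓n≤n (ν v) (s ∸ height v)))
                          (≤-reflexive (m∸n+n≡m (heightUpTo-≤ s v)))

  c₀≤ν : ∀ v → c₀ v ≤ ν v
  c₀≤ν v = m⊓n≤m (ν v) (s ∸ height v)

  Tight : Fin N → Set
  Tight v = c₀ v + height v ≡ s

  lowered-tight : ∀ v → c₀ v < ν v → Tight v
  lowered-tight v lt with ⊓-sel (ν v) (s ∸ height v)
  ... | inj₁ eq = ⊥-elim (<-irrefl eq lt)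
  ... | inj₂ eq = trans (cong (_+ height v) eq) (m∸n+n≡m (heightUpTo-≤ s v))

  -- The cap `s` in `height` does no harm: a vertex of height `s` is not the last vertex of any
  -- edge, as that edge would prolong a chain of `s` edges to one of `suc s`.
  height-step : ∀ {e u v} → e ∈ₗ es → First e u → Last e v → height v < height u
  height-step {e} {u} {v} e∈ f l with height v <? s
  ... | yes lt = heightUpTo-max s u _ lt tp
    where tp : Top (suc (height v)) u
          tp = lose e∈ (f , v , l , heightUpTo-top s v)
  ... | no ¬lt with top-chain (suc (height v)) u (lose e∈ (f , v , l , heightUpTo-top s v))
  ...   | t , all , len , w , c =
    ⊥-elim (no-chain t all (trans len (cong suc (≤-antisym (heightUpTo-≤ s v) (≮⇒≥ ¬lt)))) u w c)

  -- Only the first vertex of e is inspected: pushing too often is harmless, and then a pushed vertex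
  -- yields a chain without any reference to the colours of the other vertices of its edges.
  Pushed : ℕ → Fin N → Set
  Pushed zero    v = Any (λ e → Last e v × ∃ λ u → First e u × c₀ u ≡ 0) es
  Pushed (suc i) v = Any (λ e → Last e v × ∃ λ u → First e u × (c₀ u ≡ suc i ⊎ (c₀ u ≡ i × Pushed i u))) es

  pushed? : ∀ i v → Dec (Pushed i v)
  pushed? zero    v = anyₗ? (λ e → last? e v ×-dec any? (λ u → first? e u ×-dec (c₀ u ≟ 0))) es
  pushed? (suc i) v = anyₗ? (λ e → last? e v ×-dec any? (λ u → first? e u ×-dec
                        ((c₀ u ≟ suc i) ⊎-dec ((c₀ u ≟ i) ×-dec pushed? i u)))) es

  -- Descending through the pushing edges would prolong the chain above v to one of suc s edges.
  tight-unpushed : ∀ i v → c₀ v ≡ i → Tight v → ¬ Pushed i v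
  tight-unpushed i v c₀v tv p = go i c₀v p
    where
    lower : ∀ {e u} → e ∈ₗ es → First e u → Last e v → c₀ u < c₀ v
    lower {e} {u} e∈ f l = +-cancelʳ-< (height v) (c₀ u) (c₀ v) (begin-strict
      c₀ u + height v <⟨ +-monoʳ-< (c₀ u) (height-step e∈ f l) ⟩
      c₀ u + height u ≤⟨ c₀+height≤s u ⟩
      s  ≡⟨ sym tv ⟩
      c₀ v + height v ∎)
      where open ≤-Reasoning
    go : ∀ i → c₀ v ≡ i → Pushed i v → ⊥
    go zero eq p with find p
    ... | e , e∈ , l , u , f , _ = n≮0 (subst (c₀ u <_) eq (lower e∈ f l))
    go (suc i) eq p with find p
    ... | e , e∈ , l , u , f , inj₁ eq′ = <-irrefl (trans eq′ (sym eq)) (lower e∈ f l)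
    ... | e , e∈ , l , u , f , inj₂ (eq′ , p′) = tight-unpushed i u eq′ tu p′
      where
      -- Against the edge the height rises by at least one while `c₀` drops by exactly one, so
      -- tightness passes from `v` to `u`.
      tu : Tight u
      tu = ≤-antisym (c₀+height≤s u) (begin
        s  ≡⟨ sym tv ⟩
        c₀ v + height v  ≡⟨ cong (_+ height v) eq ⟩
        suc i + height v  ≡⟨ sym (+-suc i (height v)) ⟩
        i + suc (height v)  ≤⟨ +-mono-≤ (≤-reflexive (sym eq′)) (height-step e∈ f l) ⟩
        c₀ u + height u  ∎)
        where open ≤-Reasoning

  colour : Fin N → ℕ
  colour v = c₀ v + ind (pushed? (c₀ v) v)

  colour-cases : ∀ v → (colour v ≡ c₀ v × ¬ Pushed (c₀ v) v) ⊎ (colour v ≡ suc (c₀ v) × Pushed (c₀ v) v)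
  colour-cases v with pushed? (c₀ v) v
  ... | yes p = inj₂ (+-comm (c₀ v) 1 , p)
  ... | no ¬p = inj₁ (+-identityʳ (c₀ v) , ¬p)

  -- Lowered vertices are tight, and so are vertices with `c₀ v ≡ s`. Hence a pushed vertex still
  -- has its initial colour, and there is a colour above it to be pushed to.
  pushed-natural : ∀ v → Pushed (c₀ v) v → c₀ v ≡ ν v × c₀ v < s
  pushed-natural v p = ≤-antisym (c₀≤ν v) (≮⇒≥ (λ lt → tight-unpushed _ v refl (lowered-tight v lt) p))
                     , ≤∧≢⇒< (≤-trans (m≤m+n _ _) (c₀+height≤s v)) (λ eq → tight-unpushed _ v refl (tight eq) p)
    where
    tight : c₀ v ≡ s → Tight v
    tight eq = ≤-antisym (c₀+height≤s v) (≤-trans (≤-reflexive (sym eq)) (m≤m+n _ _))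

  colour≤s : ∀ v → colour v ≤ s
  colour≤s v with colour-cases v
  ... | inj₁ (eq , _) = ≤-trans (≤-reflexive eq) (≤-trans (m≤m+n _ _) (c₀+height≤s v))
  ... | inj₂ (eq , p) = ≤-trans (≤-reflexive eq) (proj₂ (pushed-natural v p))

  step-pos : ∀ i {e u v} → e ∈ₗ es → First e u → Last e v → i * lam ≤ X u + δ → suc i * lam ≤ X v + δ
  step-pos i {e} {u} {v} e∈ f l h = begin
    lam + i * lam  ≤⟨ +-monoʳ-≤ lam h ⟩
    lam + (X u + δ)  ≡⟨ eq lam (X u) δ ⟩
    X u + lam + δ  ≤⟨ +-monoˡ-≤ δ (long e∈ f l) ⟩
    X v + δ  ∎
    where open ≤-Reasoning
          eq : ∀ a b c → a + (b + c) ≡ b + a + c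
          eq = solve-∀

  c₀-pos : ∀ i u → c₀ u ≡ i → i * lam ≤ X u + δ
  c₀-pos i u eq = ≤-trans (*-monoʳ-≤ i lam≤K) (ν-lower u i (≤-trans (≤-reflexive (sym eq)) (c₀≤ν u)))

  pushed-pos : ∀ i v → Pushed i v → suc i * lam ≤ X v + δ
  pushed-pos zero    v p with find p
  ... | e , e∈ , l , u , f , eq = step-pos 0 e∈ f l (c₀-pos 0 u eq)
  pushed-pos (suc i) v p with find p
  ... | e , e∈ , l , u , f , inj₁ eq = step-pos (suc i) e∈ f l (c₀-pos (suc i) u eq)
  ... | e , e∈ , l , u , f , inj₂ (_ , p′) = step-pos (suc i) e∈ f l (pushed-pos i u p′)

  colour-pos : ∀ v → colour v * lam ≤ X v + δ
  colour-pos v with colour-cases v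
  ... | inj₁ (eq , _) = subst (λ z → z * lam ≤ X v + δ) (sym eq) (c₀-pos _ v refl)
  ... | inj₂ (eq , p) = subst (λ z → z * lam ≤ X v + δ) (sym eq) (pushed-pos _ v p)

  -- If the last vertex of a monochromatic edge was not pushed, it ought to have been, since the
  -- first vertex ended with the same colour. If it was pushed, its weight is too small for the
  -- colour it received.
  proper : ∀ {e} → e ∈ₗ es → ∀ i → ¬ (∀ v → v ∈ e → colour v ≡ i)
  proper {e} e∈ i mono with first-exists e∈ | last-exists e∈
  ... | u , f | v , l with colour-cases v
  ...   | inj₁ (eq , ¬p) = ¬p (subst (λ z → Pushed z v) (trans (sym (mono v (proj₁ l))) eq) (push i (mono u (proj₁ f))))
    where
    push : ∀ i → colour u ≡ i → Pushed i v
    push i ci with colour-cases u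
    push zero    ci | inj₁ (eu , _) = lose e∈ (l , u , f , trans (sym eu) ci)
    push (suc i) ci | inj₁ (eu , _) = lose e∈ (l , u , f , inj₁ (trans (sym eu) ci))
    push zero    ci | inj₂ (eu , p) = case trans (sym eu) ci of λ ()
    push (suc i) ci | inj₂ (eu , p) =
      let e₀ = suc-injective (trans (sym eu) ci) in
      lose e∈ (l , u , f , inj₂ (e₀ , subst (λ z → Pushed z u) e₀ p))
  -- The last vertex `v` comes from block `i - 1`, so its weight is at most `i * K + δ`. The first
  -- vertex has colour `i`, hence weight at least `i * lam - δ`, and the edge adds another `lam`.
  ...   | inj₂ (eq , p) = <-irrefl refl (begin-strict
      i * K + δ + δ  <⟨ wide i (≤-trans (≤-reflexive ci) (colour≤s v)) ⟩
      suc i * lam  ≤⟨ step-pos i e∈ f l (subst (λ z → z * lam ≤ X u + δ) (mono u (proj₁ f)) (colour-pos u)) ⟩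
      X v + δ  ≤⟨ +-monoˡ-≤ δ (ν-upper v i (≤-reflexive (trans (cong suc (sym (proj₁ (pushed-natural v p)))) (trans (sym eq) (sym ci))))) ⟩
      i * K + δ + δ  ∎)
    where
    open ≤-Reasoning
    ci : i ≡ colour v
    ci = sym (mono v (proj₁ l))

  Changed : Fin N → Set
  Changed v = ¬ colour v ≡ ν v

  changed? : ∀ v → Dec (Changed v)
  changed? v = ¬? (colour v ≟ ν v)

  Aligned : ℕ → ℕ → List (Subset N) → Fin N → Fin N → Set
  Aligned i m = Spans (i * K ∸ δ) ((i + m) * K + δ)

  -- Pushes are traced back to a vertex that enters with its colour `c₀`. Each edge on the way
  -- accounts for one colour, so the chain climbs exactly one block per edge.
  pushed-chain : ∀ i v → Pushed i v →
    ∃ λ k → ∃ λ t → ∃ λ u → All (_∈ₗ es) t × k + length t ≡ suc i × 1 ≤ length t × Chain u v t × k * K ≤ X u + δ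
  pushed-chain i v p = go i p
    where
    one : ∀ i {e u} → e ∈ₗ es → First e u → Last e v → c₀ u ≡ i →
      ∃ λ k → ∃ λ t → ∃ λ u → All (_∈ₗ es) t × k + length t ≡ suc i × 1 ≤ length t × Chain u v t × k * K ≤ X u + δ
    one i {e} {u} e∈ f l eq = i , e ∷ [] , u , e∈ ∷ [] , +-comm i 1 , ≤-refl , (v , f , l , long e∈ f l , refl)
                            , ν-lower u i (≤-trans (≤-reflexive (sym eq)) (c₀≤ν u))
    go : ∀ i → Pushed i v →
      ∃ λ k → ∃ λ t → ∃ λ u → All (_∈ₗ es) t × k + length t ≡ suc i × 1 ≤ length t × Chain u v t × k * K ≤ X u + δ
    go zero    p with find p
    ... | e , e∈ , l , u , f , eq = one 0 e∈ f l eq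
    go (suc i) p with find p
    ... | e , e∈ , l , u , f , inj₁ eq = one (suc i) e∈ f l eq
    ... | e , e∈ , l , u , f , inj₂ (_ , p′) with pushed-chain i u p′
    ...   | k , t , u₀ , all , len , 1≤ , c , pos =
      k , t ++ e ∷ [] , u₀ , ++⁺ all (e∈ ∷ []) , len′
        , ≤-trans 1≤ (≤-trans (m≤m+n _ _) (≤-reflexive (sym (length-++ t))))
        , chain-snoc t c f l (long e∈ f l) , pos
      where
      len′ : k + length (t ++ e ∷ []) ≡ suc (suc i)
      len′ rewrite length-++ t {e ∷ []} | +-comm (length t) 1 | +-suc k (length t) = cong suc len

  -- A lowered vertex has `c₀ v + height v ≡ s` but lies in block `suc (c₀ v)` or higher, so the
  -- `height v` edges above it have to fit into equally many top blocks. A pushed vertex ends the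
  -- chain of `pushed-chain`. Such aligned chains are rare, which is why few vertices change.
  changed-chain : ∀ v → Changed v →
    ∃ λ i → ∃ λ t → All (_∈ₗ es) t × i ≤ s × 1 ≤ length t × length t ≤ s ×
      ((∃ λ w → Aligned i (length t) t v w) ⊎ (∃ λ w → Aligned i (length t) t w v))
  changed-chain v ch with colour-cases v
  ... | inj₁ (eq , _) with top-chain (height v) v (heightUpTo-top s v)
  ...   | t , all , len , w , c = suc (c₀ v) , t , all , ≤-trans lt (ν≤s v) , 1≤
                                , ≤-trans (≤-reflexive len) (heightUpTo-≤ s v)
                                , inj₁ (w , c , m≤n+o⇒m∸n≤o (suc (c₀ v) * K) δ (≤-trans (ν-lower v (suc (c₀ v)) lt) (≤-reflexive (+-comm (X v) δ)))
                                , ≤-trans (X-top w) (≤-reflexive (cong (λ z → z * K + δ) (sym tot))))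
    where
    lt : c₀ v < ν v
    lt = ≤∧≢⇒< (c₀≤ν v) (λ q → ch (trans eq q))
    tight : Tight v
    tight = lowered-tight v lt
    1≤ : 1 ≤ length t
    1≤ = subst (1 ≤_) (sym len) (n≢0⇒n>0 (λ h0 → <-irrefl refl (begin-strict
           s ≡⟨ sym tight ⟩ c₀ v + height v ≡⟨ cong (c₀ v +_) h0 ⟩ c₀ v + 0 ≡⟨ +-identityʳ _ ⟩
           c₀ v <⟨ lt ⟩ ν v ≤⟨ ν≤s v ⟩ s ∎)))
      where open ≤-Reasoning
    tot : suc (c₀ v) + length t ≡ suc s
    tot = cong suc (trans (cong (c₀ v +_) len) tight)
  changed-chain v ch | inj₂ (eq , p) with pushed-chain (c₀ v) v p
  ...   | k , t , u , all , len , 1≤ , c , pos =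
    k , t , all , k≤ , 1≤ , t≤ , inj₂ (u , c , m≤n+o⇒m∸n≤o (k * K) δ (≤-trans pos (≤-reflexive (+-comm (X u) δ)))
      , ≤-trans (ν-upper v (suc (c₀ v)) (s≤s (≤-reflexive (sym (proj₁ (pushed-natural v p))))))
                (≤-reflexive (cong (λ z → z * K + δ) (sym len))))
    where
    k≤ : k ≤ s
    k≤ = ≤-trans (m≤m+n k (length t)) (≤-trans (≤-reflexive len) (proj₂ (pushed-natural v p)))
    t≤ : length t ≤ s
    t≤ = ≤-trans (m≤n+m (length t) k) (≤-trans (≤-reflexive len) (proj₂ (pushed-natural v p)))

  alignedIn? : ∀ i m t → Dec (ChainIn (i * K ∸ δ) ((i + m) * K + δ) t)
  alignedIn? i m t = chainIn? (i * K ∸ δ) ((i + m) * K + δ) t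

  alignedCount : ℕ
  alignedCount = ∑ (range 0 (suc s)) λ i → ∑ (range 1 s) λ m → ∑ (tuples es m) λ t → ind (alignedIn? i m t)

  -- The edges of a chain determine both of its end vertices. Each aligned chain is therefore
  -- charged at most twice, once for its start and once for its end.
  changed-count : (∀ {u v} → key u ≡ key v → u ≡ v) →
                  ∑ (fins N) (λ v → ind (changed? v)) ≤ 2 * alignedCount
  changed-count inj = begin
    ∑ (fins N) (λ v → ind (changed? v))
      ≤⟨ ∑-mono (fins N) (λ {v} _ → ind-bound (changed? v) (λ ch → charge v (changed-chain v ch))) ⟩
    ∑ (fins N) (λ v → ∑ I λ i → ∑ M λ m → ∑ (tuples es m) λ t → F i m t v)
      ≡⟨ ∑-swap (fins N) I _ ⟩
    (∑ I λ i → ∑ (fins N) λ v → ∑ M λ m → ∑ (tuples es m) λ t → F i m t v)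
      ≡⟨ ∑-cong I (λ i → ∑-swap (fins N) M _) ⟩
    (∑ I λ i → ∑ M λ m → ∑ (fins N) λ v → ∑ (tuples es m) λ t → F i m t v)
      ≡⟨ ∑-cong I (λ i → ∑-cong M (λ m → ∑-swap (fins N) (tuples es m) _)) ⟩
    (∑ I λ i → ∑ M λ m → ∑ (tuples es m) λ t → ∑ (fins N) λ v → F i m t v)
      ≤⟨ ∑-mono I (λ {i} _ → ∑-mono M (λ {m} m∈ → ∑-mono (tuples es m) (λ {t} t∈ → both i m t (proj₁ (∈-range⁻ 1 s m∈)) t∈))) ⟩
    (∑ I λ i → ∑ M λ m → ∑ (tuples es m) λ t → 2 * ind (alignedIn? i m t))
      ≡⟨ ∑-cong I (λ i → ∑-cong M (λ m → ∑-*ˡ (tuples es m) 2 _)) ⟩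
    (∑ I λ i → ∑ M λ m → 2 * ∑ (tuples es m) λ t → ind (alignedIn? i m t))
      ≡⟨ ∑-cong I (λ i → ∑-*ˡ M 2 _) ⟩
    (∑ I λ i → 2 * ∑ M λ m → ∑ (tuples es m) λ t → ind (alignedIn? i m t))
      ≡⟨ ∑-*ˡ I 2 (λ i → ∑ M λ m → ∑ (tuples es m) λ t → ind (alignedIn? i m t)) ⟩
    2 * alignedCount ∎
    where
    open ≤-Reasoning
    I = range 0 (suc s)
    M = range 1 s
    F : ℕ → ℕ → List (Subset N) → Fin N → ℕ
    F i m t v = ind (any? (spans? (i * K ∸ δ) ((i + m) * K + δ) t v))
              + ind (any? (λ u → spans? (i * K ∸ δ) ((i + m) * K + δ) t u v))
    both : ∀ i m t → 1 ≤ m → t ∈ₗ tuples es m → ∑ (fins N) (λ v → F i m t v) ≤ 2 * ind (alignedIn? i m t)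
    both i m t 1≤m t∈ = begin
      ∑ (fins N) (λ v → F i m t v)
        ≡⟨ ∑-+ (fins N) _ _ ⟩
      _ ≤⟨ +-mono-≤ (∑-starts≤ inj a b t 1≤) (∑-ends≤ inj a b t 1≤) ⟩
      ind (alignedIn? i m t) + ind (alignedIn? i m t)
        ≡⟨ cong (ind (alignedIn? i m t) +_) (sym (+-identityʳ _)) ⟩
      2 * ind (alignedIn? i m t) ∎
      where
      a = i * K ∸ δ
      b = (i + m) * K + δ
      1≤ : 1 ≤ length t
      1≤ = ≤-trans 1≤m (≤-reflexive (sym (length-tuples m t∈)))
    charge : ∀ v → (∃ λ i → ∃ λ t → All (_∈ₗ es) t × i ≤ s × 1 ≤ length t × length t ≤ s ×
               ((∃ λ w → Aligned i (length t) t v w) ⊎ (∃ λ w → Aligned i (length t) t w v))) →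
             1 ≤ (∑ I λ i → ∑ M λ m → ∑ (tuples es m) λ t → F i m t v)
    charge v (i , t , all , i≤ , 1≤ , t≤ , al) = begin
      1 ≤⟨ hit al ⟩
      F i (length t) t v
        ≤⟨ ∑-∈ (λ t′ → F i (length t) t′ v) (∈-tuples all) ⟩
      ∑ (tuples es (length t)) (λ t′ → F i (length t) t′ v)
        ≤⟨ ∑-∈ (λ m → ∑ (tuples es m) λ t → F i m t v) (∈-range⁺ 1 s 1≤ (s≤s t≤)) ⟩
      (∑ M λ m → ∑ (tuples es m) λ t → F i m t v)
        ≤⟨ ∑-∈ (λ i → ∑ M λ m → ∑ (tuples es m) λ t → F i m t v) (∈-range⁺ 0 (suc s) z≤n (s≤s i≤)) ⟩
      _ ∎
      where
      hit : _ → 1 ≤ F i (length t) t v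
      hit (inj₁ p) = ≤-trans (≤-reflexive (sym (ind-yes (any? (spans? (i * K ∸ δ) ((i + length t) * K + δ) t v)) p))) (m≤m+n _ _)
      hit (inj₂ p) = ≤-trans (≤-reflexive (sym (ind-yes (any? (λ u → spans? (i * K ∸ δ) ((i + length t) * K + δ) t u v)) p))) (m≤n+m _ _)

-- Weights, orders and box volumes

-- Orders the vertices by weight, breaking ties by index.
keyOf : ∀ {N} → Vec ℕ N → Fin N → ℕ
keyOf {N} x v = lookup x v * N + toℕ v

keyOf-<  : ∀ {N} (x : Vec ℕ N) u v → lookup x u < lookup x v → keyOf x u < keyOf x v
keyOf-< {N} x u v lt = begin-strict
  lookup x u * N + toℕ u  <⟨ +-monoʳ-< (lookup x u * N) (toℕ<n u) ⟩
  lookup x u * N + N  ≡⟨ +-comm (lookup x u * N) N ⟩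
  suc (lookup x u) * N  ≤⟨ *-monoˡ-≤ N lt ⟩
  lookup x v * N  ≤⟨ m≤m+n _ _ ⟩
  keyOf x v  ∎
  where open ≤-Reasoning

keyOf-mono : ∀ {N} (x : Vec ℕ N) {u v} → keyOf x u ≤ keyOf x v → lookup x u ≤ lookup x v
keyOf-mono x {u} {v} le = ≮⇒≥ (λ lt → <⇒≱ (keyOf-< x v u lt) le)

keyOf-injective : ∀ {N} (x : Vec ℕ N) {u v} → keyOf x u ≡ keyOf x v → u ≡ v
keyOf-injective {N} x {u} {v} eq = toℕ-injective (+-cancelˡ-≡ (lookup x u * N) _ _
  (trans eq (cong (λ z → z * N + toℕ v) (sym same))))
  where same : lookup x u ≡ lookup x v
        same = ≤-antisym (keyOf-mono x (≤-reflexive eq)) (keyOf-mono x (≤-reflexive (sym eq)))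

bernoulli : ∀ a m → a ^ suc m + suc m * a ^ m ≤ suc a ^ suc m
bernoulli a zero    = ≤-reflexive (eq a)
  where eq : ∀ a → a * 1 + 1 ≡ suc (a * 1)
        eq = solve-∀
bernoulli a (suc m) = begin
  a * (a * p) + suc (suc m) * (a * p)  ≤⟨ m≤m+n _ (suc m * p) ⟩
  a * (a * p) + suc (suc m) * (a * p) + suc m * p ≡⟨ eq a m p ⟩
  suc a * (a * p + suc m * p)  ≤⟨ *-monoʳ-≤ (suc a) (bernoulli a m) ⟩
  suc a ^ suc (suc m)  ∎
  where open ≤-Reasoning
        p = a ^ m
        eq : ∀ a m p → a * (a * p) + suc (suc m) * (a * p) + suc m * p ≡ suc a * (a * p + suc m * p)
        eq = solve-∀

∣─∣+∣∩∣ : ∀ {N} (p q : Subset N) → ∣ p ─ q ∣ + ∣ p ∩ q ∣ ≡ ∣ p ∣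
∣─∣+∣∩∣ []            []            = refl
∣─∣+∣∩∣ (inside ∷ p)  (inside ∷ q)  = trans (+-suc _ _) (cong suc (∣─∣+∣∩∣ p q))
∣─∣+∣∩∣ (inside ∷ p)  (outside ∷ q) = cong suc (∣─∣+∣∩∣ p q)
∣─∣+∣∩∣ (outside ∷ p) (inside ∷ q)  = ∣─∣+∣∩∣ p q
∣─∣+∣∩∣ (outside ∷ p) (outside ∷ q) = ∣─∣+∣∩∣ p q

x∈p─q⇒x∉q : ∀ {N} (p q : Subset N) {x} → x ∈ p ─ q → x ∉ q
x∈p─q⇒x∉q (b ∷ p) (inside ∷ q)  () here
x∈p─q⇒x∉q (b ∷ p) (c ∷ q) (there x∈) (there x∈q) = x∈p─q⇒x∉q p q x∈ x∈q

override : ∀ {N} → Subset N → ℕ × ℕ → Box N → Box N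
override S iv I v with v ∈? S
... | yes _ = iv
... | no  _ = I v

override-in : ∀ {N} (S : Subset N) iv I {v} → v ∈ S → override S iv I v ≡ iv
override-in S iv I {v} v∈ with v ∈? S
... | yes _ = refl
... | no v∉ = ⊥-elim (v∉ v∈)

override-out : ∀ {N} (S : Subset N) iv I {v} → v ∉ S → override S iv I v ≡ I v
override-out S iv I {v} v∉ with v ∈? S
... | yes v∈ = ⊥-elim (v∉ v∈)
... | no _   = refl

override-∋ : ∀ {N} (x : Vec ℕ N) (S : Subset N) iv I z →
             (z ∈ S → proj₁ iv ≤ lookup x z × lookup x z < proj₁ iv + proj₂ iv) →
             (proj₁ (I z) ≤ lookup x z × lookup x z < proj₁ (I z) + proj₂ (I z)) →
             proj₁ (override S iv I z) ≤ lookup x z ×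
             lookup x z < proj₁ (override S iv I z) + proj₂ (override S iv I z)
override-∋ x S iv I z h k with z ∈? S
... | yes z∈ = h z∈
... | no  _  = k

∏-cong : ∀ {A : Set} (xs : List A) {f g : A → ℕ} → (∀ x → f x ≡ g x) → ∏ xs f ≡ ∏ xs g
∏-cong []       h = refl
∏-cong (x ∷ xs) h = cong₂ _*_ (h x) (∏-cong xs h)

volume-cons : ∀ {N} (I : Box (suc N)) → volume I ≡ proj₂ (I zero) * volume (I ∘ suc)
volume-cons {N} I = cong (proj₂ (I zero) *_) (∏-map suc (fins N) (proj₂ ∘ I))

volume-override : ∀ L {N} (S : Subset N) lo len (I : Box N) → (∀ {v} → v ∈ S → proj₂ (I v) ≡ L) →
                  volume (override S (lo , len) I) * L ^ ∣ S ∣ ≡ volume I * len ^ ∣ S ∣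
volume-override L []      lo len I full = refl
volume-override L {suc N} (b ∷ S) lo len I full =
  trans (cong (_* L ^ ∣ b ∷ S ∣) (trans (volume-cons (override (b ∷ S) (lo , len) I))
          (cong (proj₂ (override (b ∷ S) (lo , len) I zero) *_) (∏-cong (fins N) tl))))
        (step b full)
  where
  ih : volume (override S (lo , len) (I ∘ suc)) * L ^ ∣ S ∣ ≡ volume (I ∘ suc) * len ^ ∣ S ∣
  ih = volume-override L S lo len (I ∘ suc) (λ v∈ → full (there v∈))
  tl : ∀ v → proj₂ (override (b ∷ S) (lo , len) I (suc v)) ≡ proj₂ (override S (lo , len) (I ∘ suc) v)
  tl v = by (v ∈? S)
    where
    by : Dec (v ∈ S) → proj₂ (override (b ∷ S) (lo , len) I (suc v)) ≡ proj₂ (override S (lo , len) (I ∘ suc) v)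
    by (yes v∈) = cong proj₂ (trans (override-in (b ∷ S) (lo , len) I (there v∈))
                                    (sym (override-in S (lo , len) (I ∘ suc) v∈)))
    by (no v∉)  = cong proj₂ (trans (override-out (b ∷ S) (lo , len) I (λ p → v∉ (drop-there p)))
                                    (sym (override-out S (lo , len) (I ∘ suc) v∉)))
  V = volume (override S (lo , len) (I ∘ suc))
  eqi : ∀ l V L p → l * V * (L * p) ≡ L * l * (V * p)
  eqi = solve-∀
  eqi′ : ∀ l V L p → L * l * (V * p) ≡ L * V * (l * p)
  eqi′ = solve-∀
  step : ∀ b → (∀ {v} → v ∈ (b ∷ S) → proj₂ (I v) ≡ L) →
         proj₂ (override (b ∷ S) (lo , len) I zero) * V * L ^ ∣ b ∷ S ∣ ≡ volume I * len ^ ∣ b ∷ S ∣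
  step inside full = trans (eqi len V L (L ^ ∣ S ∣)) (trans (cong (L * len *_) ih)
    (trans (eqi′ len (volume (I ∘ suc)) L (len ^ ∣ S ∣))
      (cong (_* (len * len ^ ∣ S ∣)) (trans (cong (_* volume (I ∘ suc)) (sym (full here))) (sym (volume-cons I))))))
  step outside full = trans (*-assoc (proj₂ (I zero)) V (L ^ ∣ S ∣)) (trans (cong (proj₂ (I zero) *_) ih)
    (trans (sym (*-assoc (proj₂ (I zero)) _ _)) (cong (_* len ^ ∣ S ∣) (sym (volume-cons I)))))

volume-full : ∀ L N → volume {N} (λ _ → 0 , L) ≡ L ^ N
volume-full L zero    = refl
volume-full L (suc N) = trans (volume-cons {N} (λ _ → 0 , L)) (cong (L *_) (volume-full L N))

2ab≤a²+b² : ∀ a b → 2 * (a * b) ≤ a * a + b * b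
2ab≤a²+b² a b with ≤-total a b
... | inj₁ le = go a b le
  where
  eq : ∀ a d → a * a + (a + d) * (a + d) ≡ 2 * (a * (a + d)) + d * d
  eq = solve-∀
  go : ∀ a b → a ≤ b → 2 * (a * b) ≤ a * a + b * b
  go a b le with m≤n⇒∃[o]m+o≡n le
  ... | d , refl = ≤-trans (m≤m+n _ (d * d)) (≤-reflexive (sym (eq a d)))
... | inj₂ le with m≤n⇒∃[o]m+o≡n le
...   | d , refl = ≤-trans (m≤m+n _ (d * d)) (≤-reflexive (sym (eq b d)))
  where
  eq : ∀ b d → (b + d) * (b + d) + b * b ≡ 2 * ((b + d) * b) + d * d
  eq = solve-∀

-- The convex function `A ^ suc k` lies above its tangent at `q`; the negative term has been moved
-- to the other side.
weighted-bernoulli : ∀ A q k → suc k * (A * q ^ k) ≤ A ^ suc k + k * q ^ suc k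
weighted-bernoulli A q zero    = ≤-reflexive (eq A)
  where eq : ∀ A → 1 * (A * 1) ≡ A * 1 + 0
        eq = solve-∀
weighted-bernoulli A q (suc k) = +-cancelʳ-≤ (k * (A * (q * p))) _ _ (begin
  suc (suc k) * (A * (q * p)) + k * (A * (q * p))  ≡⟨ eq₁ A q k p ⟩
  suc k * p * (2 * (A * q))  ≤⟨ *-monoʳ-≤ (suc k * p) (2ab≤a²+b² A q) ⟩
  suc k * p * (A * A + q * q)  ≡⟨ eq₂ A q k p ⟩
  A * (suc k * (A * p)) + suc k * (q * (q * p))  ≤⟨ +-monoˡ-≤ _ (*-monoʳ-≤ A (weighted-bernoulli A q k)) ⟩
  A * (A ^ suc k + k * (q * p)) + suc k * (q * (q * p)) ≡⟨ eq₃ A q k p (A ^ suc k) ⟩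
  A * A ^ suc k + suc k * (q * (q * p)) + k * (A * (q * p)) ∎)
  where
  open ≤-Reasoning
  p = q ^ k
  eq₁ : ∀ A q k p → suc (suc k) * (A * (q * p)) + k * (A * (q * p)) ≡ suc k * p * (2 * (A * q))
  eq₁ = solve-∀
  eq₂ : ∀ A q k p → suc k * p * (A * A + q * q) ≡ A * (suc k * (A * p)) + suc k * (q * (q * p))
  eq₂ = solve-∀
  eq₃ : ∀ A q k p P → A * (P + k * (q * p)) + suc k * (q * (q * p)) ≡ A * P + suc k * (q * (q * p)) + k * (A * (q * p))
  eq₃ = solve-∀

^-*-distrib : ∀ a b k → (a * b) ^ k ≡ a ^ k * b ^ k
^-*-distrib a b zero    = refl
^-*-distrib a b (suc k) rewrite ^-*-distrib a b k = eq a b (a ^ k) (b ^ k)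
  where eq : ∀ a b p q → a * b * (p * q) ≡ a * p * (b * q)
        eq = solve-∀

-- The tangent inequality for `m * (x + S)` and `suc m * S`, which agree precisely when `x` is the
-- mean of the `m` numbers with sum `S`.
amgm-step : ∀ m x S → suc m ^ suc m * (x * S ^ m) ≤ m ^ m * (x + S) ^ suc m
amgm-step zero    x S = ≤-trans (≤-reflexive (e₁ x)) (≤-trans (m≤m+n x S) (≤-reflexive (e₂ (x + S))))
  where e₁ : ∀ x → 1 * (x * 1) ≡ x
        e₁ = solve-∀
        e₂ : ∀ y → y ≡ 1 * (y * 1)
        e₂ = solve-∀
amgm-step (suc k) x S = *-cancelˡ-≤ m (+-cancelʳ-≤ (m * (q * q ^ m)) _ _ (begin
  m * (suc m ^ suc m * (x * S ^ m)) + m * (q * q ^ m)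
    ≡⟨ cong (λ z → m * (suc m ^ suc m * (x * S ^ m)) + m * (q * z)) (^-*-distrib (suc m) S m) ⟩
  m * (suc m * suc m ^ m * (x * S ^ m)) + m * (q * (suc m ^ m * S ^ m))
    ≡⟨ eq m x S (suc m ^ m) (S ^ m) ⟩
  suc m * (A * (suc m ^ m * S ^ m))
    ≡⟨ cong (λ z → suc m * (A * z)) (sym (^-*-distrib (suc m) S m)) ⟩
  suc m * (A * q ^ m)
    ≤⟨ weighted-bernoulli A q m ⟩
  A ^ suc m + m * q ^ suc m
    ≡⟨ cong (_+ m * q ^ suc m) (trans (^-*-distrib m (x + S) (suc m)) (*-assoc m (m ^ m) _)) ⟩
  m * (m ^ m * (x + S) ^ suc m) + m * (q * q ^ m) ∎))
  where
  open ≤-Reasoning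
  m = suc k
  A = m * (x + S)
  q = suc m * S
  eq : ∀ m x S a b → m * (suc m * a * (x * b)) + m * (suc m * S * (a * b)) ≡ suc m * (m * (x + S) * (a * b))
  eq = solve-∀

-- Serves to bound the product of the gaps of a chain by its value for equally spaced links.
amgm : ∀ xs → length xs ^ length xs * product xs ≤ sum xs ^ length xs
amgm []       = ≤-refl
amgm (x ∷ xs) = cancel (length xs) (begin
  m ^ m * (suc m ^ suc m * (x * P))  ≡⟨ eq (m ^ m) (suc m ^ suc m) x P ⟩
  suc m ^ suc m * (x * (m ^ m * P))  ≤⟨ *-monoʳ-≤ (suc m ^ suc m) (*-monoʳ-≤ x (amgm xs)) ⟩
  suc m ^ suc m * (x * sum xs ^ m)  ≤⟨ amgm-step m x (sum xs) ⟩
  m ^ m * (x + sum xs) ^ suc m  ∎)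
  where
  open ≤-Reasoning
  m = length xs
  P = product xs
  eq : ∀ a b x P → a * (b * (x * P)) ≡ b * (x * (a * P))
  eq = solve-∀
  cancel : ∀ k {a b} → k ^ k * a ≤ k ^ k * b → a ≤ b
  cancel zero    {a} {b} h = subst₂ _≤_ (*-identityˡ a) (*-identityˡ b) h
  cancel (suc k) h = *-cancelˡ-≤ (suc k ^ suc k) {{m^n≢0 (suc k) (suc k)}} h

-- Positions y₁, …, yₘ of the links of a chain of m + 1 edges inside [a, b].
module Gaps (lam b : ℕ) where

  links : ℕ → ℕ → List (List ℕ)
  links a zero    with a + lam ≤? b
  ... | yes _ = [] ∷ []
  ... | no  _ = []
  links a (suc m) = concatMap (λ y → map (y ∷_) (links y m)) (range (a + lam) (suc b ∸ (a + lam)))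

  gaps : ℕ → List ℕ → List ℕ
  gaps a []       = suc b ∸ a ∷ []
  gaps a (y ∷ ys) = suc y ∸ a ∷ gaps y ys

  ∈-links⁺ : ∀ {a m y ys} → a + lam ≤ y → y ≤ b → ys ∈ₗ links y m → y ∷ ys ∈ₗ links a (suc m)
  ∈-links⁺ {a} {m} {y} {ys} a≤y y≤b ys∈ =
    ∈-concatMap⁺ (λ y → map (y ∷_) (links y m))
      (lose (∈-range⁺ (a + lam) (suc b ∸ (a + lam)) a≤y
              (≤-trans (s≤s y≤b) (≤-reflexive (sym (m+[n∸m]≡n (≤-trans a≤y (m≤n⇒m≤1+n y≤b)))))))
            (∈-map⁺ (y ∷_) ys∈))

  ∈-links⁻ : ∀ a m {ys} → ys ∈ₗ links a (suc m) →
             ∃₂ λ y ys′ → ys ≡ y ∷ ys′ × a + lam ≤ y × y ≤ b × ys′ ∈ₗ links y m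
  ∈-links⁻ a m ys∈ with find (∈-concatMap⁻ (λ y → map (y ∷_) (links y m)) {xs = range (a + lam) (suc b ∸ (a + lam))} ys∈)
  ... | y , y∈ , q with ∈-map⁻ (y ∷_) q | ∈-range⁻ (a + lam) (suc b ∸ (a + lam)) y∈
  ...   | ys′ , ys′∈ , refl | lo , hi = y , ys′ , refl , lo , y≤b , ys′∈
    where
    y≤b : y ≤ b
    y≤b with ≤-total (a + lam) (suc b)
    ... | inj₁ le = s≤s⁻¹ (≤-trans hi (≤-reflexive (m+[n∸m]≡n le)))
    ... | inj₂ ge = ⊥-elim (<-irrefl refl (≤-<-trans lo (≤-trans hi (≤-reflexive
                      (trans (cong (a + lam +_) (m≤n⇒m∸n≡0 ge)) (+-identityʳ _))))))

  links-zero : ∀ {a ys} → ys ∈ₗ links a 0 → ys ≡ [] × a + lam ≤ b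
  links-zero {a} ys∈ with a + lam ≤? b
  links-zero (here refl) | yes le = refl , le
  links-zero ()          | no _

  length-gaps : ∀ {a} m {ys} → ys ∈ₗ links a m → length (gaps a ys) ≡ suc m
  length-gaps zero    ys∈ with links-zero ys∈
  ... | refl , _ = refl
  length-gaps {a} (suc m) ys∈ with ∈-links⁻ a m ys∈
  ... | y , ys′ , refl , _ , _ , ys′∈ = cong suc (length-gaps {y} m ys′∈)

  -- Gaps are closed intervals, so every link belongs to two of them; this is the extra `m`.
  sum-gaps : ∀ {a} m {ys} → ys ∈ₗ links a m → sum (gaps a ys) ≡ suc b ∸ a + m
  sum-gaps zero    ys∈ with links-zero ys∈
  ... | refl , _ = refl
  sum-gaps {a} (suc m) ys∈ with ∈-links⁻ a m ys∈
  ... | y , ys′ , refl , lo , hi , ys′∈ = begin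
    (suc y ∸ a) + sum (gaps y ys′)  ≡⟨ cong₂ _+_ (+-∸-assoc 1 a≤y) (sum-gaps {y} m ys′∈) ⟩
    suc (y ∸ a) + (suc b ∸ y + m)  ≡⟨ eq (y ∸ a) (suc b ∸ y) m ⟩
    (suc b ∸ y) + (y ∸ a) + suc m  ≡⟨ cong (_+ suc m) (trans (sym (+-∸-assoc (suc b ∸ y) a≤y)) (cong (_∸ a) (m∸n+n≡m (m≤n⇒m≤1+n hi)))) ⟩
    suc b ∸ a + suc m  ∎
    where
    open ≡-Reasoning
    a≤y : a ≤ y
    a≤y = ≤-trans (m≤m+n a lam) lo
    eq : ∀ p q m → suc p + (q + m) ≡ q + p + suc m
    eq = solve-∀

  -- (z + m)^m / m! bounds the number of lattice points of a simplex of side z; the factorial is what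
  -- makes the constant in the theorem independent of r.
  simplex : ℕ → ℕ → ℕ
  simplex m zero    = 0
  simplex m (suc z) = (z + m) ^ m

  -- The discrete counterpart of integrating `z ^ m`: by `bernoulli` each summand is at most a
  -- difference of consecutive values of `simplex (suc m)`, and the sum telescopes.
  simplex-step : ∀ m T s k → ∑ (range s k) (λ y → suc m * simplex m (T ∸ y)) ≤ simplex (suc m) (T ∸ s)
  simplex-step m T s zero    = z≤n
  simplex-step m T s (suc k) = ≤-trans (+-monoʳ-≤ (suc m * simplex m (T ∸ s)) (simplex-step m T (suc s) k)) (tele (T ∸ s) (T ∸ suc s) pred-∸)
    where
    pred-∸ : T ∸ suc s ≡ pred (T ∸ s)
    pred-∸ = sym (pred[m∸n]≡m∸[1+n] T s)
    below : ∀ z → simplex (suc m) z ≤ (z + m) ^ suc m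
    below zero    = z≤n
    below (suc z) = ≤-reflexive (cong (_^ suc m) (+-suc z m))
    tele : ∀ z z′ → z′ ≡ pred z → suc m * simplex m z + simplex (suc m) z′ ≤ simplex (suc m) z
    tele zero    .0 refl = ≤-reflexive (trans (+-identityʳ _) (*-zeroʳ (suc m)))
    tele (suc z) .z refl = begin
      suc m * (z + m) ^ m + simplex (suc m) z  ≤⟨ +-monoʳ-≤ (suc m * (z + m) ^ m) (below z) ⟩
      suc m * (z + m) ^ m + (z + m) ^ suc m  ≡⟨ +-comm (suc m * (z + m) ^ m) _ ⟩
      (z + m) ^ suc m + suc m * (z + m) ^ m  ≤⟨ bernoulli (z + m) m ⟩
      suc (z + m) ^ suc m  ≡⟨ cong (_^ suc m) (sym (+-suc z m)) ⟩
      (z + suc m) ^ suc m  ∎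
      where open ≤-Reasoning

  -- Each of the `suc m` edges uses up `lam`. What remains of the interval is the side of the
  -- simplex in which the links move.
  length-links : ∀ a m → length (links a m) * m ! ≤ simplex m (suc b ∸ (a + suc m * lam))
  length-links a zero with a + lam ≤? b
  ... | no _  = z≤n
  ... | yes le = pos (suc b ∸ (a + 1 * lam)) (m<n⇒0<n∸m (s≤s (≤-trans (≤-reflexive (cong (a +_) (*-identityˡ lam))) le)))
    where pos : ∀ z → 0 < z → 1 ≤ simplex 0 z
          pos (suc z) _ = ≤-refl
  length-links a (suc m) = begin
    length (links a (suc m)) * suc m !
      ≡⟨ cong (_* suc m !) (trans (sym (*-identityʳ (length (links a (suc m))))) (trans (sym (∑-const (links a (suc m)) 1))
           (trans (∑-concatMap (λ y → map (y ∷_) (links y m)) R (λ _ → 1)) (∑-cong R (λ y → trans (∑-map (y ∷_) (links y m) (λ _ → 1)) (trans (∑-const (links y m) 1) (*-identityʳ _))))))) ⟩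
    ∑ R (λ y → length (links y m)) * suc m !
      ≡⟨ sym (∑-*ʳ R (suc m !) _) ⟩
    ∑ R (λ y → length (links y m) * suc m !)
      ≤⟨ ∑-mono R (λ {y} _ → ≤-trans (≤-reflexive (eq (length (links y m)) (suc m) (m !))) (*-monoʳ-≤ (suc m) (≤-trans (length-links y m) (≤-reflexive (cong (simplex m) (idx y)))))) ⟩
    ∑ R (λ y → suc m * simplex m (T ∸ y))
      ≤⟨ simplex-step m T (a + lam) (suc b ∸ (a + lam)) ⟩
    simplex (suc m) (T ∸ (a + lam))
      ≡⟨ cong (simplex (suc m)) (trans (∸-+-assoc (suc b) (suc m * lam) (a + lam)) (cong (suc b ∸_) (eq′ (suc m * lam) a lam))) ⟩
    simplex (suc m) (suc b ∸ (a + suc (suc m) * lam)) ∎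
    where
    open ≤-Reasoning
    R = range (a + lam) (suc b ∸ (a + lam))
    T = suc b ∸ suc m * lam
    eq : ∀ x k f → x * (k * f) ≡ k * (x * f)
    eq = solve-∀
    eq′ : ∀ p a l → p + (a + l) ≡ a + (l + p)
    eq′ = solve-∀
    idx : ∀ y → suc b ∸ (y + suc m * lam) ≡ T ∸ y
    idx y = trans (cong (suc b ∸_) (+-comm y (suc m * lam))) (sym (∸-+-assoc (suc b) (suc m * lam) y))

-- Expected number of chains

-- Trades the τ vertices lost by trimming an edge for a factor ρ each.
exchange-powers : ∀ L len ρ s τ n′ → len ≤ L → L ≤ ρ * len → 1 ≤ ρ → n′ ≤ s + τ →
                  len ^ s * L ^ n′ ≤ L ^ s * (len ^ n′ * ρ ^ τ)
exchange-powers L len ρ s τ n′ len≤L L≤ 1≤ρ n′≤ with ≤-total n′ s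
... | inj₁ le with m≤n⇒∃[o]m+o≡n le
...   | d , refl = begin
  len ^ (n′ + d) * L ^ n′  ≡⟨ cong (_* L ^ n′) (^-distribˡ-+-* len n′ d) ⟩
  len ^ n′ * len ^ d * L ^ n′  ≤⟨ *-monoˡ-≤ (L ^ n′) (*-monoʳ-≤ (len ^ n′) (^-monoˡ-≤ d len≤L)) ⟩
  len ^ n′ * L ^ d * L ^ n′  ≡⟨ eq (len ^ n′) (L ^ d) (L ^ n′) ⟩
  L ^ n′ * L ^ d * (len ^ n′ * 1)  ≤⟨ *-monoʳ-≤ (L ^ n′ * L ^ d) (*-monoʳ-≤ (len ^ n′) (m^n>0 ρ {{>-nonZero 1≤ρ}} τ)) ⟩
  L ^ n′ * L ^ d * (len ^ n′ * ρ ^ τ)  ≡⟨ cong (_* (len ^ n′ * ρ ^ τ)) (sym (^-distribˡ-+-* L n′ d)) ⟩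
  L ^ (n′ + d) * (len ^ n′ * ρ ^ τ)  ∎
  where open ≤-Reasoning
        eq : ∀ a b c → a * b * c ≡ c * b * (a * 1)
        eq = solve-∀
exchange-powers L len ρ s τ n′ len≤L L≤ 1≤ρ n′≤ | inj₂ le with m≤n⇒∃[o]m+o≡n le
...   | d , refl = begin
  len ^ s * L ^ (s + d)  ≡⟨ cong (len ^ s *_) (^-distribˡ-+-* L s d) ⟩
  len ^ s * (L ^ s * L ^ d)  ≤⟨ *-monoʳ-≤ (len ^ s) (*-monoʳ-≤ (L ^ s) (^-monoˡ-≤ d L≤)) ⟩
  len ^ s * (L ^ s * (ρ * len) ^ d)  ≡⟨ cong (λ z → len ^ s * (L ^ s * z)) (^-*-distrib ρ len d) ⟩
  len ^ s * (L ^ s * (ρ ^ d * len ^ d))  ≡⟨ eq (len ^ s) (L ^ s) (ρ ^ d) (len ^ d) ⟩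
  L ^ s * (len ^ s * len ^ d * ρ ^ d)  ≡⟨ cong (λ z → L ^ s * (z * ρ ^ d)) (sym (^-distribˡ-+-* len s d)) ⟩
  L ^ s * (len ^ (s + d) * ρ ^ d)  ≤⟨ *-monoʳ-≤ (L ^ s) (*-monoʳ-≤ (len ^ (s + d)) (^-monoʳ-≤ ρ {{>-nonZero 1≤ρ}} (+-cancelˡ-≤ s d τ n′≤))) ⟩
  L ^ s * (len ^ (s + d) * ρ ^ τ)  ∎
  where open ≤-Reasoning
        eq : ∀ a b c d → a * (b * (c * d)) ≡ b * (a * d * c)
        eq = solve-∀

module Weighted {N : ℕ} (x : Vec ℕ N) (lam : ℕ) = Ordered (keyOf x) (lookup x) lam

module ChainBound
  {N : ℕ} (L lam b n′ ρ : ℕ) (τ : Subset N → ℕ)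
  (L>0 : 1 ≤ L) (lam>0 : 1 ≤ lam) (ρ>0 : 1 ≤ ρ) (L≤ρlam : L ≤ ρ * lam) where

  open Gaps lam b

  full : Box N
  full _ = 0 , L

  -- The weights allowed by a chain e ∷ t with links at ys; P is the edge preceding e.
  placement : Subset N → ℕ → Subset N → List (Subset N) → List ℕ → Box N
  placement P a e []       ys       = override (e ─ P) (a , suc b ∸ a) full
  placement P a e (e′ ∷ t) []       = full
  placement P a e (e′ ∷ t) (y ∷ ys) =
    override ((e ─ P) ─ e′) (a , suc y ∸ a) (override (e ∩ e′) (y , 1) (placement e y e′ t ys))

  -- Volumes are computed one override at a time, and `volume-override` requires the overridden
  -- coordinates to be free until then.
  placement-full : ∀ P a e t ys {v} → v ∉ e ─ P → All (v ∉_) t → proj₂ (placement P a e t ys v) ≡ L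
  placement-full P a e []       ys v∉ all = cong proj₂ (override-out (e ─ P) (a , suc b ∸ a) full v∉)
  placement-full P a e (e′ ∷ t) [] v∉ all = refl
  placement-full P a e (e′ ∷ t) (y ∷ ys) v∉ (v∉e′ ∷ all) =
    trans (cong proj₂ (trans (override-out ((e ─ P) ─ e′) (a , suc y ∸ a) _ (v∉ ∘ p─q⊆p (e ─ P) e′))
                             (override-out (e ∩ e′) (y , 1) _ (v∉e′ ∘ proj₂ ∘ x∈p∩q⁻ e e′))))
          (placement-full e y e′ t ys (v∉e′ ∘ p─q⊆p e′ e) all)

  module At (x : Vec ℕ N) where
    open Weighted x lam

    chain-X≤ : ∀ t {u v} → Chain u v t → lookup x u ≤ lookup x v
    chain-X≤ []      refl = ≤-refl
    chain-X≤ (e ∷ t) (w , _ , _ , le , c) = ≤-trans (m≤m+n _ lam) (≤-trans le (chain-X≤ t c))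

    step-key< : ∀ {u w} → lookup x u + lam ≤ lookup x w → keyOf x u < keyOf x w
    step-key< {u} {w} le = keyOf-< x u w (≤-trans (≤-trans (≤-reflexive (+-comm 1 _)) (+-monoʳ-≤ (lookup x u) lam>0)) le)

    chain-above : ∀ t {u v} → Chain u v t → All (λ e → ∀ z → z ∈ e → keyOf x u ≤ keyOf x z) t
    chain-above []      c = []
    chain-above (e ∷ t) (w , f , _ , le , c) =
      proj₂ f ∷ mapAll (λ h z z∈ → ≤-trans (<⇒≤ (step-key< le)) (h z z∈)) (chain-above t c)

    edge-interval : ∀ {a y e u w} → First e u → Last e w → a ≤ lookup x u → lookup x w ≤ y → ∀ {z} → z ∈ e →
                    a ≤ lookup x z × lookup x z < a + (suc y ∸ a)
    edge-interval {a} {y} (u∈ , f) (w∈ , l) a≤ ≤y {z} z∈ =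
      a≤z , ≤-trans (s≤s z≤y) (≤-reflexive (sym (m+[n∸m]≡n (≤-trans a≤z (m≤n⇒m≤1+n z≤y)))))
      where
      a≤z : a ≤ lookup x z
      a≤z = ≤-trans a≤ (keyOf-mono x (f z z∈))
      z≤y : lookup x z ≤ y
      z≤y = ≤-trans (keyOf-mono x (l z z∈)) ≤y

    chain-inBox : (∀ v → lookup x v < L) → ∀ P a e t {u v} → Chain u v (e ∷ t) → a ≤ lookup x u → lookup x v ≤ b →
                  ∃ λ ys → ys ∈ₗ links a (length t) × InBox (placement P a e t ys) x
    chain-inBox <L P a e [] (w , f , l , le , refl) a≤ ≤b = [] , ∈₀ , inb
      where
      ∈₀ : [] ∈ₗ links a 0
      ∈₀ with a + lam ≤? b
      ... | yes _ = here refl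
      ... | no ¬p = ⊥-elim (¬p (≤-trans (+-monoˡ-≤ lam a≤) (≤-trans le ≤b)))
      inb : InBox (placement P a e [] []) x
      inb z = override-∋ x (e ─ P) (a , suc b ∸ a) full z (λ z∈ → edge-interval f l a≤ ≤b (p─q⊆p e P z∈)) (z≤n , <L z)
    chain-inBox <L P a e (e′ ∷ t) (w , f , l , le , c@(_ , f′ , _)) a≤ ≤b
      with chain-inBox <L e (lookup x w) e′ t c ≤-refl ≤b
    ... | ys , ys∈ , inb = lookup x w ∷ ys
                         , ∈-links⁺ {m = length t} (≤-trans (+-monoˡ-≤ lam a≤) le) (≤-trans (chain-X≤ (e′ ∷ t) c) ≤b) ys∈ , inb′
      where
      y = lookup x w
      inb′ : InBox (placement P a e (e′ ∷ t) (y ∷ ys)) x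
      inb′ z = override-∋ x ((e ─ P) ─ e′) (a , suc y ∸ a) _ z
                 (λ z∈ → edge-interval f l a≤ ≤-refl (p─q⊆p e P (p─q⊆p (e ─ P) e′ z∈)))
                 (override-∋ x (e ∩ e′) (y , 1) _ z atLink (inb z))
        where
        atLink : z ∈ e ∩ e′ → y ≤ lookup x z × lookup x z < y + 1
        atLink z∈ = keyOf-mono x (proj₂ f′ z (proj₂ (x∈p∩q⁻ e e′ z∈)))
                  , ≤-<-trans (keyOf-mono x (proj₂ l z (proj₁ (x∈p∩q⁻ e e′ z∈)))) (m<m+n y (s≤s z≤n))

    link-size : ∀ {e e′ w} → Last e w → First e′ w → ∣ e ∩ e′ ∣ ≡ 1
    link-size {e} {e′} {w} l f′ = trans (≤-antisym (p⊆q⇒∣p∣≤∣q∣ sub) (p⊆q⇒∣p∣≤∣q∣ sup)) (∣⁅x⁆∣≡1 w)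
      where
      sub : ∀ {z} → z ∈ e ∩ e′ → z ∈ ⁅ w ⁆
      sub {z} z∈ = subst (_∈ ⁅ w ⁆) (keyOf-injective x (≤-antisym (proj₂ f′ z (proj₂ (x∈p∩q⁻ e e′ z∈))) (proj₂ l z (proj₁ (x∈p∩q⁻ e e′ z∈))))) (x∈⁅x⁆ w)
      sup : ∀ {z} → z ∈ ⁅ w ⁆ → z ∈ e ∩ e′
      sup z∈ rewrite x∈⁅y⁆⇒x≡y w z∈ = x∈p∩q⁺ (proj₁ l , proj₁ f′)

    -- An edge shares at most one vertex with each of its two neighbours in the chain; apart from
    -- these and the `τ e` missing vertices, at least `n′` coordinates are confined to its gap.
    -- Every link contributes one coordinate with a single admissible value, hence `length t`
    -- further factors `L`. The chain assumed in one weight vector supplies the intersection pattern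
    -- of the edges on which the volumes depend.
    volume-bound : ∀ P a e t ys {u v} → Chain u v (e ∷ t) → ∣ e ∣ ≤ ∣ e ─ P ∣ + 1 →
                   All (λ e → n′ + 2 ≤ ∣ e ∣ + τ e) (e ∷ t) → suc b ∸ a ≤ L → ys ∈ₗ links a (length t) →
                   volume (placement P a e t ys) * L ^ (suc (length t) * n′ + length t)
                     ≤ L ^ N * (product (gaps a ys) ^ n′ * ∏ (e ∷ t) (λ e → ρ ^ τ e))
    volume-bound P a e [] ys c eP (nτ ∷ []) a≤ ys∈ with links-zero ys∈
    ... | refl , fits = *-cancelʳ-≤ _ _ (L ^ s) {{m^n≢0 L s {{>-nonZero L>0}}}} (begin
      V * L ^ (1 * n′ + 0) * L ^ s  ≡⟨ cong (λ z → V * L ^ z * L ^ s) (trans (+-identityʳ _) (*-identityˡ n′)) ⟩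
      V * L ^ n′ * L ^ s  ≡⟨ eq₁ V (L ^ n′) (L ^ s) ⟩
      V * L ^ s * L ^ n′  ≡⟨ cong (_* L ^ n′) (trans (volume-override L (e ─ P) a len full (λ _ → refl)) (cong (_* len ^ s) (volume-full L N))) ⟩
      L ^ N * len ^ s * L ^ n′  ≡⟨ *-assoc (L ^ N) _ _ ⟩
      L ^ N * (len ^ s * L ^ n′)  ≤⟨ *-monoʳ-≤ (L ^ N) (exchange-powers L len ρ s (τ e) n′ a≤ L≤ρlen ρ>0 small) ⟩
      L ^ N * (L ^ s * (len ^ n′ * ρ ^ τ e))  ≡⟨ eq₂ (L ^ N) (L ^ s) (len ^ n′) (ρ ^ τ e) ⟩
      L ^ N * (len ^ n′ * (ρ ^ τ e * 1)) * L ^ s  ≡⟨ cong (λ z → L ^ N * (z ^ n′ * (ρ ^ τ e * 1)) * L ^ s) (sym (*-identityʳ len)) ⟩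
      L ^ N * ((len * 1) ^ n′ * (ρ ^ τ e * 1)) * L ^ s  ∎)
      where
      open ≤-Reasoning
      V = volume (placement P a e [] [])
      s = ∣ e ─ P ∣
      len = suc b ∸ a
      eq₁ : ∀ a b c → a * b * c ≡ a * c * b
      eq₁ = solve-∀
      eq₂ : ∀ a b c d → a * (b * (c * d)) ≡ a * (c * (d * 1)) * b
      eq₂ = solve-∀
      L≤ρlen : L ≤ ρ * len
      L≤ρlen = ≤-trans L≤ρlam (*-monoʳ-≤ ρ (≤-trans (≤-reflexive (sym (m+n∸m≡n a lam))) (∸-monoˡ-≤ a (m≤n⇒m≤1+n fits))))
      small : n′ ≤ s + τ e
      small = +-cancelʳ-≤ 2 n′ (s + τ e) (≤-trans nτ (≤-trans (+-monoˡ-≤ (τ e) eP) (≤-trans (≤-reflexive (eq₃ s (τ e))) (+-monoʳ-≤ (s + τ e) (s≤s z≤n)))))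
        where eq₃ : ∀ s t → s + 1 + t ≡ s + t + 1
              eq₃ = solve-∀
    volume-bound P a e (e′ ∷ t) ys (w , f , l , le , c@(w′ , f′ , l′ , le′ , c′)) eP (nτ ∷ nτs) a≤ ys∈
      with ∈-links⁻ a (length t) ys∈
    ... | y , ys′ , refl , lo , hi , ys′∈ = *-cancelʳ-≤ _ _ (L ^ s) {{m^n≢0 L s {{>-nonZero L>0}}}} (begin
      V₂ * L ^ (suc (suc k) * n′ + suc k) * L ^ s
        ≡⟨ cong (λ z → V₂ * z * L ^ s) split ⟩
      V₂ * (L * (L ^ n′ * Lk)) * L ^ s
        ≡⟨ eq₁ V₂ L (L ^ n′) Lk (L ^ s) ⟩
      V₂ * L ^ s * (L * (L ^ n′ * Lk))
        ≡⟨ cong (_* (L * (L ^ n′ * Lk))) (volume-override L S a len _ bodyFull) ⟩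
      V₁ * len ^ s * (L * (L ^ n′ * Lk))
        ≡⟨ eq₂ V₁ (len ^ s) L (L ^ n′) Lk ⟩
      V₁ * L * (len ^ s * L ^ n′ * Lk)
        ≡⟨ cong (_* (len ^ s * L ^ n′ * Lk)) linkVol ⟩
      V₀ * (len ^ s * L ^ n′ * Lk)
        ≡⟨ eq₃ V₀ (len ^ s * L ^ n′) Lk ⟩
      V₀ * Lk * (len ^ s * L ^ n′)
        ≤⟨ *-mono-≤ (volume-bound e y e′ t ys′ c e′e nτs (≤-trans (∸-monoʳ-≤ (suc b) a≤y) a≤) ys′∈)
                    (exchange-powers L len ρ s (τ e) n′ (≤-trans (∸-monoˡ-≤ a (s≤s hi)) a≤) L≤ρlen ρ>0 small) ⟩
      L ^ N * (G ^ n′ * R) * (L ^ s * (len ^ n′ * ρ ^ τ e))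
        ≡⟨ eq₄ (L ^ N) (G ^ n′) R (L ^ s) (len ^ n′) (ρ ^ τ e) ⟩
      L ^ N * (len ^ n′ * G ^ n′ * (ρ ^ τ e * R)) * L ^ s
        ≡⟨ cong (λ z → L ^ N * (z * (ρ ^ τ e * R)) * L ^ s) (sym (^-*-distrib len G n′)) ⟩
      L ^ N * ((len * G) ^ n′ * (ρ ^ τ e * R)) * L ^ s ∎)
      where
      open ≤-Reasoning
      k = length t
      S = (e ─ P) ─ e′
      s = ∣ S ∣
      len = suc y ∸ a
      Lk = L ^ (suc k * n′ + k)
      G = product (gaps y ys′)
      R = ∏ (e′ ∷ t) (λ e → ρ ^ τ e)
      V₀ = volume (placement e y e′ t ys′)
      V₁ = volume (override (e ∩ e′) (y , 1) (placement e y e′ t ys′))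
      V₂ = volume (placement P a e (e′ ∷ t) (y ∷ ys′))
      a≤y : a ≤ y
      a≤y = ≤-trans (m≤m+n a lam) lo
      split : L ^ (suc (suc k) * n′ + suc k) ≡ L * (L ^ n′ * Lk)
      split = trans (cong (L ^_) (eq n′ k)) (cong (L *_) (^-distribˡ-+-* L n′ (suc k * n′ + k)))
        where eq : ∀ n k → suc (suc k) * n + suc k ≡ suc (n + (suc k * n + k))
              eq = solve-∀
      eq₁ : ∀ a b c d e → a * (b * (c * d)) * e ≡ a * e * (b * (c * d))
      eq₁ = solve-∀
      eq₂ : ∀ a b c d e → a * b * (c * (d * e)) ≡ a * c * (b * d * e)
      eq₂ = solve-∀
      eq₃ : ∀ a b c → a * (b * c) ≡ a * c * b
      eq₃ = solve-∀
      eq₄ : ∀ a b c d e f → a * (b * c) * (d * (e * f)) ≡ a * (e * b * (f * c)) * d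
      eq₄ = solve-∀
      link1 : ∣ e ∩ e′ ∣ ≡ 1
      link1 = link-size l f′
      -- All edges after `e′` start strictly above the link `w`, so they avoid every vertex up to
      -- `w`, in particular all of `e`.
      later∉ : ∀ {z} → keyOf x z ≤ keyOf x w → All (z ∉_) t
      later∉ {z} z≤w = mapAll (λ h z∈ → <⇒≱ (step-key< le′) (≤-trans (h _ z∈) z≤w)) (chain-above t c′)
      linkFull : ∀ {z} → z ∈ e ∩ e′ → proj₂ (placement e y e′ t ys′ z) ≡ L
      linkFull {z} z∈ = placement-full e y e′ t ys′ (λ q → x∈p─q⇒x∉q e′ e q (proj₁ (x∈p∩q⁻ e e′ z∈)))
                          (later∉ (proj₂ l z (proj₁ (x∈p∩q⁻ e e′ z∈))))
      bodyFull : ∀ {z} → z ∈ S → proj₂ (override (e ∩ e′) (y , 1) (placement e y e′ t ys′) z) ≡ L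
      bodyFull {z} z∈ = trans (cong proj₂ (override-out (e ∩ e′) (y , 1) _ (z∉e′ ∘ proj₂ ∘ x∈p∩q⁻ e e′)))
                              (placement-full e y e′ t ys′ (z∉e′ ∘ p─q⊆p e′ e) (later∉ (proj₂ l z (p─q⊆p e P (p─q⊆p (e ─ P) e′ z∈)))))
        where z∉e′ : z ∉ e′
              z∉e′ = x∈p─q⇒x∉q (e ─ P) e′ z∈
      linkVol : V₁ * L ≡ V₀
      linkVol = trans (cong (V₁ *_) (trans (sym (^-identityʳ L)) (cong (L ^_) (sym link1))))
                (trans (volume-override L (e ∩ e′) y 1 _ linkFull) (trans (cong (V₀ *_) (^-zeroˡ ∣ e ∩ e′ ∣)) (*-identityʳ V₀)))
      e′e : ∣ e′ ∣ ≤ ∣ e′ ─ e ∣ + 1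
      e′e = ≤-reflexive (trans (sym (∣─∣+∣∩∣ e′ e)) (cong (∣ e′ ─ e ∣ +_) (trans (cong ∣_∣ (∩-comm e′ e)) link1)))
      L≤ρlen : L ≤ ρ * len
      L≤ρlen = ≤-trans L≤ρlam (*-monoʳ-≤ ρ (≤-trans (≤-reflexive (sym (m+n∸m≡n a lam))) (∸-monoˡ-≤ a (m≤n⇒m≤1+n lo))))
      small : n′ ≤ s + τ e
      small = +-cancelʳ-≤ 2 n′ (s + τ e) (begin
        n′ + 2  ≤⟨ nτ ⟩
        ∣ e ∣ + τ e  ≤⟨ +-monoˡ-≤ (τ e) eP ⟩
        ∣ e ─ P ∣ + 1 + τ e  ≡⟨ cong (λ z → z + 1 + τ e) (sym (∣─∣+∣∩∣ (e ─ P) e′)) ⟩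
        s + ∣ (e ─ P) ∩ e′ ∣ + 1 + τ e ≤⟨ +-monoˡ-≤ (τ e) (+-monoˡ-≤ 1 (+-monoʳ-≤ s (≤-trans (p⊆q⇒∣p∣≤∣q∣ sub) (≤-reflexive link1)))) ⟩
        s + 1 + 1 + τ e  ≡⟨ eq s (τ e) ⟩
        s + τ e + 2  ∎)
        where
        eq : ∀ s t → s + 1 + 1 + t ≡ s + t + 2
        eq = solve-∀
        sub : ∀ {z} → z ∈ (e ─ P) ∩ e′ → z ∈ e ∩ e′
        sub z∈ with x∈p∩q⁻ (e ─ P) e′ z∈
        ... | p , q = x∈p∩q⁺ (p─q⊆p e P p , q)

  -- Union bound over the link positions. The factor `suc (length t) ^ (suc (length t) * n′)` is the
  -- denominator left by `amgm`.
  chain-bound : ∀ a e t → All (λ e → n′ + 2 ≤ ∣ e ∣ + τ e) (e ∷ t) → suc b ∸ a ≤ L →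
    ∑ (words L N) (λ x → ind (Weighted.chainIn? x lam a b (e ∷ t))) * L ^ (suc (length t) * n′ + length t) * suc (length t) ^ (suc (length t) * n′)
      ≤ L ^ N * length (links a (length t)) * (suc b ∸ a + length t) ^ (suc (length t) * n′) * ∏ (e ∷ t) (λ e → ρ ^ τ e)
  chain-bound a e t nτ a≤ = begin
    C * Lk * m ^ (m * n′)  ≤⟨ *-monoˡ-≤ (m ^ (m * n′)) main ⟩
    L ^ N * (∑ Y (λ ys → product (gaps a ys) ^ n′) * R) * m ^ (m * n′)
                            ≡⟨ eq₁ (L ^ N) (∑ Y (λ ys → product (gaps a ys) ^ n′)) R (m ^ (m * n′)) ⟩
    L ^ N * R * (∑ Y (λ ys → product (gaps a ys) ^ n′) * m ^ (m * n′))
                            ≡⟨ cong (L ^ N * R *_) (sym (∑-*ʳ Y (m ^ (m * n′)) (λ ys → product (gaps a ys) ^ n′))) ⟩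
    L ^ N * R * ∑ Y (λ ys → product (gaps a ys) ^ n′ * m ^ (m * n′))
                            ≤⟨ *-monoʳ-≤ (L ^ N * R) (∑-mono Y (λ {ys} ys∈ → am ys ys∈)) ⟩
    L ^ N * R * ∑ Y (λ _ → (suc b ∸ a + k) ^ (m * n′))
                            ≡⟨ cong (L ^ N * R *_) (∑-const Y _) ⟩
    L ^ N * R * (length Y * (suc b ∸ a + k) ^ (m * n′))
                            ≡⟨ eq₂ (L ^ N) R (length Y) ((suc b ∸ a + k) ^ (m * n′)) ⟩
    L ^ N * length Y * (suc b ∸ a + k) ^ (m * n′) * R ∎
    where
    open ≤-Reasoning
    k = length t
    m = suc k
    Y = links a k
    Lk = L ^ (m * n′ + k)
    R = ∏ (e ∷ t) (λ e → ρ ^ τ e)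
    C = ∑ (words L N) (λ x → ind (Weighted.chainIn? x lam a b (e ∷ t)))
    eq₁ : ∀ a b c d → a * (b * c) * d ≡ a * c * (b * d)
    eq₁ = solve-∀
    eq₂ : ∀ a b c d → a * b * (c * d) ≡ a * c * d * b
    eq₂ = solve-∀
    am : ∀ ys → ys ∈ₗ Y → product (gaps a ys) ^ n′ * m ^ (m * n′) ≤ (suc b ∸ a + k) ^ (m * n′)
    am ys ys∈ = begin
      g ^ n′ * m ^ (m * n′)  ≡⟨ cong (g ^ n′ *_) (sym (^-*-assoc m m n′)) ⟩
      g ^ n′ * (m ^ m) ^ n′  ≡⟨ sym (^-*-distrib g (m ^ m) n′) ⟩
      (g * m ^ m) ^ n′  ≤⟨ ^-monoˡ-≤ n′ (≤-trans (≤-reflexive (*-comm g (m ^ m)))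
                                     (subst₂ (λ z s → z ^ z * g ≤ s ^ z) (length-gaps k ys∈) (sum-gaps k ys∈) (amgm (gaps a ys)))) ⟩
      ((suc b ∸ a + k) ^ m) ^ n′ ≡⟨ ^-*-assoc (suc b ∸ a + k) m n′ ⟩
      (suc b ∸ a + k) ^ (m * n′) ∎
      where g = product (gaps a ys)
    ⊥P : ∣ e ∣ ≤ ∣ e ─ ∅ ∣ + 1
    ⊥P = ≤-trans (≤-reflexive (cong ∣_∣ (sym (p─⊥≡p e)))) (m≤m+n _ 1)
    count≤volumes : C ≤ ∑ Y (λ ys → volume (placement ∅ a e t ys))
    count≤volumes = begin
      C ≤⟨ ∑-mono (words L N) (λ {x} x∈ → ind-bound (Weighted.chainIn? x lam a b (e ∷ t)) (λ { (u , v , c , a≤u , v≤b) →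
             let (ys , ys∈ , inb) = At.chain-inBox x (words-< L N x∈) ∅ a e t c a≤u v≤b in
             ≤-trans (≤-reflexive (sym (ind-yes (inBox? (placement ∅ a e t ys) x) inb)))
                     (∑-∈ (λ ys → ind (inBox? (placement ∅ a e t ys) x)) ys∈) })) ⟩
      ∑ (words L N) (λ x → ∑ Y (λ ys → ind (inBox? (placement ∅ a e t ys) x)))
        ≡⟨ ∑-swap (words L N) Y _ ⟩
      ∑ Y (λ ys → ∑ (words L N) (λ x → ind (inBox? (placement ∅ a e t ys) x)))
        ≤⟨ ∑-mono Y (λ {ys} _ → ∑-box≤ L (placement ∅ a e t ys)) ⟩
      ∑ Y (λ ys → volume (placement ∅ a e t ys)) ∎
    volumes : ∀ x → Weighted.ChainIn x lam a b (e ∷ t) →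
              ∑ Y (λ ys → volume (placement ∅ a e t ys)) * Lk ≤ L ^ N * (∑ Y (λ ys → product (gaps a ys) ^ n′) * R)
    volumes x (u , v , c , _) = begin
      ∑ Y (λ ys → volume (placement ∅ a e t ys)) * Lk
        ≡⟨ sym (∑-*ʳ Y Lk _) ⟩
      ∑ Y (λ ys → volume (placement ∅ a e t ys) * Lk)
        ≤⟨ ∑-mono Y (λ {ys} ys∈ → At.volume-bound x ∅ a e t ys c ⊥P nτ a≤ ys∈) ⟩
      ∑ Y (λ ys → L ^ N * (product (gaps a ys) ^ n′ * R))
        ≡⟨ ∑-*ˡ Y (L ^ N) _ ⟩
      L ^ N * ∑ Y (λ ys → product (gaps a ys) ^ n′ * R)
        ≡⟨ cong (L ^ N *_) (∑-*ʳ Y R _) ⟩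
      L ^ N * (∑ Y (λ ys → product (gaps a ys) ^ n′) * R) ∎
    main : C * Lk ≤ L ^ N * (∑ Y (λ ys → product (gaps a ys) ^ n′) * R)
    -- A sequence of edges that is a chain for no weights contributes nothing. Otherwise a single
    -- realisation provides the intersection pattern, and the volumes no longer refer to it.
    main with C ≟ 0
    ... | yes C0 rewrite C0 = z≤n
    ... | no C≢0 with ∑-<⇒∃ (words L N) {λ _ → 0} {λ x → ind (Weighted.chainIn? x lam a b (e ∷ t))}
                       (≤-<-trans (≤-reflexive (∑-zero (words L N))) (n≢0⇒n>0 C≢0))
    ...   | x , _ , lt with Weighted.chainIn? x lam a b (e ∷ t)
    ...     | yes ci = ≤-trans (*-monoˡ-≤ Lk count≤volumes) (volumes x ci)
    ...     | no _   = ⊥-elim (n≮0 lt)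

∑-tuples-∏ : ∀ {A : Set} (es : List A) (f : A → ℕ) m → ∑ (tuples es m) (λ t → ∏ t f) ≡ ∑ es f ^ m
∑-tuples-∏ es f zero    = refl
∑-tuples-∏ es f (suc m) = begin
  ∑ (tuples es (suc m)) (λ t → ∏ t f)  ≡⟨ ∑-concatMap _ es _ ⟩
  ∑ es (λ e → ∑ (map (e ∷_) (tuples es m)) (λ t → ∏ t f)) ≡⟨ ∑-cong es (λ e → trans (∑-map (e ∷_) (tuples es m) _) (∑-*ˡ (tuples es m) (f e) _)) ⟩
  ∑ es (λ e → f e * ∑ (tuples es m) (λ t → ∏ t f))  ≡⟨ ∑-*ʳ es _ f ⟩
  ∑ es f * ∑ (tuples es m) (λ t → ∏ t f)  ≡⟨ cong (∑ es f *_) (∑-tuples-∏ es f m) ⟩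
  ∑ es f ^ suc m  ∎
  where open ≡-Reasoning

tuples-All : ∀ {A : Set} {es t : List A} m → t ∈ₗ tuples es m → All (_∈ₗ es) t
tuples-All zero (here refl) = []
tuples-All {es = es} (suc m) t∈ with find (∈-concatMap⁻ (λ e → map (e ∷_) (tuples es m)) {xs = es} t∈)
... | e , e∈ , q with ∈-map⁻ (e ∷_) q
...   | t′ , t′∈ , refl = e∈ ∷ tuples-All m t′∈

module ChainSum
  {N : ℕ} (L lam n′ ρ : ℕ) (τ : Subset N → ℕ)
  (L>0 : 1 ≤ L) (lam>0 : 1 ≤ lam) (ρ>0 : 1 ≤ ρ) (L≤ρlam : L ≤ ρ * lam)
  (es : List (Subset N)) (sizes : ∀ {e} → e ∈ₗ es → n′ + 2 ≤ ∣ e ∣ + τ e) where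

  expectation : ∀ k a b → suc b ∸ a ≤ L →
    ∑ (words L N) (λ x → ∑ (tuples es (suc k)) (λ t → ind (Weighted.chainIn? x lam a b t)))
      * (L ^ (suc k * n′ + k) * suc k ^ (suc k * n′))
    ≤ L ^ N * length (Gaps.links lam b a k) * (suc b ∸ a + k) ^ (suc k * n′) * ∑ es (λ e → ρ ^ τ e) ^ suc k
  expectation k a b a≤ = begin
    ∑ (words L N) (λ x → ∑ T (λ t → F x t)) * Q  ≡⟨ cong (_* Q) (∑-swap (words L N) T F) ⟩
    ∑ T (λ t → ∑ (words L N) (λ x → F x t)) * Q  ≡⟨ sym (∑-*ʳ T Q _) ⟩
    ∑ T (λ t → ∑ (words L N) (λ x → F x t) * Q)  ≤⟨ ∑-mono T (λ {t} t∈ → one t (length-tuples {es = es} (suc k) t∈) (tuples-All (suc k) t∈)) ⟩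
    ∑ T (λ t → Z * ∏ t (λ e → ρ ^ τ e))  ≡⟨ ∑-*ˡ T Z _ ⟩
    Z * ∑ T (λ t → ∏ t (λ e → ρ ^ τ e))  ≡⟨ cong (Z *_) (∑-tuples-∏ es (λ e → ρ ^ τ e) (suc k)) ⟩
    Z * ∑ es (λ e → ρ ^ τ e) ^ suc k  ∎
    where
    open ≤-Reasoning
    T = tuples es (suc k)
    F : Vec ℕ N → List (Subset N) → ℕ
    F x t = ind (Weighted.chainIn? x lam a b t)
    Q = L ^ (suc k * n′ + k) * suc k ^ (suc k * n′)
    Z = L ^ N * length (Gaps.links lam b a k) * (suc b ∸ a + k) ^ (suc k * n′)
    one : ∀ t → length t ≡ suc k → All (_∈ₗ es) t →
          ∑ (words L N) (λ x → F x t) * Q ≤ Z * ∏ t (λ e → ρ ^ τ e)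
    one (e ∷ t) refl all = ≤-trans (≤-reflexive (sym (*-assoc (∑ (words L N) (λ x → F x (e ∷ t))) (L ^ (suc k * n′ + k)) _)))
      (ChainBound.chain-bound L lam b n′ ρ τ L>0 lam>0 ρ>0 L≤ρlam a e t (mapAll sizes all) a≤)

-- Short edges and deviations

module ShortEdges
  {N : ℕ} (L lam n′ ρ : ℕ) (τ : Subset N → ℕ)
  (L>0 : 1 ≤ L) (lam≤L : lam ≤ L) (ρ>0 : 1 ≤ ρ) (L≤ρlam : L ≤ ρ * lam) where

  Short : Vec ℕ N → Subset N → Set
  Short x e = ∃₂ λ u v → Weighted.First x lam e u × Weighted.Last x lam e v × lookup x v < lookup x u + lam

  short? : ∀ x e → Dec (Short x e)
  short? x e = any? (λ u → any? (λ v → Weighted.first? x lam e u ×-dec Weighted.last? x lam e v ×-dec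
                 (lookup x v <? lookup x u + lam)))

  box : Subset N → Fin N → ℕ → Box N
  box e u y = override ⁅ u ⁆ (y , 1) (override (e ─ ⁅ u ⁆) (y , lam) (λ _ → 0 , L))

  short-inBox : ∀ x → (∀ v → lookup x v < L) → ∀ e → Short x e →
                ∃ λ u → u ∈ e × InBox (box e u (lookup x u)) x
  short-inBox x <L e (u , v , (u∈ , f) , (_ , l) , lt) = u , u∈ , λ z →
    override-∋ x ⁅ u ⁆ (y , 1) _ z
      (λ z∈ → subst (λ w → y ≤ lookup x w × lookup x w < y + 1) (sym (x∈⁅y⁆⇒x≡y u z∈)) (≤-refl , m<m+n y (s≤s z≤n)))
      (override-∋ x (e ─ ⁅ u ⁆) (y , lam) _ z
        (λ z∈ → keyOf-mono x (f z (p─q⊆p e ⁅ u ⁆ z∈)) , ≤-<-trans (keyOf-mono x (l z (p─q⊆p e ⁅ u ⁆ z∈))) lt)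
        (z≤n , <L z))
    where
    y = lookup x u

  volume-box : ∀ e u y → u ∈ e → n′ + 2 ≤ ∣ e ∣ + τ e → volume (box e u y) * L * L ^ n′ ≤ L ^ N * (lam ^ n′ * ρ ^ τ e)
  volume-box e u y u∈ nτ = *-cancelʳ-≤ _ _ (L ^ s) {{m^n≢0 L s {{>-nonZero L>0}}}} (begin
    V * L * L ^ n′ * L ^ s  ≡⟨ eq₁ (V * L) (L ^ n′) (L ^ s) ⟩
    V * L * (L ^ s * L ^ n′)  ≡⟨ cong (_* (L ^ s * L ^ n′)) single ⟩
    V₁ * (L ^ s * L ^ n′)  ≡⟨ sym (*-assoc V₁ _ _) ⟩
    V₁ * L ^ s * L ^ n′  ≡⟨ cong (_* L ^ n′) (trans (volume-override L (e ─ ⁅ u ⁆) y lam _ (λ _ → refl)) (cong (_* lam ^ s) (volume-full L N))) ⟩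
    L ^ N * lam ^ s * L ^ n′  ≡⟨ *-assoc (L ^ N) _ _ ⟩
    L ^ N * (lam ^ s * L ^ n′)  ≤⟨ *-monoʳ-≤ (L ^ N) (exchange-powers L lam ρ s (τ e) n′ lam≤L L≤ρlam ρ>0 small) ⟩
    L ^ N * (L ^ s * (lam ^ n′ * ρ ^ τ e))  ≡⟨ eq₂ (L ^ N) (L ^ s) _ ⟩
    L ^ N * (lam ^ n′ * ρ ^ τ e) * L ^ s  ∎)
    where
    open ≤-Reasoning
    s = ∣ e ─ ⁅ u ⁆ ∣
    V = volume (box e u y)
    V₁ = volume (override (e ─ ⁅ u ⁆) (y , lam) (λ _ → 0 , L))
    eq₁ : ∀ a b c → a * b * c ≡ a * (c * b)
    eq₁ = solve-∀
    eq₂ : ∀ a b c → a * (b * c) ≡ a * c * b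
    eq₂ = solve-∀
    single : V * L ≡ V₁
    single = trans (cong (V *_) (trans (sym (^-identityʳ L)) (cong (L ^_) (sym (∣⁅x⁆∣≡1 u)))))
      (trans (volume-override L ⁅ u ⁆ y 1 _ (λ {z} z∈ → cong proj₂ (override-out (e ─ ⁅ u ⁆) (y , lam) _ (λ q → x∈p─q⇒x∉q e ⁅ u ⁆ q z∈))))
             (trans (cong (V₁ *_) (^-zeroˡ ∣ ⁅ u ⁆ ∣)) (*-identityʳ V₁)))
    small : n′ ≤ s + τ e
    small = +-cancelʳ-≤ 2 n′ (s + τ e) (begin
      n′ + 2  ≤⟨ nτ ⟩
      ∣ e ∣ + τ e  ≡⟨ cong (_+ τ e) (sym (∣─∣+∣∩∣ e ⁅ u ⁆)) ⟩
      s + ∣ e ∩ ⁅ u ⁆ ∣ + τ e ≤⟨ +-monoˡ-≤ (τ e) (+-monoʳ-≤ s (≤-trans (p⊆q⇒∣p∣≤∣q∣ (λ z∈ → proj₂ (x∈p∩q⁻ e ⁅ u ⁆ z∈))) (≤-reflexive (∣⁅x⁆∣≡1 u)))) ⟩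
      s + 1 + τ e  ≤⟨ m≤m+n _ 1 ⟩
      s + 1 + τ e + 1  ≡⟨ eq s (τ e) ⟩
      s + τ e + 2  ∎)
      where eq : ∀ s t → s + 1 + t + 1 ≡ s + t + 2
            eq = solve-∀

  -- Union bound over the first vertex and its weight: the `L` possible weights are paid for by
  -- fixing that coordinate, and the choice of the vertex costs `∣ e ∣`. The other vertices lie in
  -- an interval of length `lam`.
  short-edge : ∀ e → n′ + 2 ≤ ∣ e ∣ + τ e →
               ∑ (words L N) (λ x → ind (short? x e)) * L ^ n′ ≤ L ^ N * (∣ e ∣ * (lam ^ n′ * ρ ^ τ e))
  short-edge e nτ = begin
    ∑ (words L N) (λ x → ind (short? x e)) * L ^ n′
      ≤⟨ *-monoˡ-≤ (L ^ n′) (∑-mono (words L N) (λ {x} x∈ → ind-bound (short? x e) (hit x x∈))) ⟩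
    ∑ (words L N) (λ x → ∑ (fins N) λ u → ∑ (range 0 L) λ y → I x u y) * L ^ n′
      ≡⟨ cong (_* L ^ n′) (trans (∑-swap (words L N) (fins N) _) (∑-cong (fins N) (λ u → ∑-swap (words L N) (range 0 L) _))) ⟩
    (∑ (fins N) λ u → ∑ (range 0 L) λ y → ∑ (words L N) λ x → I x u y) * L ^ n′
      ≡⟨ trans (sym (∑-*ʳ (fins N) (L ^ n′) _)) (∑-cong (fins N) (λ u → sym (∑-*ʳ (range 0 L) (L ^ n′) _))) ⟩
    (∑ (fins N) λ u → ∑ (range 0 L) λ y → ∑ (words L N) (λ x → I x u y) * L ^ n′)
      ≤⟨ ∑-mono (fins N) (λ {u} _ → *-cancelʳ-≤ _ _ L {{>-nonZero L>0}} (cell u)) ⟩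
    ∑ (fins N) (λ u → ind (u ∈? e) * Z)
      ≡⟨ ∑-*ʳ (fins N) Z _ ⟩
    ∑ (fins N) (λ u → ind (u ∈? e)) * Z
      ≡⟨ cong (_* Z) (sym (∣∣-∑ e)) ⟩
    ∣ e ∣ * Z
      ≡⟨ eq ∣ e ∣ (L ^ N) (lam ^ n′ * ρ ^ τ e) ⟩
    L ^ N * (∣ e ∣ * (lam ^ n′ * ρ ^ τ e)) ∎
    where
    open ≤-Reasoning
    Z = L ^ N * (lam ^ n′ * ρ ^ τ e)
    eq : ∀ a b c → a * (b * c) ≡ b * (a * c)
    eq = solve-∀
    I : Vec ℕ N → Fin N → ℕ → ℕ
    I x u y = ind (u ∈? e) * ind (inBox? (box e u y) x)
    hit : ∀ x → x ∈ₗ words L N → Short x e → 1 ≤ (∑ (fins N) λ u → ∑ (range 0 L) λ y → I x u y)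
    hit x x∈ sh with short-inBox x (words-< L N x∈) e sh
    ... | u , u∈ , inb = begin
      1  ≡⟨ sym (cong₂ _*_ (ind-yes (u ∈? e) u∈) (ind-yes (inBox? (box e u (lookup x u)) x) inb)) ⟩
      I x u (lookup x u)  ≤⟨ ∑-∈ (I x u) (∈-range⁺ 0 L z≤n (words-< L N x∈ u)) ⟩
      ∑ (range 0 L) (I x u)  ≤⟨ ∑-∈ (λ u → ∑ (range 0 L) (I x u)) (∈-fins u) ⟩
      (∑ (fins N) λ u → ∑ (range 0 L) (I x u))  ∎
    cell : ∀ u → ∑ (range 0 L) (λ y → ∑ (words L N) (λ x → I x u y) * L ^ n′) * L ≤ ind (u ∈? e) * Z * L
    cell u = begin
      ∑ (range 0 L) (λ y → ∑ (words L N) (λ x → I x u y) * L ^ n′) * L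
        ≡⟨ sym (∑-*ʳ (range 0 L) L _) ⟩
      ∑ (range 0 L) (λ y → ∑ (words L N) (λ x → I x u y) * L ^ n′ * L)
        ≤⟨ ∑-mono (range 0 L) (λ {y} _ → one y (u ∈? e)) ⟩
      ∑ (range 0 L) (λ y → ind (u ∈? e) * Z)
        ≡⟨ trans (∑-const (range 0 L) _) (trans (cong (_* (ind (u ∈? e) * Z)) (length-range 0 L)) (*-comm L _)) ⟩
      ind (u ∈? e) * Z * L ∎
      where
      one : ∀ y (d : Dec (u ∈ e)) → ∑ (words L N) (λ x → ind d * ind (inBox? (box e u y) x)) * L ^ n′ * L ≤ ind d * Z
      one y (no _) = ≤-reflexive (cong (λ z → z * L ^ n′ * L) (∑-zero (words L N)))
      one y (yes u∈) = begin
        ∑ (words L N) (λ x → 1 * ind (inBox? (box e u y) x)) * L ^ n′ * L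
          ≡⟨ cong (λ z → z * L ^ n′ * L) (∑-cong (words L N) (λ x → *-identityˡ _)) ⟩
        ∑ (words L N) (λ x → ind (inBox? (box e u y) x)) * L ^ n′ * L
          ≤⟨ *-monoˡ-≤ L (*-monoˡ-≤ (L ^ n′) (∑-box≤ L (box e u y))) ⟩
        volume (box e u y) * L ^ n′ * L
          ≡⟨ eq′ (volume (box e u y)) (L ^ n′) L ⟩
        volume (box e u y) * L * L ^ n′
          ≤⟨ volume-box e u y u∈ nτ ⟩
        Z ≡⟨ sym (*-identityˡ Z) ⟩
        1 * Z ∎
        where eq′ : ∀ a b c → a * b * c ≡ a * c * b
              eq′ = solve-∀

module Deviation (L θ : ℕ) (θ≤L : θ ≤ L) where

  below : ∀ {N} → Subset N → Vec ℕ N → ℕ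
  below []            []      = 0
  below (inside ∷ A)  (a ∷ x) = ind (a <? θ) + below A x
  below (outside ∷ A) (a ∷ x) = below A x

  below-∑ : ∀ {N} (A : Subset N) x → below A x ≡ ∑ (fins N) (λ v → ind ((v ∈? A) ×-dec (lookup x v <? θ)))
  below-∑ [] [] = refl
  below-∑ {suc N} (b ∷ A) (a ∷ x) = trans (hd b) (sym (∑-fins N (λ v → ind ((v ∈? (b ∷ A)) ×-dec (lookup (a ∷ x) v <? θ)))))
    where
    tl : ∀ b → below A x ≡ ∑ (fins N) (λ v → ind ((suc v ∈? (b ∷ A)) ×-dec (lookup x v <? θ)))
    tl b = trans (below-∑ A x) (∑-cong (fins N) (λ v → ≤-antisym
      (ind-mono ((v ∈? A) ×-dec (lookup x v <? θ)) ((suc v ∈? (b ∷ A)) ×-dec (lookup x v <? θ)) (λ (p , q) → there p , q))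
      (ind-mono ((suc v ∈? (b ∷ A)) ×-dec (lookup x v <? θ)) ((v ∈? A) ×-dec (lookup x v <? θ)) (λ (p , q) → drop-there p , q))))
    hd : ∀ b → below (b ∷ A) (a ∷ x) ≡ ind ((zero ∈? (b ∷ A)) ×-dec (a <? θ)) + ∑ (fins N) (λ v → ind ((suc v ∈? (b ∷ A)) ×-dec (lookup x v <? θ)))
    hd inside  = cong₂ _+_ (≤-antisym (ind-mono (a <? θ) ((zero ∈? (inside ∷ A)) ×-dec (a <? θ)) (λ q → here , q))
                                      (ind-mono ((zero ∈? (inside ∷ A)) ×-dec (a <? θ)) (a <? θ) proj₂)) (tl inside)
    hd outside = tl outside

  ∑-<θ : ∑ (range 0 L) (λ a → ind (a <? θ)) ≡ θ
  ∑-<θ = go 0 L θ≤L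
    where
    go : ∀ s k → θ ≤ s + k → ∑ (range s k) (λ a → ind (a <? θ)) ≡ θ ∸ s
    go s zero    le = sym (m≤n⇒m∸n≡0 (≤-trans le (≤-reflexive (+-identityʳ s))))
    go s (suc k) le = trans (cong (ind (s <? θ) +_) (go (suc s) k (≤-trans le (≤-reflexive (+-suc s k))))) (last s (s <? θ))
      where
      last : ∀ s (d : Dec (s < θ)) → ind d + (θ ∸ suc s) ≡ θ ∸ s
      last s (yes s<) = sym (+-∸-assoc 1 s<)
      last s (no s≮)  = trans (m≤n⇒m∸n≡0 (m≤n⇒m≤1+n (≮⇒≥ s≮))) (sym (m≤n⇒m∸n≡0 (≮⇒≥ s≮)))

  S₁ S₂ : ∀ {N} → Subset N → ℕ
  S₁ {N} A = ∑ (words L N) (below A)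
  S₂ {N} A = ∑ (words L N) (λ x → below A x * below A x)

  S₁-in : ∀ {N} (A : Subset N) → S₁ (inside ∷ A) ≡ θ * L ^ N + L * S₁ A
  S₁-in {N} A = begin
    S₁ (inside ∷ A)  ≡⟨ ∑-words L N _ ⟩
    ∑ (range 0 L) (λ a → ∑ (words L N) (λ x → ind (a <? θ) + below A x))  ≡⟨ ∑-cong (range 0 L) (λ a → trans (∑-+ (words L N) (λ _ → ind (a <? θ)) (below A)) (cong (_+ S₁ A) (∑-words-const L N _))) ⟩
    ∑ (range 0 L) (λ a → L ^ N * ind (a <? θ) + S₁ A)  ≡⟨ ∑-+ (range 0 L) _ _ ⟩
    ∑ (range 0 L) (λ a → L ^ N * ind (a <? θ)) + ∑ (range 0 L) (λ _ → S₁ A)  ≡⟨ cong₂ _+_ (trans (∑-*ˡ (range 0 L) (L ^ N) _) (trans (cong (L ^ N *_) ∑-<θ) (*-comm (L ^ N) θ))) (trans (∑-const (range 0 L) _) (cong (_* S₁ A) (length-range 0 L))) ⟩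
    θ * L ^ N + L * S₁ A  ∎
    where open ≡-Reasoning

  S₁-out : ∀ {N} (A : Subset N) → S₁ (outside ∷ A) ≡ L * S₁ A
  S₁-out {N} A = trans (∑-words L N _) (trans (∑-const (range 0 L) _) (cong (_* S₁ A) (length-range 0 L)))

  S₂-out : ∀ {N} (A : Subset N) → S₂ (outside ∷ A) ≡ L * S₂ A
  S₂-out {N} A = trans (∑-words L N _) (trans (∑-const (range 0 L) _) (cong (_* S₂ A) (length-range 0 L)))

  S₂-in : ∀ {N} (A : Subset N) → S₂ (inside ∷ A) ≡ θ * (L ^ N + 2 * S₁ A) + L * S₂ A
  S₂-in {N} A = begin
    S₂ (inside ∷ A) ≡⟨ ∑-words L N _ ⟩
    ∑ (range 0 L) (λ a → ∑ (words L N) (λ x → (ind (a <? θ) + below A x) * (ind (a <? θ) + below A x)))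
      ≡⟨ ∑-cong (range 0 L) (λ a → trans (∑-cong (words L N) (λ x → sq (a <? θ) (below A x)))
           (trans (∑-+ (words L N) (λ x → ind (a <? θ) * (1 + 2 * below A x)) (λ x → below A x * below A x))
                  (cong (_+ S₂ A) (trans (∑-*ˡ (words L N) (ind (a <? θ)) _) (cong (ind (a <? θ) *_) inner))))) ⟩
    ∑ (range 0 L) (λ a → ind (a <? θ) * (L ^ N + 2 * S₁ A) + S₂ A)
      ≡⟨ ∑-+ (range 0 L) _ _ ⟩
    ∑ (range 0 L) (λ a → ind (a <? θ) * (L ^ N + 2 * S₁ A)) + ∑ (range 0 L) (λ _ → S₂ A)
      ≡⟨ cong₂ _+_ (trans (∑-*ʳ (range 0 L) (L ^ N + 2 * S₁ A) _) (cong (_* (L ^ N + 2 * S₁ A)) ∑-<θ))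
                   (trans (∑-const (range 0 L) _) (cong (_* S₂ A) (length-range 0 L))) ⟩
    θ * (L ^ N + 2 * S₁ A) + L * S₂ A ∎
    where
    open ≡-Reasoning
    sq : ∀ {P : Set} (d : Dec P) c → (ind d + c) * (ind d + c) ≡ ind d * (1 + 2 * c) + c * c
    sq (no _)  c = refl
    sq (yes _) c = eq c
      where eq : ∀ c → (1 + c) * (1 + c) ≡ 1 * (1 + 2 * c) + c * c
            eq = solve-∀
    inner : ∑ (words L N) (λ x → 1 + 2 * below A x) ≡ L ^ N + 2 * S₁ A
    inner = trans (∑-+ (words L N) (λ _ → 1) (λ x → 2 * below A x)) (cong₂ _+_ (trans (∑-words-const L N 1) (*-identityʳ (L ^ N))) (∑-*ˡ (words L N) 2 (below A)))

  first-moment : ∀ {N} (A : Subset N) → L * S₁ A ≡ L ^ N * (∣ A ∣ * θ)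
  first-moment [] = *-zeroʳ L
  first-moment {suc N} (outside ∷ A) = trans (cong (L *_) (trans (S₁-out A) (first-moment A))) (sym (*-assoc L _ _))
  first-moment {suc N} (inside ∷ A) = trans (cong (L *_) (trans (S₁-in A) (cong (θ * L ^ N +_) (first-moment A)))) (eq L θ (L ^ N) ∣ A ∣)
    where eq : ∀ L θ p m → L * (θ * p + p * (m * θ)) ≡ L * p * (suc m * θ)
          eq = solve-∀

  -- The moments of a binomial variable, multiplied by `L * L`; the negative part of the variance
  -- stands on the left to avoid subtraction.
  second-moment : ∀ {N} (A : Subset N) → L * L * S₂ A + L ^ N * (∣ A ∣ * (θ * θ)) ≡ L ^ N * (∣ A ∣ * θ * (∣ A ∣ * θ) + ∣ A ∣ * (θ * L))
  second-moment [] = trans (+-identityʳ _) (*-zeroʳ (L * L))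
  second-moment {suc N} (outside ∷ A) = trans (cong (λ z → L * L * z + L * L ^ N * (∣ A ∣ * (θ * θ))) (S₂-out A))
    (trans (eq L (S₂ A) (L ^ N) (∣ A ∣ * (θ * θ))) (trans (cong (L *_) (second-moment A)) (sym (*-assoc L _ _))))
    where eq : ∀ L s p q → L * L * (L * s) + L * p * q ≡ L * (L * L * s + p * q)
          eq = solve-∀
  second-moment {suc N} (inside ∷ A) = begin
    L * L * S₂ (inside ∷ A) + L * L ^ N * (suc m * (θ * θ))
      ≡⟨ cong (λ z → L * L * z + L * L ^ N * (suc m * (θ * θ))) (S₂-in A) ⟩
    L * L * (θ * (L ^ N + 2 * S₁ A) + L * S₂ A) + L * L ^ N * (suc m * (θ * θ))
      ≡⟨ eq₁ L θ (L ^ N) (S₁ A) (S₂ A) m ⟩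
    L * (L * θ * L ^ N + 2 * θ * (L * S₁ A) + (L * L * S₂ A + L ^ N * (m * (θ * θ))) + L ^ N * (θ * θ))
      ≡⟨ cong₂ (λ y z → L * (L * θ * L ^ N + 2 * θ * y + z + L ^ N * (θ * θ))) (first-moment A) (second-moment A) ⟩
    L * (L * θ * L ^ N + 2 * θ * (L ^ N * (m * θ)) + L ^ N * (m * θ * (m * θ) + m * (θ * L)) + L ^ N * (θ * θ))
      ≡⟨ eq₂ L θ (L ^ N) m ⟩
    L * L ^ N * (suc m * θ * (suc m * θ) + suc m * (θ * L)) ∎
    where
    open ≡-Reasoning
    m = ∣ A ∣
    eq₁ : ∀ L θ p a b m → L * L * (θ * (p + 2 * a) + L * b) + L * p * (suc m * (θ * θ)) ≡ L * (L * θ * p + 2 * θ * (L * a) + (L * L * b + p * (m * (θ * θ))) + p * (θ * θ))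
    eq₁ = solve-∀
    eq₂ : ∀ L θ p m → L * (L * θ * p + 2 * θ * (p * (m * θ)) + p * (m * θ * (m * θ) + m * (θ * L)) + p * (θ * θ)) ≡ L * p * (suc m * θ * (suc m * θ) + suc m * (θ * L))
    eq₂ = solve-∀

  Far : ∀ {N} → Subset N → ℕ → Vec ℕ N → Set
  Far A d x = ∣ A ∣ * θ + d ≤ L * below A x ⊎ L * below A x + d ≤ ∣ A ∣ * θ

  far? : ∀ {N} (A : Subset N) d x → Dec (Far A d x)
  far? A d x = (∣ A ∣ * θ + d ≤? L * below A x) ⊎-dec (L * below A x + d ≤? ∣ A ∣ * θ)

  -- With `μ = ∣ A ∣ * θ`, the indicator times `d * d` is at most the square of `L * below A x - μ`.
  -- The square is expanded, and its cross term is carried on the left, so everything stays in the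
  -- natural numbers.
  chebyshev : ∀ {N} (A : Subset N) d → ∑ (words L N) (λ x → ind (far? A d x)) * (d * d) ≤ L ^ N * (∣ A ∣ * (θ * L))
  chebyshev {N} A d = +-cancelʳ-≤ (2 * (L ^ N * (μ * μ))) _ _ (begin
    F * (d * d) + 2 * (L ^ N * (μ * μ))
      ≡⟨ cong (F * (d * d) +_) (trans (eq₁ (L ^ N) μ) (cong (2 * μ *_) (trans (sym (first-moment A)) (sym (∑-*ˡ (words L N) L _))))) ⟩
    F * (d * d) + 2 * μ * ∑ (words L N) (λ x → L * below A x)
      ≡⟨ cong₂ _+_ (sym (∑-*ʳ (words L N) (d * d) _)) (sym (∑-*ˡ (words L N) (2 * μ) _)) ⟩
    ∑ (words L N) (λ x → ind (far? A d x) * (d * d)) + ∑ (words L N) (λ x → 2 * μ * (L * below A x))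
      ≡⟨ sym (∑-+ (words L N) _ _) ⟩
    ∑ (words L N) (λ x → ind (far? A d x) * (d * d) + 2 * μ * (L * below A x))
      ≤⟨ ∑-mono (words L N) (λ {x} _ → point μ (L * below A x) (far? A d x)) ⟩
    ∑ (words L N) (λ x → L * below A x * (L * below A x) + μ * μ)
      ≡⟨ ∑-+ (words L N) _ _ ⟩
    ∑ (words L N) (λ x → L * below A x * (L * below A x)) + ∑ (words L N) (λ _ → μ * μ)
      ≡⟨ cong₂ _+_ (trans (∑-cong (words L N) (λ x → eq₂ L (below A x))) (∑-*ˡ (words L N) (L * L) _)) (∑-words-const L N (μ * μ)) ⟩
    L * L * S₂ A + L ^ N * (μ * μ)
      ≤⟨ +-monoˡ-≤ (L ^ N * (μ * μ)) (m≤m+n (L * L * S₂ A) (L ^ N * (∣ A ∣ * (θ * θ)))) ⟩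
    L * L * S₂ A + L ^ N * (∣ A ∣ * (θ * θ)) + L ^ N * (μ * μ)
      ≡⟨ cong (_+ L ^ N * (μ * μ)) (second-moment A) ⟩
    L ^ N * (μ * μ + ∣ A ∣ * (θ * L)) + L ^ N * (μ * μ)
      ≡⟨ eq₃ (L ^ N) (μ * μ) (∣ A ∣ * (θ * L)) ⟩
    L ^ N * (∣ A ∣ * (θ * L)) + 2 * (L ^ N * (μ * μ)) ∎)
    where
    open ≤-Reasoning
    μ = ∣ A ∣ * θ
    F = ∑ (words L N) (λ x → ind (far? A d x))
    eq₁ : ∀ p μ → 2 * (p * (μ * μ)) ≡ 2 * μ * (p * μ)
    eq₁ = solve-∀
    eq₂ : ∀ L c → L * c * (L * c) ≡ L * L * (c * c)
    eq₂ = solve-∀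
    eq₃ : ∀ p a b → p * (a + b) + p * a ≡ p * b + 2 * (p * a)
    eq₃ = solve-∀
    gap : ∀ a b → a + d ≤ b → d * d + 2 * (a * b) ≤ b * b + a * a
    gap a b le with m≤n⇒∃[o]m+o≡n (≤-trans (m≤m+n a d) le)
    ... | c , refl = ≤-trans (+-monoˡ-≤ _ (*-mono-≤ d≤c d≤c)) (≤-reflexive (eq a c))
      where
      d≤c : d ≤ c
      d≤c = +-cancelˡ-≤ a d c le
      eq : ∀ a c → c * c + 2 * (a * (a + c)) ≡ (a + c) * (a + c) + a * a
      eq = solve-∀
    point : ∀ a b (f : Dec (a + d ≤ b ⊎ b + d ≤ a)) → ind f * (d * d) + 2 * a * b ≤ b * b + a * a
    point a b (no _) = ≤-trans (≤-reflexive (*-assoc 2 a b)) (≤-trans (2ab≤a²+b² a b) (≤-reflexive (+-comm (a * a) (b * b))))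
    point a b (yes (inj₁ le)) = ≤-trans (≤-reflexive (eq d a b)) (gap a b le)
      where eq : ∀ d a b → 1 * (d * d) + 2 * a * b ≡ d * d + 2 * (a * b)
            eq = solve-∀
    point a b (yes (inj₂ le)) = ≤-trans (≤-reflexive (eq d a b)) (≤-trans (gap b a le) (≤-reflexive (+-comm (a * a) (b * b))))
      where eq : ∀ d a b → 1 * (d * d) + 2 * a * b ≡ d * d + 2 * (b * a)
            eq = solve-∀

-- Natural colouring by rank, and completing partial colourings

<[1+m/n]*n : ∀ m n .{{_ : NonZero n}} → m < suc (m / n) * n
<[1+m/n]*n m n = ≤-trans (s≤s (≤-reflexive (m≡m%n+[m/n]*n m n))) (+-monoˡ-≤ (m / n * n) (m%n<n m n))

module Ranking {N : ℕ} (x : Vec ℕ N) (A : Subset N) (s q : ℕ) .{{_ : NonZero q}} (size : ∣ A ∣ ≡ suc s * q) where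

  before? : ∀ v u → Dec (u ∈ A × keyOf x u < keyOf x v)
  before? v u = (u ∈? A) ×-dec (keyOf x u <? keyOf x v)

  rank : Fin N → ℕ
  rank v = ∑ (fins N) (λ u → ind (before? v u))

  -- The cap concerns only vertices outside `A`: one that follows all of `A` has rank `suc s * q`.
  ν : Fin N → ℕ
  ν v = s ⊓ (rank v / q)

  ν≤s : ∀ v → ν v ≤ s
  ν≤s v = m⊓n≤m s _

  ν≥⇒rank : ∀ v k → k ≤ ν v → k * q ≤ rank v
  ν≥⇒rank v k k≤ = ≤-trans (*-monoˡ-≤ q (≤-trans k≤ (m⊓n≤n s (rank v / q)))) (m/n*n≤m (rank v) q)

  ν<⇒rank : ∀ v k → k ≤ s → ν v < k → rank v < k * q
  ν<⇒rank v k k≤s ν< with ⊓-sel s (rank v / q)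
  ... | inj₁ eq = ⊥-elim (<⇒≱ ν< (≤-trans k≤s (≤-reflexive (sym eq))))
  ... | inj₂ eq = ≤-trans (<[1+m/n]*n (rank v) q) (*-monoˡ-≤ q (≤-trans (≤-reflexive (cong suc (sym eq))) ν<))

  rank≤below : ∀ L θ (θ≤L : θ ≤ L) v → lookup x v < θ → rank v ≤ Deviation.below L θ θ≤L A x
  rank≤below L θ θ≤L v lt = ≤-trans
    (∑-mono (fins N) (λ {u} _ → ind-mono (before? v u) ((u ∈? A) ×-dec (lookup x u <? θ))
      (λ (u∈ , k<) → u∈ , ≤-<-trans (keyOf-mono x (<⇒≤ k<)) lt)))
    (≤-reflexive (sym (Deviation.below-∑ L θ θ≤L A x)))

  below≤rank : ∀ L θ (θ≤L : θ ≤ L) v → θ ≤ lookup x v → Deviation.below L θ θ≤L A x ≤ rank v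
  below≤rank L θ θ≤L v le = ≤-trans (≤-reflexive (Deviation.below-∑ L θ θ≤L A x))
    (∑-mono (fins N) (λ {u} _ → ind-mono ((u ∈? A) ×-dec (lookup x u <? θ)) (before? v u)
      (λ (u∈ , u<) → u∈ , keyOf-< x u v (<-≤-trans u< le))))

  one≤ : ∀ u → 1 ≤ ∑ (fins N) (λ w → ind (w ≟F u))
  one≤ u = ≤-trans (≤-reflexive (sym (ind-yes (u ≟F u) refl))) (∑-∈ (λ w → ind (w ≟F u)) (∈-fins u))

  add-one : ∀ {P Q : Fin N → Set} (P? : ∀ w → Dec (P w)) (Q? : ∀ w → Dec (Q w)) u →
            (∀ {w} → P w → Q w) → Q u → ¬ P u → ∑ (fins N) (ind ∘ P?) < ∑ (fins N) (ind ∘ Q?)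
  add-one P? Q? u P⇒Q Qu ¬Pu = begin
    suc (∑ (fins N) (ind ∘ P?))  ≤⟨ +-monoˡ-≤ _ (one≤ u) ⟩
    ∑ (fins N) (λ w → ind (w ≟F u)) + ∑ (fins N) (ind ∘ P?) ≡⟨ sym (∑-+ (fins N) _ _) ⟩
    ∑ (fins N) (λ w → ind (w ≟F u) + ind (P? w))  ≤⟨ ∑-mono (fins N) (λ {w} _ → pt w (w ≟F u) (P? w)) ⟩
    ∑ (fins N) (ind ∘ Q?)  ∎
    where
    open ≤-Reasoning
    pt : ∀ w (d : Dec (w ≡ u)) (p : Dec _) → ind d + ind p ≤ ind (Q? w)
    pt w (yes refl) (yes p) = ⊥-elim (¬Pu p)
    pt w (yes refl) (no _)  = ≤-reflexive (sym (ind-yes (Q? w) Qu))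
    pt w (no _)     (yes p) = ≤-reflexive (sym (ind-yes (Q? w) (P⇒Q p)))
    pt w (no _)     (no _)  = z≤n

  rank-< : ∀ {u v} → u ∈ A → keyOf x u < keyOf x v → rank u < rank v
  rank-< {u} {v} u∈ u<v = add-one (before? u) (before? v) u (λ (p , q) → p , <-trans q u<v) (u∈ , u<v) (λ (_ , q) → <-irrefl refl q)

  rank-<-size : ∀ {v} → v ∈ A → rank v < suc s * q
  rank-<-size {v} v∈ = subst (rank v <_) (trans (sym (∣∣-∑ A)) size)
    (add-one (before? v) (_∈? A) v proj₁ v∈ (λ (_ , q) → <-irrefl refl q))

  rank-injective : ∀ {u v} → u ∈ A → v ∈ A → rank u ≡ rank v → u ≡ v
  rank-injective {u} {v} u∈ v∈ eq with <-cmp (keyOf x u) (keyOf x v)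
  ... | tri< lt _ _ = ⊥-elim (<-irrefl eq (rank-< u∈ lt))
  ... | tri≈ _ k≡ _ = keyOf-injective x k≡
  ... | tri> _ _ gt = ⊥-elim (<-irrefl (sym eq) (rank-< v∈ gt))

  class-size : ∀ k → ∑ (fins N) (λ v → ind ((v ∈? A) ×-dec (ν v ≟ k))) ≤ q
  class-size k = begin
    ∑ (fins N) (λ v → ind ((v ∈? A) ×-dec (ν v ≟ k)))
      ≤⟨ ∑-mono (fins N) (λ {v} _ → ind-bound ((v ∈? A) ×-dec (ν v ≟ k)) (λ (v∈ , eq) → hit v v∈ eq)) ⟩
    ∑ (fins N) (λ v → ∑ R (λ i → ind ((v ∈? A) ×-dec (rank v ≟ i))))
      ≡⟨ ∑-swap (fins N) R _ ⟩
    ∑ R (λ i → ∑ (fins N) (λ v → ind ((v ∈? A) ×-dec (rank v ≟ i))))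
      ≤⟨ ∑-mono R (λ {i} _ → ∑-fins-≤1 (λ v → (v ∈? A) ×-dec (rank v ≟ i)) (λ (u∈ , p) (v∈ , p′) → rank-injective u∈ v∈ (trans p (sym p′)))) ⟩
    ∑ R (λ _ → 1)
      ≡⟨ trans (∑-const R 1) (trans (*-identityʳ _) (length-range (k * q) q)) ⟩
    q ∎
    where
    open ≤-Reasoning
    R = range (k * q) q
    hit : ∀ v → v ∈ A → ν v ≡ k → 1 ≤ ∑ R (λ i → ind ((v ∈? A) ×-dec (rank v ≟ i)))
    hit v v∈ eq = ≤-trans (≤-reflexive (sym (ind-yes ((v ∈? A) ×-dec (rank v ≟ rank v)) (v∈ , refl))))
                          (∑-∈ (λ i → ind ((v ∈? A) ×-dec (rank v ≟ i))) (∈-range⁺ (k * q) q lo hi))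
      where
      quot≤s : rank v / q ≤ s
      quot≤s = s≤s⁻¹ (m<n*o⇒m/o<n (rank-<-size v∈))
      quot : rank v / q ≡ k
      quot = trans (sym (m≥n⇒m⊓n≡n quot≤s)) eq
      lo : k * q ≤ rank v
      lo = ≤-trans (*-monoˡ-≤ q (≤-reflexive (sym quot))) (m/n*n≤m (rank v) q)
      hi : rank v < k * q + q
      hi = ≤-trans (<[1+m/n]*n (rank v) q) (≤-reflexive (trans (cong (λ z → suc z * q) quot) (+-comm q (k * q))))

∑-ind-≟ : ∀ {r} (j : Fin r) → ∑ (fins r) (λ k → ind (j ≟F k)) ≡ 1
∑-ind-≟ {r} j = ≤-antisym (∑-fins-≤1 (λ k → j ≟F k) (λ p q → trans (sym p) q))
  (≤-trans (≤-reflexive (sym (ind-yes (j ≟F j) refl))) (∑-∈ (λ k → ind (j ≟F k)) (∈-fins j)))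

-- Vertices outside `A` are free, so they can take up whatever the colours lack. The induction
-- removes the first vertex and lowers the capacity of its colour by one.
fill : ∀ {r} N (A : Subset N) (c : Fin N → Fin r) (cap : Fin r → ℕ) →
       (∀ k → ∑ (fins N) (λ v → ind ((v ∈? A) ×-dec (c v ≟F k))) ≤ cap k) → ∑ (fins r) cap ≡ N →
       ∃ λ (f : Fin N → Fin r) → (∀ v → v ∈ A → f v ≡ c v) × (∀ k → ∑ (fins N) (λ v → ind (f v ≟F k)) ≡ cap k)
fill {r} zero A c cap fits total = c , (λ ()) , λ k → sym (n≤0⇒n≡0 (≤-trans (∑-∈ cap (∈-fins k)) (≤-reflexive total)))
fill {r} (suc N) (b ∷ A) c cap fits total = go b fits
  where
  cnt : Fin r → ℕ
  cnt k = ∑ (fins N) (λ v → ind ((v ∈? A) ×-dec (c (suc v) ≟F k)))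
  with-first : ∀ b j → (zero ∈ (b ∷ A) → j ≡ c zero) → (∀ k → ind (j ≟F k) + cnt k ≤ cap k) →
    ∃ λ (f : Fin (suc N) → Fin r) → (∀ v → v ∈ (b ∷ A) → f v ≡ c v) × (∀ k → ∑ (fins (suc N)) (λ v → ind (f v ≟F k)) ≡ cap k)
  with-first b j agree room with fill N A (c ∘ suc) (λ k → cap k ∸ ind (j ≟F k)) (λ k → m+n≤o⇒m≤o∸n (cnt k) (≤-trans (≤-reflexive (+-comm (cnt k) _)) (room k))) total′
    where
    total′ : ∑ (fins r) (λ k → cap k ∸ ind (j ≟F k)) ≡ N
    total′ = suc-injective (begin
      suc (∑ (fins r) (λ k → cap k ∸ ind (j ≟F k)))
        ≡⟨ cong (_+ ∑ (fins r) (λ k → cap k ∸ ind (j ≟F k))) (sym (∑-ind-≟ j)) ⟩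
      ∑ (fins r) (λ k → ind (j ≟F k)) + ∑ (fins r) (λ k → cap k ∸ ind (j ≟F k))
        ≡⟨ sym (∑-+ (fins r) _ _) ⟩
      ∑ (fins r) (λ k → ind (j ≟F k) + (cap k ∸ ind (j ≟F k)))
        ≡⟨ ∑-cong (fins r) (λ k → m+[n∸m]≡n (≤-trans (m≤m+n _ (cnt k)) (room k))) ⟩
      ∑ (fins r) cap
        ≡⟨ total ⟩
      suc N ∎)
      where open ≡-Reasoning
  ... | f′ , agree′ , count′ = f , agrees , counts
    where
    f : Fin (suc N) → Fin r
    f zero    = j
    f (suc v) = f′ v
    agrees : ∀ v → v ∈ (b ∷ A) → f v ≡ c v
    agrees zero    v∈ = agree v∈
    agrees (suc v) v∈ = agree′ v (drop-there v∈)
    counts : ∀ k → ∑ (fins (suc N)) (λ v → ind (f v ≟F k)) ≡ cap k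
    counts k = trans (∑-fins N (λ v → ind (f v ≟F k))) (trans (cong (ind (j ≟F k) +_) (count′ k))
                 (m+[n∸m]≡n (≤-trans (m≤m+n _ (cnt k)) (room k))))
  tails : ∀ b k → cnt k ≤ ∑ (fins N) (λ v → ind ((suc v ∈? (b ∷ A)) ×-dec (c (suc v) ≟F k)))
  tails b k = ∑-mono (fins N) (λ {v} _ → ind-mono ((v ∈? A) ×-dec (c (suc v) ≟F k)) ((suc v ∈? (b ∷ A)) ×-dec (c (suc v) ≟F k)) (λ (p , q) → there p , q))
  split : ∀ b k → ind ((zero ∈? (b ∷ A)) ×-dec (c zero ≟F k)) + cnt k ≤ ∑ (fins (suc N)) (λ v → ind ((v ∈? (b ∷ A)) ×-dec (c v ≟F k)))
  split b k = ≤-trans (+-monoʳ-≤ (ind ((zero ∈? (b ∷ A)) ×-dec (c zero ≟F k))) (tails b k)) (≤-reflexive (sym (∑-fins N (λ v → ind ((v ∈? (b ∷ A)) ×-dec (c v ≟F k))))))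
  go : ∀ b → (∀ k → ∑ (fins (suc N)) (λ v → ind ((v ∈? (b ∷ A)) ×-dec (c v ≟F k))) ≤ cap k) →
    ∃ λ (f : Fin (suc N) → Fin r) → (∀ v → v ∈ (b ∷ A) → f v ≡ c v) × (∀ k → ∑ (fins (suc N)) (λ v → ind (f v ≟F k)) ≡ cap k)
  go inside fits = with-first inside (c zero) (λ _ → refl) (λ k →
    ≤-trans (+-monoˡ-≤ (cnt k) (ind-mono (c zero ≟F k) ((zero ∈? (inside ∷ A)) ×-dec (c zero ≟F k)) (λ q → here , q)))
            (≤-trans (split inside k) (fits k)))
  -- The remaining vertices of `A` number at most `N` while the capacities sum to `suc N`, so some
  -- colour `j` has room for the free vertex.
  go outside fits with ∑-<⇒∃ (fins r) {cnt} {cap} (begin-strict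
      ∑ (fins r) cnt ≡⟨ ∑-swap (fins r) (fins N) _ ⟩
      ∑ (fins N) (λ v → ∑ (fins r) (λ k → ind ((v ∈? A) ×-dec (c (suc v) ≟F k))))
        ≤⟨ ∑-mono (fins N) (λ {v} _ → ∑-fins-≤1 (λ k → (v ∈? A) ×-dec (c (suc v) ≟F k)) (λ (_ , p) (_ , q) → trans (sym p) q)) ⟩
      ∑ (fins N) (λ _ → 1) ≡⟨ trans (∑-const (fins N) 1) (trans (*-identityʳ _) (length-fins N)) ⟩
      N <⟨ n<1+n N ⟩
      suc N ≡⟨ sym total ⟩
      ∑ (fins r) cap ∎)
    where open ≤-Reasoning
  ... | j , _ , lt = with-first outside j (λ ()) room
    where
    room : ∀ k → ind (j ≟F k) + cnt k ≤ cap k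
    room k with j ≟F k
    ... | yes refl = lt
    ... | no  _    = ≤-trans (m≤n+m (cnt k) _) (≤-trans (split outside k) (fits k))

∣tabulate∣ : ∀ N {P : Fin N → Set} (P? : ∀ v → Dec (P v)) → ∣ tabulate (λ v → does (P? v)) ∣ ≡ ∑ (fins N) (λ v → ind (P? v))
∣tabulate∣ zero    P? = refl
∣tabulate∣ (suc N) P? = trans (hd (P? zero)) (sym (∑-fins N (λ v → ind (P? v))))
  where
  hd : ∀ {Q : Set} (d : Dec Q) → ∣ does d ∷ tabulate (λ v → does (P? (suc v))) ∣ ≡ ind d + ∑ (fins N) (λ v → ind (P? (suc v)))
  hd (yes _) = cong suc (∣tabulate∣ N (P? ∘ suc))
  hd (no _)  = ∣tabulate∣ N (P? ∘ suc)

∣colorClass∣ : ∀ {N r} (c : Fin N → Fin r) i → ∣ colorClass c i ∣ ≡ ∑ (fins N) (λ v → ind (c v ≟F i))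
∣colorClass∣ {N} c i = ∣tabulate∣ N (λ v → c v ≟F i)

-- The reservoir

-- Bernoulli in the form (X / (X + s))^k ≥ 1 - k s / X. It yields `growth≤2`, by which all small
-- relative errors are absorbed in factors 2.
growth : ∀ X s k → (X + s) ^ k * X ≤ X ^ suc k + k * (s * (X + s) ^ k)
growth X s zero    = ≤-reflexive (eq X)
  where eq : ∀ X → 1 * X ≡ X * 1 + 0
        eq = solve-∀
growth X s (suc k) = begin
  (X + s) * p * X  ≡⟨ *-assoc (X + s) p X ⟩
  (X + s) * (p * X)  ≤⟨ *-monoʳ-≤ (X + s) (growth X s k) ⟩
  (X + s) * (X ^ suc k + k * (s * p))  ≡⟨ eq X s k p (X ^ suc k) ⟩
  X * X ^ suc k + s * X ^ suc k + k * (s * ((X + s) * p)) ≤⟨ +-monoˡ-≤ (k * (s * ((X + s) * p))) (+-monoʳ-≤ (X * X ^ suc k) (*-monoʳ-≤ s (^-monoˡ-≤ (suc k) (m≤m+n X s)))) ⟩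
  X * X ^ suc k + s * ((X + s) * p) + k * (s * ((X + s) * p)) ≡⟨ +-assoc (X * X ^ suc k) _ _ ⟩
  X ^ suc (suc k) + suc k * (s * (X + s) ^ suc k)  ∎
  where
  open ≤-Reasoning
  p = (X + s) ^ k
  eq : ∀ X s k p P → (X + s) * (P + k * (s * p)) ≡ X * P + s * P + k * (s * ((X + s) * p))
  eq = solve-∀

growth≤2 : ∀ X s k → 1 ≤ X → 2 * (s * k) ≤ X → (X + s) ^ k ≤ 2 * X ^ k
growth≤2 X s k 1≤X small = *-cancelʳ-≤ _ _ X {{>-nonZero 1≤X}} (+-cancelʳ-≤ (p * X) _ _ (begin
  p * X + p * X  ≤⟨ +-mono-≤ (growth X s k) (growth X s k) ⟩
  X ^ suc k + k * (s * p) + (X ^ suc k + k * (s * p)) ≡⟨ eq X (X ^ k) s k p ⟩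
  2 * X ^ k * X + p * (2 * (s * k))  ≤⟨ +-monoʳ-≤ (2 * X ^ k * X) (*-monoʳ-≤ p small) ⟩
  2 * X ^ k * X + p * X  ∎))
  where
  open ≤-Reasoning
  p = (X + s) ^ k
  eq : ∀ X q s k p → X * q + k * (s * p) + (X * q + k * (s * p)) ≡ 2 * q * X + p * (2 * (s * k))
  eq = solve-∀

∣p∪⁅x⁆∣ : ∀ {N} (p : Subset N) {v} → v ∉ p → ∣ p ∪ ⁅ v ⁆ ∣ ≡ suc ∣ p ∣
∣p∪⁅x⁆∣ (inside ∷ p)  {zero}  v∉ = ⊥-elim (v∉ here)
∣p∪⁅x⁆∣ (outside ∷ p) {zero}  v∉ = cong (suc ∘ ∣_∣) (∪-identityʳ p)
∣p∪⁅x⁆∣ (inside ∷ p)  {suc v} v∉ = cong suc (∣p∪⁅x⁆∣ p (v∉ ∘ there))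
∣p∪⁅x⁆∣ (outside ∷ p) {suc v} v∉ = ∣p∪⁅x⁆∣ p (v∉ ∘ there)

∣e∩[R∪⁅v⁆]∣≤ : ∀ {N} (e R : Subset N) {v} → v ∉ R → ∣ e ∩ (R ∪ ⁅ v ⁆) ∣ ≤ ind (v ∈? e) + ∣ e ∩ R ∣
∣e∩[R∪⁅v⁆]∣≤ e R {v} v∉ with v ∈? e
... | yes v∈ = ≤-trans (p⊆q⇒∣p∣≤∣q∣ sub) (≤-reflexive (∣p∪⁅x⁆∣ (e ∩ R) (v∉ ∘ proj₂ ∘ x∈p∩q⁻ e R)))
  where
  sub : ∀ {z} → z ∈ e ∩ (R ∪ ⁅ v ⁆) → z ∈ (e ∩ R) ∪ ⁅ v ⁆
  sub z∈ with x∈p∩q⁻ e (R ∪ ⁅ v ⁆) z∈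
  ... | a , b with x∈p∪q⁻ R ⁅ v ⁆ b
  ...   | inj₁ c = x∈p∪q⁺ (inj₁ (x∈p∩q⁺ (a , c)))
  ...   | inj₂ c = x∈p∪q⁺ {p = e ∩ R} (inj₂ c)
... | no v∉e = p⊆q⇒∣p∣≤∣q∣ sub
  where
  sub : ∀ {z} → z ∈ e ∩ (R ∪ ⁅ v ⁆) → z ∈ e ∩ R
  sub z∈ with x∈p∩q⁻ e (R ∪ ⁅ v ⁆) z∈
  ... | a , b with x∈p∪q⁻ R ⁅ v ⁆ b
  ...   | inj₁ c = x∈p∩q⁺ (a , c)
  ...   | inj₂ c = ⊥-elim (v∉e (subst (_∈ e) (x∈⁅y⁆⇒x≡y v c) a))

module Reservoir {N : ℕ} (es : List (Subset N)) (n ρ B : ℕ) (1≤ρ : 1 ≤ ρ) (1≤B : 1 ≤ B)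
                 (sizes : ∀ {e} → e ∈ₗ es → ∣ e ∣ ≤ n) where

  Φ : Subset N → ℕ
  Φ R = ∑ es (λ e → ρ ^ ∣ e ∩ R ∣)

  load : Subset N → Fin N → ℕ
  load R v = ∑ es (λ e → ind (v ∈? e) * ρ ^ ∣ e ∩ R ∣)

  ∑-load : ∀ R → ∑ (fins N) (load R) ≤ n * Φ R
  ∑-load R = begin
    ∑ (fins N) (load R)
      ≡⟨ ∑-swap (fins N) es _ ⟩
    ∑ es (λ e → ∑ (fins N) (λ v → ind (v ∈? e) * ρ ^ ∣ e ∩ R ∣))
      ≡⟨ ∑-cong es (λ e → trans (∑-*ʳ (fins N) (ρ ^ ∣ e ∩ R ∣) _) (cong (_* ρ ^ ∣ e ∩ R ∣) (sym (∣∣-∑ e)))) ⟩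
    ∑ es (λ e → ∣ e ∣ * ρ ^ ∣ e ∩ R ∣)
      ≤⟨ ∑-mono es (λ {e} e∈ → *-monoˡ-≤ (ρ ^ ∣ e ∩ R ∣) (sizes e∈)) ⟩
    ∑ es (λ e → n * ρ ^ ∣ e ∩ R ∣)
      ≡⟨ ∑-*ˡ es n _ ⟩
    n * Φ R ∎
    where open ≤-Reasoning

  Φ-insert : ∀ R {v} → v ∉ R → Φ (R ∪ ⁅ v ⁆) ≤ Φ R + ρ * load R v
  Φ-insert R {v} v∉ = begin
    Φ (R ∪ ⁅ v ⁆)
      ≤⟨ ∑-mono es (λ {e} _ → ≤-trans (^-monoʳ-≤ ρ {{>-nonZero 1≤ρ}} (∣e∩[R∪⁅v⁆]∣≤ e R v∉)) (pt (v ∈? e) (ρ ^ ∣ e ∩ R ∣) ∣ e ∩ R ∣ refl)) ⟩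
    ∑ es (λ e → ρ ^ ∣ e ∩ R ∣ + ρ * (ind (v ∈? e) * ρ ^ ∣ e ∩ R ∣))
      ≡⟨ trans (∑-+ es _ _) (cong (Φ R +_) (∑-*ˡ es ρ _)) ⟩
    Φ R + ρ * load R v ∎
    where
    open ≤-Reasoning
    pt : ∀ {P : Set} (d : Dec P) p k → p ≡ ρ ^ k → ρ ^ (ind d + k) ≤ p + ρ * (ind d * p)
    pt (yes _) .(ρ ^ k) k refl = ≤-trans (≤-reflexive (cong (ρ *_) (sym (+-identityʳ _)))) (m≤n+m _ _)
    pt (no _)  .(ρ ^ k) k refl = m≤m+n _ _

  -- Greedy choice: the loads add up to at most `n * Φ R`, and at least `B` vertices are outside
  -- `R`, so some vertex has load at most `n * Φ R / B`. Adding it multiplies the potential by at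
  -- most `1 + ρ * n / B`.
  build : ∀ k → k + B ≤ suc N → ∃ λ R → ∣ R ∣ ≡ k × Φ R * B ^ k ≤ length es * (B + ρ * n) ^ k
  build zero    _  = ∅ , ∣⊥∣≡0 N , ≤-reflexive (cong (_* 1) (trans (∑-cong es (λ e → cong (ρ ^_) (trans (cong ∣_∣ (∩-zeroʳ e)) (∣⊥∣≡0 N)))) (trans (∑-const es 1) (*-identityʳ (length es)))))
  build (suc k) le with build k (≤-trans (n≤1+n _) le)
  -- The successor on the right makes the averaging strict; over the integers it is removed again in
  -- `load≤`.
  ... | R , Rk , bound with ∑-<⇒∃ (fins N) {λ v → ind (v ∈? ∁ R) * (load R v * B)} {λ v → ind (v ∈? ∁ R) * suc (n * Φ R)} (begin-strict
      ∑ (fins N) (λ v → ind (v ∈? ∁ R) * (load R v * B))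
        ≤⟨ ∑-mono (fins N) (λ {v} _ → ≤-trans (*-monoˡ-≤ (load R v * B) (ind≤1 (v ∈? ∁ R))) (≤-reflexive (*-identityˡ _))) ⟩
      ∑ (fins N) (λ v → load R v * B)
        ≡⟨ ∑-*ʳ (fins N) B _ ⟩
      ∑ (fins N) (load R) * B
        ≤⟨ *-monoˡ-≤ B (∑-load R) ⟩
      n * Φ R * B
        <⟨ *-monoˡ-< B {{>-nonZero 1≤B}} (n<1+n (n * Φ R)) ⟩
      suc (n * Φ R) * B
        ≤⟨ *-monoʳ-≤ (suc (n * Φ R)) room ⟩
      suc (n * Φ R) * ∣ ∁ R ∣
        ≡⟨ trans (*-comm (suc (n * Φ R)) _) (cong (_* suc (n * Φ R)) (∣∣-∑ (∁ R))) ⟩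
      ∑ (fins N) (λ v → ind (v ∈? ∁ R)) * suc (n * Φ R)
        ≡⟨ sym (∑-*ʳ (fins N) (suc (n * Φ R)) _) ⟩
      ∑ (fins N) (λ v → ind (v ∈? ∁ R) * suc (n * Φ R)) ∎)
    where
    open ≤-Reasoning
    room : B ≤ ∣ ∁ R ∣
    room = ≤-trans (m+n≤o⇒m≤o∸n B (≤-trans (≤-reflexive (+-comm B k)) (s≤s⁻¹ le)))
                   (≤-reflexive (trans (cong (N ∸_) (sym Rk)) (sym (∣∁p∣≡n∸∣p∣ R))))
  ...   | v , _ , lt with v ∈? ∁ R
  ...     | no _   = ⊥-elim (n≮0 lt)
  ...     | yes v∈ = R ∪ ⁅ v ⁆ , trans (∣p∪⁅x⁆∣ R v∉) (cong suc Rk) , (begin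
      Φ (R ∪ ⁅ v ⁆) * (B * B ^ k)  ≤⟨ *-monoˡ-≤ (B * B ^ k) (Φ-insert R v∉) ⟩
      (Φ R + ρ * load R v) * (B * B ^ k)  ≡⟨ eq₁ (Φ R) ρ (load R v) B (B ^ k) ⟩
      (Φ R * B + ρ * (load R v * B)) * B ^ k ≤⟨ *-monoˡ-≤ (B ^ k) (+-monoʳ-≤ (Φ R * B) (*-monoʳ-≤ ρ load≤)) ⟩
      (Φ R * B + ρ * (n * Φ R)) * B ^ k  ≡⟨ eq₂ (Φ R) B ρ n (B ^ k) ⟩
      (B + ρ * n) * (Φ R * B ^ k)  ≤⟨ *-monoʳ-≤ (B + ρ * n) bound ⟩
      (B + ρ * n) * (length es * (B + ρ * n) ^ k) ≡⟨ eq₃ (B + ρ * n) (length es) _ ⟩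
      length es * ((B + ρ * n) * (B + ρ * n) ^ k) ∎)
    where
    open ≤-Reasoning
    v∉ : v ∉ R
    v∉ = x∈∁p⇒x∉p v∈
    load≤ : load R v * B ≤ n * Φ R
    load≤ = s≤s⁻¹ (subst₂ _<_ (*-identityˡ (load R v * B)) (*-identityˡ (suc (n * Φ R))) lt)
    eq₁ : ∀ a b c d e → (a + b * c) * (d * e) ≡ (a * d + b * (c * d)) * e
    eq₁ = solve-∀
    eq₂ : ∀ a b c d e → (a * b + c * (d * a)) * e ≡ (b + c * d) * (a * e)
    eq₂ = solve-∀
    eq₃ : ∀ a b c → a * (b * c) ≡ b * (a * c)
    eq₃ = solve-∀

  reservoir : ∀ k → k + B ≤ N → 2 * (ρ * n * k) ≤ B → ∃ λ R → ∣ R ∣ ≡ k × Φ R ≤ 2 * length es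
  reservoir k le small with build k (m≤n⇒m≤1+n le)
  ... | R , Rk , bound = R , Rk , *-cancelʳ-≤ _ _ (B ^ k) {{m^n≢0 B k {{>-nonZero 1≤B}}}} (begin
    Φ R * B ^ k  ≤⟨ bound ⟩
    length es * (B + ρ * n) ^ k  ≤⟨ *-monoʳ-≤ (length es) (growth≤2 B (ρ * n) k 1≤B small) ⟩
    length es * (2 * B ^ k)  ≡⟨ eq (length es) (B ^ k) ⟩
    2 * length es * B ^ k  ∎)
    where
    open ≤-Reasoning
    eq : ∀ a b → a * (2 * b) ≡ 2 * a * b
    eq = solve-∀

-- Balanced colourings by conditional expectations

falling : ℕ → ℕ → ℕ
falling k zero    = 1
falling k (suc s) = k * falling (k ∸ 1) s

falling-last : ∀ k s → falling k (suc s) ≡ falling k s * (k ∸ s)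
falling-last k zero    = *-comm k 1
falling-last k (suc s) = trans (cong (k *_) (falling-last (k ∸ 1) s))
  (trans (sym (*-assoc k _ _)) (cong (k * falling (k ∸ 1) s *_) (∸-+-assoc k 1 s)))

falling-zero : ∀ k s → k < s → falling k s ≡ 0
falling-zero zero    (suc s) _  = refl
falling-zero (suc k) (suc s) lt = trans (cong (suc k *_) (falling-zero k s (s≤s⁻¹ lt))) (*-zeroʳ (suc k))

falling-! : ∀ k s → s ≤ k → falling k s * (k ∸ s) ! ≡ k !
falling-! k       zero    _  = +-identityʳ _
falling-! (suc k) (suc s) le = trans (*-assoc (suc k) (falling k s) ((k ∸ s) !)) (cong (suc k *_) (falling-! k s (s≤s⁻¹ le)))

module _ {r : ℕ} where

  -- Up to the factor N !, the probability that a random colouring with class sizes cap paints S with i.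
  weight : ∀ {N} → (Fin r → ℕ) → Subset N × Fin r → ℕ
  weight {N} cap (S , i) = falling (cap i) ∣ S ∣ * (N ∸ ∣ S ∣) !

  spend : Fin r → (Fin r → ℕ) → Fin r → ℕ
  spend j cap k = cap k ∸ ind (j ≟F k)

  -- What is still to be avoided once the first vertex has colour `j`: a set that contains this
  -- vertex but was to be painted in another colour is already safe and disappears.
  residual : ∀ {N} → Fin r → Subset (suc N) × Fin r → List (Subset N × Fin r)
  residual j (outside ∷ S , i) = (S , i) ∷ []
  residual j (inside ∷ S , i) with j ≟F i
  ... | yes _ = (S , i) ∷ []
  ... | no  _ = []

  -- The martingale property. A random colouring with class sizes `cap` gives the first vertex
  -- colour `j` with probability `cap j / suc N`, and the average of the conditional probabilities
  -- is the original one.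
  average-weight : ∀ {N} (cap : Fin r → ℕ) → ∑ (fins r) cap ≡ suc N → (d : Subset (suc N) × Fin r) →
            ∑ (fins r) (λ j → cap j * ∑ (residual j d) (weight (spend j cap))) ≤ weight cap d
  average-weight {N} cap total (inside ∷ S , i) = begin
    ∑ (fins r) (λ j → cap j * ∑ (residual j (inside ∷ S , i)) (weight (spend j cap)))
      ≤⟨ ∑-mono (fins r) (λ {j} _ → pt j) ⟩
    ∑ (fins r) (λ j → ind (i ≟F j) * W)
      ≡⟨ trans (∑-*ʳ (fins r) W _) (trans (cong (_* W) (∑-ind-≟ i)) (*-identityˡ W)) ⟩
    W ∎
    where
    open ≤-Reasoning
    W = weight cap (inside ∷ S , i)
    pt : ∀ j → cap j * ∑ (residual j (inside ∷ S , i)) (weight (spend j cap)) ≤ ind (i ≟F j) * W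
    pt j with j ≟F i
    ... | no _ = ≤-trans (≤-reflexive (*-zeroʳ (cap j))) z≤n
    ... | yes refl rewrite ind-yes (j ≟F j) refl = ≤-reflexive (eq (cap j) (falling (cap j ∸ 1) ∣ S ∣) ((N ∸ ∣ S ∣) !))
      where eq : ∀ a b c → a * (b * c + 0) ≡ 1 * (a * b * c)
            eq = solve-∀
  -- The calculation below restores `κ` from `κ ∸ s + s`, which needs `s ≤ κ`. For a smaller
  -- capacity all weights are 0.
  average-weight {N} cap total (outside ∷ S , i) with cap i <? ∣ S ∣
  ... | yes lt = ≤-trans (∑-mono (fins r) (λ {j} _ → ≤-reflexive (zero-term j))) (≤-trans (≤-reflexive (∑-zero (fins r))) z≤n)
    where
    zero-term : ∀ j → cap j * (falling (spend j cap i) ∣ S ∣ * (N ∸ ∣ S ∣) ! + 0) ≡ 0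
    zero-term j rewrite falling-zero (spend j cap i) ∣ S ∣ (≤-<-trans (m∸n≤m (cap i) (ind (j ≟F i))) lt) = *-zeroʳ (cap j)
  ... | no ge = begin
    ∑ (fins r) (λ j → cap j * (falling (spend j cap i) s * (N ∸ s) ! + 0))
      ≡⟨ trans (∑-cong (fins r) (λ j → eq₀ (cap j) (falling (spend j cap i) s) ((N ∸ s) !))) (∑-*ʳ (fins r) ((N ∸ s) !) _) ⟩
    T * (N ∸ s) !
      ≡⟨ cong (_* (N ∸ s) !) T≡ ⟩
    F * (suc N ∸ s) * (N ∸ s) !
      ≡⟨ trans (*-assoc F _ _) (cong (F *_) (trans (cong (_* (N ∸ s) !) (+-∸-assoc 1 s≤N)) (cong _! (sym (+-∸-assoc 1 s≤N))))) ⟩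
    F * (suc N ∸ s) ! ∎
    where
    open ≤-Reasoning
    s = ∣ S ∣
    κ = cap i
    F = falling κ s
    T = ∑ (fins r) (λ j → cap j * falling (spend j cap i) s)
    s≤N : s ≤ N
    s≤N = ∣p∣≤n S
    eq₀ : ∀ a b c → a * (b * c + 0) ≡ a * b * c
    eq₀ = solve-∀
    -- Only the summand `j = i` differs from `cap j * F`. The compensating terms on both sides
    -- replace the subtraction, and `falling-last` evaluates the one on the right.
    pt : ∀ j → cap j * falling (spend j cap i) s + ind (i ≟F j) * (κ * F) ≡ cap j * F + ind (i ≟F j) * (κ * falling (κ ∸ 1) s)
    pt j = by (i ≟F j)
      where
      by : Dec (i ≡ j) → cap j * falling (spend j cap i) s + ind (i ≟F j) * (κ * F) ≡ cap j * F + ind (i ≟F j) * (κ * falling (κ ∸ 1) s)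
      by (no i≢j) rewrite ind-no (j ≟F i) (i≢j ∘ sym) | ind-no (i ≟F j) i≢j = refl
      by (yes refl) rewrite ind-yes (i ≟F i) refl = eq κ (falling (κ ∸ 1) s) F
        where eq : ∀ a b c → a * b + 1 * (a * c) ≡ a * c + 1 * (a * b)
              eq = solve-∀
    sums : T + κ * F ≡ suc N * F + F * (κ ∸ s)
    sums = begin-equality
      T + κ * F
        ≡⟨ cong (T +_) (sym (trans (∑-*ʳ (fins r) (κ * F) _) (trans (cong (_* (κ * F)) (∑-ind-≟ i)) (*-identityˡ _)))) ⟩
      T + ∑ (fins r) (λ j → ind (i ≟F j) * (κ * F))
        ≡⟨ sym (∑-+ (fins r) _ _) ⟩
      ∑ (fins r) (λ j → cap j * falling (spend j cap i) s + ind (i ≟F j) * (κ * F))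
        ≡⟨ ∑-cong (fins r) pt ⟩
      ∑ (fins r) (λ j → cap j * F + ind (i ≟F j) * (κ * falling (κ ∸ 1) s))
        ≡⟨ ∑-+ (fins r) _ _ ⟩
      ∑ (fins r) (λ j → cap j * F) + ∑ (fins r) (λ j → ind (i ≟F j) * (κ * falling (κ ∸ 1) s))
        ≡⟨ cong₂ _+_ (trans (∑-*ʳ (fins r) F cap) (cong (_* F) total))
                     (trans (∑-*ʳ (fins r) (κ * falling (κ ∸ 1) s) _) (trans (cong (_* (κ * falling (κ ∸ 1) s)) (∑-ind-≟ i)) (*-identityˡ _))) ⟩
      suc N * F + κ * falling (κ ∸ 1) s
        ≡⟨ cong (suc N * F +_) (falling-last κ s) ⟩
      suc N * F + F * (κ ∸ s) ∎
    T≡ : T ≡ F * (suc N ∸ s)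
    T≡ = +-cancelʳ-≡ (κ * F) T (F * (suc N ∸ s)) (begin-equality
      T + κ * F  ≡⟨ sums ⟩
      suc N * F + F * (κ ∸ s)  ≡⟨ cong (λ z → z * F + F * (κ ∸ s)) (sym (m∸n+n≡m (m≤n⇒m≤1+n s≤N))) ⟩
      (suc N ∸ s + s) * F + F * (κ ∸ s)  ≡⟨ eq₁ (suc N ∸ s) s F (κ ∸ s) ⟩
      F * (suc N ∸ s) + (κ ∸ s + s) * F  ≡⟨ cong (λ z → F * (suc N ∸ s) + z * F) (m∸n+n≡m (≮⇒≥ ge)) ⟩
      F * (suc N ∸ s) + κ * F  ∎)
      where eq₁ : ∀ a b c d → (a + b) * c + c * d ≡ c * a + (d + b) * c
            eq₁ = solve-∀

  -- An expected number of forbidden events below 1 is preserved by some colour for the next vertex.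
  -- At the end each remaining event would contribute a full 1, so none remains.
  balanced : ∀ N (cap : Fin r → ℕ) (ds : List (Subset N × Fin r)) → ∑ (fins r) cap ≡ N → ∑ ds (weight cap) < N ! →
             ∃ λ (f : Fin N → Fin r) → (∀ k → ∑ (fins N) (λ v → ind (f v ≟F k)) ≡ cap k) ×
               (∀ {S i} → (S , i) ∈ₗ ds → ¬ (∀ v → v ∈ S → f v ≡ i))
  balanced zero cap ds total lt = (λ ()) , (λ k → sym (n≤0⇒n≡0 (≤-trans (∑-∈ cap (∈-fins k)) (≤-reflexive total))))
                                , λ {S} {i} d∈ _ → <⇒≱ lt (≤-trans (≤-reflexive (sym (one S i))) (∑-∈ (weight cap) d∈))
    where one : ∀ (S : Subset 0) i → weight cap (S , i) ≡ 1
          one [] i = refl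
  balanced (suc N) cap ds total lt with ∑-<⇒∃ (fins r) {λ j → cap j * ∑ (concatMap (residual j) ds) (weight (spend j cap))} {λ j → cap j * N !} (begin-strict
      ∑ (fins r) (λ j → cap j * ∑ (concatMap (residual j) ds) (weight (spend j cap)))
        ≡⟨ ∑-cong (fins r) (λ j → trans (cong (cap j *_) (∑-concatMap (residual j) ds (weight (spend j cap)))) (sym (∑-*ˡ ds (cap j) _))) ⟩
      ∑ (fins r) (λ j → ∑ ds (λ d → cap j * ∑ (residual j d) (weight (spend j cap))))
        ≡⟨ ∑-swap (fins r) ds _ ⟩
      ∑ ds (λ d → ∑ (fins r) (λ j → cap j * ∑ (residual j d) (weight (spend j cap))))
        ≤⟨ ∑-mono ds (λ {d} _ → average-weight cap total d) ⟩
      ∑ ds (weight cap)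
        <⟨ lt ⟩
      suc N * N !
        ≡⟨ sym (trans (∑-*ʳ (fins r) (N !) cap) (cong (_* N !) total)) ⟩
      ∑ (fins r) (λ j → cap j * N !) ∎)
    where open ≤-Reasoning
  ... | j , _ , lt′ with balanced N (spend j cap) (concatMap (residual j) ds) total′ (*-cancelˡ-< (cap j) _ _ lt′)
    where
    1≤cap : 1 ≤ cap j
    1≤cap = n≢0⇒n>0 (λ z → n≮0 (subst (λ c → c * ∑ (concatMap (residual j) ds) (weight (spend j cap)) < c * N !) z lt′))
    total′ : ∑ (fins r) (spend j cap) ≡ N
    total′ = suc-injective (begin
      suc (∑ (fins r) (spend j cap))
        ≡⟨ cong (_+ ∑ (fins r) (spend j cap)) (sym (∑-ind-≟ j)) ⟩
      ∑ (fins r) (λ k → ind (j ≟F k)) + ∑ (fins r) (spend j cap)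
        ≡⟨ sym (∑-+ (fins r) _ _) ⟩
      ∑ (fins r) (λ k → ind (j ≟F k) + (cap k ∸ ind (j ≟F k)))
        ≡⟨ ∑-cong (fins r) (λ k → m+[n∸m]≡n (fits k)) ⟩
      ∑ (fins r) cap
        ≡⟨ total ⟩
      suc N ∎)
      where
      open ≡-Reasoning
      fits : ∀ k → ind (j ≟F k) ≤ cap k
      fits k = ind-bound (j ≟F k) (λ { refl → 1≤cap })
  ...   | f′ , count′ , avoid′ = f , counts , avoid
    where
    1≤cap : 1 ≤ cap j
    1≤cap = n≢0⇒n>0 (λ z → n≮0 (subst (λ c → c * ∑ (concatMap (residual j) ds) (weight (spend j cap)) < c * N !) z lt′))
    f : Fin (suc N) → Fin r
    f zero    = j
    f (suc v) = f′ v
    counts : ∀ k → ∑ (fins (suc N)) (λ v → ind (f v ≟F k)) ≡ cap k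
    counts k = trans (∑-fins N (λ v → ind (f v ≟F k))) (trans (cong (ind (j ≟F k) +_) (count′ k))
                 (m+[n∸m]≡n (ind-bound (j ≟F k) (λ { refl → 1≤cap }))))
    avoid : ∀ {S i} → (S , i) ∈ₗ ds → ¬ (∀ v → v ∈ S → f v ≡ i)
    avoid {outside ∷ S} {i} d∈ mono = avoid′ (∈-concatMap⁺ (residual j) (lose d∈ (here refl))) (λ v v∈ → mono (suc v) (there v∈))
    avoid {inside ∷ S} {i} d∈ mono = avoid′ (∈-concatMap⁺ (residual j) (lose d∈ (kept (mono zero here)))) (λ v v∈ → mono (suc v) (there v∈))
      where
      kept : j ≡ i → (S , i) ∈ₗ residual j (inside ∷ S , i)
      kept refl with j ≟F j
      ... | yes _ = here refl
      ... | no ¬p = ⊥-elim (¬p refl)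

-- Bounds on the exponential series

module ExponentialSeries where

  open import Data.Integer using (+_)
  open ℚᵘ using (mkℚᵘ; *≡*; *≤*)

  toℚᵘ-/ : ∀ n d → toℚᵘ (+ n /ℚ suc d) ℚᵘ.≃ mkℚᵘ (+ n) d
  toℚᵘ-/ n d = ℚₚ.toℚᵘ-fromℚᵘ (mkℚᵘ (+ n) d)

  ℕ→ℚ-+ : ∀ a b → ℕ→ℚ (a + b) ≡ ℕ→ℚ a +ℚ ℕ→ℚ b
  ℕ→ℚ-+ a b = ℚₚ.toℚᵘ-injective (ℚᵘₚ.≃-trans (toℚᵘ-/ (a + b) 0) (ℚᵘₚ.≃-sym
    (ℚᵘₚ.≃-trans (ℚₚ.toℚᵘ-homo-+ (ℕ→ℚ a) (ℕ→ℚ b)) (ℚᵘₚ.≃-trans (ℚᵘₚ.+-cong (toℚᵘ-/ a 0) (toℚᵘ-/ b 0))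
      (*≡* (cong (ℤ._* + 1) (trans (cong₂ ℤ._+_ (ℤₚ.*-identityʳ (+ a)) (ℤₚ.*-identityʳ (+ b))) (sym (ℤₚ.pos-+ a b)))))))))

  ℕ→ℚ-* : ∀ a b → ℕ→ℚ (a * b) ≡ ℕ→ℚ a *ℚ ℕ→ℚ b
  ℕ→ℚ-* a b = ℚₚ.toℚᵘ-injective (ℚᵘₚ.≃-trans (toℚᵘ-/ (a * b) 0) (ℚᵘₚ.≃-sym
    (ℚᵘₚ.≃-trans (ℚₚ.toℚᵘ-homo-* (ℕ→ℚ a) (ℕ→ℚ b)) (ℚᵘₚ.≃-trans (ℚᵘₚ.*-cong (toℚᵘ-/ a 0) (toℚᵘ-/ b 0))
      (*≡* (cong (ℤ._* + 1) (sym (ℤₚ.pos-* a b))))))))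

  ℕ→ℚ-mono : ∀ {a b} → a ≤ b → ℕ→ℚ a ≤ℚ ℕ→ℚ b
  ℕ→ℚ-mono {a} {b} le = ℚₚ.toℚᵘ-cancel-≤ (ℚᵘₚ.≤-trans (ℚᵘₚ.≤-reflexive (toℚᵘ-/ a 0)) (ℚᵘₚ.≤-trans
    (*≤* (subst₂ ℤ._≤_ (sym (ℤₚ.*-identityʳ (+ a))) (sym (ℤₚ.*-identityʳ (+ b))) (ℤ.+≤+ le)))
    (ℚᵘₚ.≤-reflexive (ℚᵘₚ.≃-sym (toℚᵘ-/ b 0)))))

  ℕ→ℚ-cancel : ∀ {a b} → ℕ→ℚ a ≤ℚ ℕ→ℚ b → a ≤ b
  ℕ→ℚ-cancel {a} {b} le with ℚᵘₚ.≤-trans (ℚᵘₚ.≤-reflexive (ℚᵘₚ.≃-sym (toℚᵘ-/ a 0))) (ℚᵘₚ.≤-trans (ℚₚ.toℚᵘ-mono-≤ le) (ℚᵘₚ.≤-reflexive (toℚᵘ-/ b 0)))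
  ... | *≤* q = ℤₚ.drop‿+≤+ (subst₂ ℤ._≤_ (ℤₚ.*-identityʳ (+ a)) (ℤₚ.*-identityʳ (+ b)) q)

  ℕ→ℚ-^ : ∀ a k → ℕ→ℚ (a ^ k) ≡ ℕ→ℚ a ^ℚ k
  ℕ→ℚ-^ a zero    = refl
  ℕ→ℚ-^ a (suc k) = trans (ℕ→ℚ-* a (a ^ k)) (trans (ℚₚ.*-comm (ℕ→ℚ a) _) (cong (_*ℚ ℕ→ℚ a) (ℕ→ℚ-^ a k)))

  inverse : ∀ j → (+ 1 /ℚ suc j) *ℚ ℕ→ℚ (suc j) ≡ 1ℚ
  inverse j = ℚₚ.toℚᵘ-injective (ℚᵘₚ.≃-trans (ℚₚ.toℚᵘ-homo-* (+ 1 /ℚ suc j) (ℕ→ℚ (suc j)))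
    (ℚᵘₚ.≃-trans (ℚᵘₚ.*-cong (toℚᵘ-/ 1 j) (toℚᵘ-/ (suc j) 0))
      (*≡* (trans (ℤₚ.*-identityʳ _) (trans (ℤₚ.*-identityˡ (+ suc j)) (sym (trans (ℤₚ.*-identityˡ _) (cong (λ z → + suc z) (*-identityʳ j)))))))))

  0≤ℕ→ℚ : ∀ a → 0ℚ ≤ℚ ℕ→ℚ a
  0≤ℕ→ℚ a = ℕ→ℚ-mono {0} {a} z≤n

  *ʳ-mono : ∀ {p q} r → 0ℚ ≤ℚ r → p ≤ℚ q → p *ℚ r ≤ℚ q *ℚ r
  *ʳ-mono r 0≤r = ℚₚ.*-monoʳ-≤-nonNeg r {{nonNegative 0≤r}}

  *ˡ-mono : ∀ {p q} r → 0ℚ ≤ℚ r → p ≤ℚ q → r *ℚ p ≤ℚ r *ℚ q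
  *ˡ-mono r 0≤r = ℚₚ.*-monoˡ-≤-nonNeg r {{nonNegative 0≤r}}

  *-nonneg : ∀ {p q} → 0ℚ ≤ℚ p → 0ℚ ≤ℚ q → 0ℚ ≤ℚ p *ℚ q
  *-nonneg {p} {q} 0≤p 0≤q = ℚₚ.≤-trans (ℚₚ.≤-reflexive (sym (ℚₚ.*-zeroˡ q))) (*ʳ-mono q 0≤q 0≤p)

  +-nonneg : ∀ {p q} → 0ℚ ≤ℚ p → 0ℚ ≤ℚ q → 0ℚ ≤ℚ p +ℚ q
  +-nonneg 0≤p 0≤q = ℚₚ.≤-trans (ℚₚ.≤-reflexive (sym (ℚₚ.+-identityˡ 0ℚ))) (ℚₚ.+-mono-≤ 0≤p 0≤q)

  0≤1/ : ∀ j → 0ℚ ≤ℚ (+ 1 /ℚ suc j)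
  0≤1/ j = ℚₚ.nonNegative⁻¹ (+ 1 /ℚ suc j) {{ℚₚ.normalize-nonNeg 1 (suc j)}}

  expTerm-nonneg : ∀ {t} → 0ℚ ≤ℚ t → ∀ j → 0ℚ ≤ℚ expTerm t j
  expTerm-nonneg 0≤t zero    = ℕ→ℚ-mono {0} {1} z≤n
  expTerm-nonneg 0≤t (suc j) = *-nonneg (*-nonneg (expTerm-nonneg 0≤t j) 0≤t) (0≤1/ j)

  expTerm-mono : ∀ {t u} → 0ℚ ≤ℚ t → t ≤ℚ u → ∀ j → expTerm t j ≤ℚ expTerm u j
  expTerm-mono 0≤t t≤u zero    = ℚₚ.≤-refl
  expTerm-mono {t} {u} 0≤t t≤u (suc j) = *ʳ-mono (+ 1 /ℚ suc j) (0≤1/ j)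
    (ℚₚ.≤-trans (*ʳ-mono t 0≤t (expTerm-mono 0≤t t≤u j)) (*ˡ-mono (expTerm u j) (expTerm-nonneg (ℚₚ.≤-trans 0≤t t≤u) j) t≤u))

  expPartial-nonneg : ∀ {t} → 0ℚ ≤ℚ t → ∀ k → 0ℚ ≤ℚ expPartial t k
  expPartial-nonneg 0≤t zero    = ℚₚ.≤-refl
  expPartial-nonneg 0≤t (suc k) = +-nonneg (expPartial-nonneg 0≤t k) (expTerm-nonneg 0≤t k)

  expTerm-suc : ∀ t j → expTerm t (suc j) *ℚ ℕ→ℚ (suc j) ≡ expTerm t j *ℚ t
  expTerm-suc t j = trans (ℚₚ.*-assoc (expTerm t j *ℚ t) (+ 1 /ℚ suc j) (ℕ→ℚ (suc j)))
                          (trans (cong (expTerm t j *ℚ t *ℚ_) (inverse j)) (ℚₚ.*-identityʳ _))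

  expTerm-! : ∀ t j → expTerm t j *ℚ ℕ→ℚ (j !) ≡ t ^ℚ j
  expTerm-! t zero    = refl
  expTerm-! t (suc j) = begin
    expTerm t (suc j) *ℚ ℕ→ℚ (suc j * j !)  ≡⟨ cong (expTerm t (suc j) *ℚ_) (ℕ→ℚ-* (suc j) (j !)) ⟩
    expTerm t (suc j) *ℚ (ℕ→ℚ (suc j) *ℚ ℕ→ℚ (j !))  ≡⟨ sym (ℚₚ.*-assoc (expTerm t (suc j)) _ _) ⟩
    expTerm t (suc j) *ℚ ℕ→ℚ (suc j) *ℚ ℕ→ℚ (j !)  ≡⟨ cong (_*ℚ ℕ→ℚ (j !)) (expTerm-suc t j) ⟩
    expTerm t j *ℚ t *ℚ ℕ→ℚ (j !)  ≡⟨ solve 3 (λ a b c → a :* b :* c := a :* c :* b) refl (expTerm t j) t (ℕ→ℚ (j !)) ⟩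
    expTerm t j *ℚ ℕ→ℚ (j !) *ℚ t  ≡⟨ cong (_*ℚ t) (expTerm-! t j) ⟩
    t ^ℚ suc j  ∎
    where open ≡-Reasoning
          open +-*-Solver

  -- The mean value estimate for t^(j+1) / (j+1)!. Summed over j it becomes e^(t+h) ≤ e^t + h
  -- e^(t+h) for partial sums.
  expTerm-shift : ∀ {t h} → 0ℚ ≤ℚ t → 0ℚ ≤ℚ h → ∀ j →
                  expTerm (t +ℚ h) (suc j) ≤ℚ expTerm t (suc j) +ℚ h *ℚ expTerm (t +ℚ h) j
  expTerm-shift {t} {h} 0≤t 0≤h zero = ℚₚ.≤-reflexive
    (solve 2 (λ t h → con 1ℚ :* (t :+ h) :* con 1ℚ := con 1ℚ :* t :* con 1ℚ :+ h :* con 1ℚ) refl t h)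
    where open +-*-Solver
  expTerm-shift {t} {h} 0≤t 0≤h (suc j) = begin
    F₁ *ℚ (t +ℚ h) *ℚ c
      ≡⟨ solve 4 (λ F t h c → F :* (t :+ h) :* c := (F :* t :+ h :* F) :* c) refl F₁ t h c ⟩
    (F₁ *ℚ t +ℚ h *ℚ F₁) *ℚ c
      ≤⟨ *ʳ-mono c (0≤1/ (suc j)) (ℚₚ.+-monoˡ-≤ (h *ℚ F₁) (*ʳ-mono t 0≤t (expTerm-shift 0≤t 0≤h j))) ⟩
    ((E₁ +ℚ h *ℚ F₀) *ℚ t +ℚ h *ℚ F₁) *ℚ c
      ≡⟨ solve 6 (λ E h F t G c → ((E :+ h :* F) :* t :+ h :* G) :* c := E :* t :* c :+ h :* (F :* t :+ G) :* c) refl E₁ h F₀ t F₁ c ⟩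
    E₁ *ℚ t *ℚ c +ℚ h *ℚ (F₀ *ℚ t +ℚ F₁) *ℚ c
      ≤⟨ ℚₚ.+-monoʳ-≤ (E₁ *ℚ t *ℚ c) (*ʳ-mono c (0≤1/ (suc j)) (*ˡ-mono h 0≤h (ℚₚ.+-monoˡ-≤ F₁ (*ˡ-mono F₀ 0≤F₀ t≤t+h)))) ⟩
    E₁ *ℚ t *ℚ c +ℚ h *ℚ (F₀ *ℚ (t +ℚ h) +ℚ F₁) *ℚ c
      ≡⟨ cong (λ z → E₁ *ℚ t *ℚ c +ℚ h *ℚ (z +ℚ F₁) *ℚ c) (sym (expTerm-suc (t +ℚ h) j)) ⟩
    E₁ *ℚ t *ℚ c +ℚ h *ℚ (F₁ *ℚ ℕ→ℚ (suc j) +ℚ F₁) *ℚ c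
      ≡⟨ cong (E₁ *ℚ t *ℚ c +ℚ_) (solve 4 (λ h F J c → h :* (F :* J :+ F) :* c := h :* F :* (c :* (con 1ℚ :+ J))) refl h F₁ (ℕ→ℚ (suc j)) c) ⟩
    E₁ *ℚ t *ℚ c +ℚ h *ℚ F₁ *ℚ (c *ℚ (1ℚ +ℚ ℕ→ℚ (suc j)))
      ≡⟨ cong (λ z → E₁ *ℚ t *ℚ c +ℚ h *ℚ F₁ *ℚ z) (trans (cong (c *ℚ_) (sym (ℕ→ℚ-+ 1 (suc j)))) (inverse (suc j))) ⟩
    E₁ *ℚ t *ℚ c +ℚ h *ℚ F₁ *ℚ 1ℚ
      ≡⟨ cong (E₁ *ℚ t *ℚ c +ℚ_) (ℚₚ.*-identityʳ (h *ℚ F₁)) ⟩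
    E₁ *ℚ t *ℚ c +ℚ h *ℚ F₁ ∎
    where
    open ℚₚ.≤-Reasoning
    open +-*-Solver
    E₁ = expTerm t (suc j)
    F₀ = expTerm (t +ℚ h) j
    F₁ = expTerm (t +ℚ h) (suc j)
    c = + 1 /ℚ suc (suc j)
    0≤F₀ : 0ℚ ≤ℚ F₀
    0≤F₀ = expTerm-nonneg (+-nonneg 0≤t 0≤h) j
    t≤t+h : t ≤ℚ t +ℚ h
    t≤t+h = ℚₚ.≤-trans (ℚₚ.≤-reflexive (sym (ℚₚ.+-identityʳ t))) (ℚₚ.+-monoʳ-≤ t 0≤h)

  expPartial-shift : ∀ {t h} → 0ℚ ≤ℚ t → 0ℚ ≤ℚ h → ∀ k →
                     expPartial (t +ℚ h) (suc k) ≤ℚ expPartial t (suc k) +ℚ h *ℚ expPartial (t +ℚ h) k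
  expPartial-shift {t} {h} 0≤t 0≤h zero = ℚₚ.≤-reflexive (solve 1 (λ h → con 0ℚ :+ con 1ℚ := con 0ℚ :+ con 1ℚ :+ h :* con 0ℚ) refl h)
    where open +-*-Solver
  expPartial-shift {t} {h} 0≤t 0≤h (suc k) = ℚₚ.≤-trans
    (ℚₚ.+-mono-≤ (expPartial-shift 0≤t 0≤h k) (expTerm-shift 0≤t 0≤h k))
    (ℚₚ.≤-reflexive (solve 5 (λ P h Q E F → P :+ h :* Q :+ (E :+ h :* F) := P :+ E :+ h :* (Q :+ F)) refl
      (expPartial t (suc k)) h (expPartial (t +ℚ h) k) (expTerm t (suc k)) (expTerm (t +ℚ h) k)))
    where open +-*-Solver

  halves : ℕ → ℚ
  halves zero    = 0ℚ
  halves (suc a) = halves a +ℚ ½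

  0≤½ : 0ℚ ≤ℚ ½
  0≤½ = 0≤1/ 1

  0≤halves : ∀ a → 0ℚ ≤ℚ halves a
  0≤halves zero    = ℚₚ.≤-refl
  0≤halves (suc a) = +-nonneg (0≤halves a) 0≤½

  halves-double : ∀ l → halves (l + l) ≡ ℕ→ℚ l
  halves-double zero    = refl
  halves-double (suc l) rewrite +-suc l l = trans (ℚₚ.+-assoc (halves (l + l)) ½ ½)
    (trans (cong (_+ℚ 1ℚ) (halves-double l)) (trans (ℚₚ.+-comm (ℕ→ℚ l) 1ℚ) (sym (ℕ→ℚ-+ 1 l))))

  -- Half steps: a step h multiplies e^t by at most 1 / (1 - h), which is 2 for h = ½.
  expPartial-halves : ∀ a k → expPartial (halves a) k ≤ℚ ℕ→ℚ (2 ^ a)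
  expPartial-halves zero    k = go k
    where
    vanish : ∀ j → expTerm 0ℚ (suc j) ≡ 0ℚ
    vanish j = trans (cong (_*ℚ (+ 1 /ℚ suc j)) (ℚₚ.*-zeroʳ (expTerm 0ℚ j))) (ℚₚ.*-zeroˡ (+ 1 /ℚ suc j))
    go : ∀ k → expPartial 0ℚ k ≤ℚ 1ℚ
    go zero          = 0≤ℕ→ℚ 1
    go (suc zero)    = ℚₚ.≤-refl
    go (suc (suc k)) = ℚₚ.≤-trans (ℚₚ.≤-reflexive (trans (cong (expPartial 0ℚ (suc k) +ℚ_) (vanish k)) (ℚₚ.+-identityʳ _))) (go (suc k))
  expPartial-halves (suc a) zero    = 0≤ℕ→ℚ (2 ^ suc a)
  expPartial-halves (suc a) (suc k) = begin
    expPartial (halves a +ℚ ½) (suc k)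
      ≤⟨ expPartial-shift (0≤halves a) 0≤½ k ⟩
    expPartial (halves a) (suc k) +ℚ ½ *ℚ expPartial (halves (suc a)) k
      ≤⟨ ℚₚ.+-mono-≤ (expPartial-halves a (suc k)) (*ˡ-mono ½ 0≤½ (expPartial-halves (suc a) k)) ⟩
    ℕ→ℚ (2 ^ a) +ℚ ½ *ℚ ℕ→ℚ (2 ^ suc a)
      ≡⟨ cong (λ z → ℕ→ℚ (2 ^ a) +ℚ ½ *ℚ z) (ℕ→ℚ-* 2 (2 ^ a)) ⟩
    ℕ→ℚ (2 ^ a) +ℚ ½ *ℚ (ℕ→ℚ 2 *ℚ ℕ→ℚ (2 ^ a))
      ≡⟨ cong (ℕ→ℚ (2 ^ a) +ℚ_) (trans (sym (ℚₚ.*-assoc ½ (ℕ→ℚ 2) (ℕ→ℚ (2 ^ a)))) (ℚₚ.*-identityˡ (ℕ→ℚ (2 ^ a)))) ⟩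
    ℕ→ℚ (2 ^ a) +ℚ ℕ→ℚ (2 ^ a)
      ≡⟨ trans (sym (ℕ→ℚ-+ (2 ^ a) (2 ^ a))) (cong (λ z → ℕ→ℚ (2 ^ a + z)) (sym (+-identityʳ _))) ⟩
    ℕ→ℚ (2 ^ suc a) ∎
    where open ℚₚ.≤-Reasoning

  expPartial≤4^ : ∀ l k → expPartial (ℕ→ℚ l) k ≤ℚ ℕ→ℚ (4 ^ l)
  expPartial≤4^ l k = subst₂ (λ t m → expPartial t k ≤ℚ ℕ→ℚ m) (halves-double l) pow (expPartial-halves (l + l) k)
    where pow : 2 ^ (l + l) ≡ 4 ^ l
          pow = trans (cong (2 ^_) (cong (λ z → l + z) (sym (+-identityʳ l)))) (sym (^-*-assoc 2 2 l))

  expTerm≤expPartial : ∀ {t} → 0ℚ ≤ℚ t → ∀ j → expTerm t j ≤ℚ expPartial t (suc j)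
  expTerm≤expPartial 0≤t j = ℚₚ.≤-trans (ℚₚ.≤-reflexive (sym (ℚₚ.+-identityˡ _))) (ℚₚ.+-monoˡ-≤ _ (expPartial-nonneg 0≤t j))

  l≤ln : ∀ l {n} → 4 ^ l ≤ n → ℕ→ℚ l ≤ln n
  l≤ln l le k = ℚₚ.≤-trans (expPartial≤4^ l k) (ℕ→ℚ-mono le)

  -- A single term of the exponential series at `r` is at most its sum, which is at most `4 ^ r`.
  r^r≤4^r*r! : ∀ r → r ^ r ≤ 4 ^ r * r !
  r^r≤4^r*r! r = ℕ→ℚ-cancel (begin
    ℕ→ℚ (r ^ r)  ≡⟨ ℕ→ℚ-^ r r ⟩
    ℕ→ℚ r ^ℚ r  ≡⟨ sym (expTerm-! (ℕ→ℚ r) r) ⟩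
    expTerm (ℕ→ℚ r) r *ℚ ℕ→ℚ (r !)  ≤⟨ *ʳ-mono (ℕ→ℚ (r !)) (0≤ℕ→ℚ (r !)) (ℚₚ.≤-trans (expTerm≤expPartial (0≤ℕ→ℚ r) r) (expPartial≤4^ r (suc r))) ⟩
    ℕ→ℚ (4 ^ r) *ℚ ℕ→ℚ (r !)  ≡⟨ sym (ℕ→ℚ-* (4 ^ r) (r !)) ⟩
    ℕ→ℚ (4 ^ r * r !)  ∎)
    where open ℚₚ.≤-Reasoning

  2^m*m!≤2*m^m : ∀ m → 2 ^ m * m ! ≤ 2 * m ^ m
  2^m*m!≤2*m^m zero          = s≤s z≤n
  2^m*m!≤2*m^m (suc zero)    = ≤-refl
  2^m*m!≤2*m^m (suc (suc k)) = begin
    2 * 2 ^ m * (suc m * m !)  ≡⟨ eq₁ (2 ^ m) (suc m) (m !) ⟩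
    2 * suc m * (2 ^ m * m !)  ≤⟨ *-monoʳ-≤ (2 * suc m) (2^m*m!≤2*m^m (suc k)) ⟩
    2 * suc m * (2 * m ^ m)  ≡⟨ eq₂ (suc m) (m ^ m) ⟩
    2 * (suc m * (m ^ m + m ^ m))  ≤⟨ *-monoʳ-≤ 2 (*-monoʳ-≤ (suc m) (bernoulli m k)) ⟩
    2 * (suc m * suc m ^ m)  ∎
    where
    open ≤-Reasoning
    m = suc k
    eq₁ : ∀ a b c → 2 * a * (b * c) ≡ 2 * b * (a * c)
    eq₁ = solve-∀
    eq₂ : ∀ a b → 2 * a * (2 * b) ≡ 2 * (a * (b + b))
    eq₂ = solve-∀

  -- The term m^m / m! of the series at `m` is already at least half of `2 ^ m`. This turns the
  -- hypothesis on r, which refers to the logarithm, into an inequality between natural numbers.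
  ln-lower : ∀ m n t → ℕ→ℚ m <ℚ t → t ≤ln n → 2 ^ m ≤ 2 * n
  ln-lower m n t m<t t≤ = *-cancelʳ-≤ (2 ^ m) (2 * n) (m !) {{>-nonZero (1≤n! m)}} (ℕ→ℚ-cancel (begin
    ℕ→ℚ (2 ^ m * m !)  ≤⟨ ℕ→ℚ-mono (2^m*m!≤2*m^m m) ⟩
    ℕ→ℚ (2 * m ^ m)  ≡⟨ trans (ℕ→ℚ-* 2 (m ^ m)) (cong (ℕ→ℚ 2 *ℚ_) (trans (ℕ→ℚ-^ m m) (sym (expTerm-! (ℕ→ℚ m) m)))) ⟩
    ℕ→ℚ 2 *ℚ (expTerm (ℕ→ℚ m) m *ℚ ℕ→ℚ (m !)) ≤⟨ *ˡ-mono (ℕ→ℚ 2) (0≤ℕ→ℚ 2) (*ʳ-mono (ℕ→ℚ (m !)) (0≤ℕ→ℚ (m !)) term≤) ⟩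
    ℕ→ℚ 2 *ℚ (ℕ→ℚ n *ℚ ℕ→ℚ (m !))  ≡⟨ trans (sym (ℚₚ.*-assoc (ℕ→ℚ 2) (ℕ→ℚ n) _)) (trans (cong (_*ℚ ℕ→ℚ (m !)) (sym (ℕ→ℚ-* 2 n))) (sym (ℕ→ℚ-* (2 * n) (m !)))) ⟩
    ℕ→ℚ (2 * n * m !)  ∎))
    where
    open ℚₚ.≤-Reasoning
    0≤m = 0≤ℕ→ℚ m
    m≤t = ℚₚ.<⇒≤ m<t
    term≤ : expTerm (ℕ→ℚ m) m ≤ℚ ℕ→ℚ n
    term≤ = ℚₚ.≤-trans (expTerm-mono 0≤m m≤t m) (ℚₚ.≤-trans (expTerm≤expPartial (ℚₚ.≤-trans 0≤m m≤t) m) (t≤ (suc m)))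

  -- The hypothesis on the number of edges is used for the single value `t = l`, admissible because
  -- e^l ≤ 4^l ≤ n.
  bound-at : ∀ l n A B k → 4 ^ l ≤ n →
             (∀ (t : ℚ) → 0ℚ ≤ℚ t → t ≤ln n → ℕ→ℚ A *ℚ (t ^ℚ k) ≤ℚ ℕ→ℚ B) → A * l ^ k ≤ B
  bound-at l n A B k le h = ℕ→ℚ-cancel (ℚₚ.≤-trans
    (ℚₚ.≤-reflexive (trans (ℕ→ℚ-* A (l ^ k)) (cong (ℕ→ℚ A *ℚ_) (ℕ→ℚ-^ l k))))
    (h (ℕ→ℚ l) (0≤ℕ→ℚ l) (l≤ln l le)))

open ExponentialSeries using (r^r≤4^r*r!; ln-lower; bound-at)

-- Scales

^-cancelˡ-≤ : ∀ k a b → a ^ suc k ≤ b ^ suc k → a ≤ b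
^-cancelˡ-≤ k a b h = ≮⇒≥ (λ lt → <⇒≱ (^-monoˡ-< (suc k) lt) h)

-- The crude form |E| ≤ n r^(n-1) / n^(1/r) of the bound on the edges, with `D` for n^(1/r) and `R`
-- for r^(n-1). The factor 100 and the power of `l` are given away here and kept for the chains of r
-- edges.
edges-root : ∀ E D n R s l → 1 ≤ l → (100 * E) ^ suc s * l ^ s ≤ n ^ s * R ^ suc s → D ^ suc s ≤ n → E * D ≤ n * R
edges-root E D n R s l 1≤l h D≤ = ^-cancelˡ-≤ s (E * D) (n * R) (begin
  (E * D) ^ suc s  ≡⟨ ^-*-distrib E D (suc s) ⟩
  E ^ suc s * D ^ suc s  ≤⟨ *-mono-≤ E≤ D≤ ⟩
  n ^ s * R ^ suc s * n  ≡⟨ eq (n ^ s) (R ^ suc s) n ⟩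
  n ^ suc s * R ^ suc s  ≡⟨ sym (^-*-distrib n R (suc s)) ⟩
  (n * R) ^ suc s  ∎)
  where
  open ≤-Reasoning
  eq : ∀ a b c → a * b * c ≡ c * a * b
  eq = solve-∀
  E≤ : E ^ suc s ≤ n ^ s * R ^ suc s
  E≤ = begin
    E ^ suc s  ≤⟨ ^-monoˡ-≤ (suc s) (m≤n*m E 100) ⟩
    (100 * E) ^ suc s  ≤⟨ m≤m*n _ (l ^ s) {{m^n≢0 l s {{>-nonZero 1≤l}}}} ⟩
    (100 * E) ^ suc s * l ^ s ≤⟨ h ⟩
    n ^ s * R ^ suc s  ∎

[1+g]⁴≤2^g : ∀ g → 17 ≤ g → suc g ^ 4 ≤ 2 ^ g
[1+g]⁴≤2^g g 17≤g = go (g ∸ 17) (m∸n+n≡m 17≤g)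
  where
  step : ∀ g → 8 ≤ suc g → suc g ^ 4 ≤ 2 ^ g → suc (suc g) ^ 4 ≤ 2 * 2 ^ g
  step g 8≤ h = begin
    suc (suc g) ^ 4  ≡⟨ cong (_^ 4) (+-comm 1 (suc g)) ⟩
    (suc g + 1) ^ 4  ≤⟨ growth≤2 (suc g) 1 4 (s≤s z≤n) 8≤ ⟩
    2 * suc g ^ 4  ≤⟨ *-monoʳ-≤ 2 h ⟩
    2 * 2 ^ g  ∎
    where open ≤-Reasoning
  go : ∀ d {g} → d + 17 ≡ g → suc g ^ 4 ≤ 2 ^ g
  go zero    refl = ≤ᵇ⇒≤ (18 ^ 4) (2 ^ 17) _
  go (suc d) refl = step (d + 17) (≤-trans (≤ᵇ⇒≤ 8 18 _) (s≤s (m≤n+m 17 d))) (go d refl)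

-- Opaque, so that products with these numerals are not unfolded in unary.
opaque
  2¹³ 2¹⁸ 2²⁰ : ℕ
  2¹³ = 2 ^ 13
  2¹⁸ = 2 ^ 18
  2²⁰ = 2 ^ 20

  4*2¹⁸≡2²⁰ : 4 * 2¹⁸ ≡ 2²⁰
  4*2¹⁸≡2²⁰ = refl

  2¹³≤2²⁰ : 2¹³ ≤ 2²⁰
  2¹³≤2²⁰ = ≤ᵇ⇒≤ (2 ^ 13) (2 ^ 20) _

  17≤2²⁰ : 17 ≤ 2²⁰
  17≤2²⁰ = ≤ᵇ⇒≤ 17 (2 ^ 20) _

  2¹³≡32*256 : 2¹³ ≡ 32 * 256
  2¹³≡32*256 = refl

  2¹⁸≡64*64*64 : 2¹⁸ ≡ 64 * (64 * 64)
  2¹⁸≡64*64*64 = refl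

module Scale (r l : ℕ) .{{_ : NonZero r}} (c₁ : 2²⁰ * r ^ 4 ≤ l) where

  -- Chosen so that `4 ^ g` is a power of 4 not exceeding n^(1/r); see `D-root`.
  g : ℕ
  g = l / r

  gr≤l : g * r ≤ l
  gr≤l = m/n*n≤m l r

  l<[1+g]r : l < suc g * r
  l<[1+g]r = <[1+m/n]*n l r

  c₁′ : 2²⁰ * (r * (r * (r * r))) ≤ l
  c₁′ = ≤-trans (≤-reflexive (cong (λ z → 2²⁰ * (r * (r * (r * z)))) (sym (*-identityʳ r)))) c₁

  cube<g : 2²⁰ * (r * (r * r)) < suc g
  cube<g = *-cancelʳ-< r _ _ (≤-<-trans (≤-reflexive (eq (2²⁰) r)) (≤-<-trans c₁′ l<[1+g]r))
    where eq : ∀ c r → c * (r * (r * r)) * r ≡ c * (r * (r * (r * r)))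
          eq = solve-∀

  cube≤g : 2²⁰ * (r * (r * r)) ≤ g
  cube≤g = s≤s⁻¹ cube<g

  r≤g : r ≤ g
  r≤g = ≤-trans (≤-trans (m≤m*n r (r * r) {{m*n≢0 r r}}) (m≤n*m (r * (r * r)) 2²⁰ {{>-nonZero (≤-trans (s≤s z≤n) 17≤2²⁰)}})) cube≤g

  17≤g : 17 ≤ g
  17≤g = ≤-trans (≤-trans 17≤2²⁰ (m≤m*n (2²⁰) (r * (r * r)) {{m*n≢0 r (r * r) {{it}} {{m*n≢0 r r}}}})) cube≤g

  1≤g : 1 ≤ g
  1≤g = ≤-trans (s≤s z≤n) 17≤g

  l≤2gr : l ≤ 2 * (g * r)
  l≤2gr = ≤-trans (<⇒≤ l<[1+g]r) (≤-trans (*-monoˡ-≤ r (+-monoˡ-≤ g 1≤g)) (≤-reflexive (eq g r)))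
    where eq : ∀ g r → (g + g) * r ≡ 2 * (g * r)
          eq = solve-∀

  l<[1+g]² : l < suc g * suc g
  l<[1+g]² = <-≤-trans l<[1+g]r (*-monoʳ-≤ (suc g) (m≤n⇒m≤1+n r≤g))

  2^13r⁴≤l : 2¹³ * (r * (r * (r * r))) ≤ l
  2^13r⁴≤l = ≤-trans (*-monoˡ-≤ (r * (r * (r * r))) 2¹³≤2²⁰) c₁′

  -- Any fixed power of `l` is far below `2 ^ g`: since `r ≤ g`, `l` is less than the square of
  -- `suc g`. The number 2¹³ = 32 * 256 is what `num-M` asks for.
  c₂ : 2¹³ * (r * (r * (r * r))) * l ≤ 2 ^ g
  c₂ = begin
    2¹³ * (r * (r * (r * r))) * l  ≤⟨ *-mono-≤ 2^13r⁴≤l ≤-refl ⟩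
    l * l  ≤⟨ *-mono-≤ (<⇒≤ l<[1+g]²) (<⇒≤ l<[1+g]²) ⟩
    suc g * suc g * (suc g * suc g)  ≡⟨ eq (suc g) ⟩
    suc g ^ 4  ≤⟨ [1+g]⁴≤2^g g 17≤g ⟩
    2 ^ g  ∎
    where open ≤-Reasoning
          eq : ∀ a → a * a * (a * a) ≡ a * (a * (a * (a * 1)))
          eq = solve-∀

  -- Since `g` is at least l / (2r), it is enough that l² / (4r²) ≥ 2¹⁸ r² l, that is, l ≥ 2²⁰ r⁴.
  -- This fixes the constant in `c₁`.
  g²-large : 2¹⁸ * (r * r * l) ≤ g * g
  g²-large = *-cancelˡ-≤ 4 (*-cancelˡ-≤ (r * r) {{m*n≢0 r r}} (begin
    r * r * (4 * (2¹⁸ * (r * r * l)))  ≡⟨ eq₁ r 4 (2¹⁸) l ⟩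
    4 * 2¹⁸ * (r * (r * (r * r))) * l  ≡⟨ cong (λ z → z * (r * (r * (r * r))) * l) 4*2¹⁸≡2²⁰ ⟩
    2²⁰ * (r * (r * (r * r))) * l  ≤⟨ *-monoˡ-≤ l c₁′ ⟩
    l * l  ≤⟨ *-mono-≤ l≤2gr l≤2gr ⟩
    2 * (g * r) * (2 * (g * r))  ≡⟨ eq₂ g r ⟩
    r * r * (4 * (g * g))  ∎))
    where
    open ≤-Reasoning
    eq₁ : ∀ r f c l → r * r * (f * (c * (r * r * l))) ≡ f * c * (r * (r * (r * r))) * l
    eq₁ = solve-∀
    eq₂ : ∀ g r → 2 * (g * r) * (2 * (g * r)) ≡ r * r * (4 * (g * g))
    eq₂ = solve-∀

  1≤l : 1 ≤ l
  1≤l = ≤-trans (*-mono-≤ 1≤g (>-nonZero⁻¹ r)) gr≤l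

  D : ℕ
  D = 4 ^ g

  D-root : ∀ {n} → 4 ^ l ≤ n → D ^ r ≤ n
  D-root le = ≤-trans (≤-reflexive (^-*-assoc 4 g r)) (≤-trans (^-monoʳ-≤ 4 gr≤l) le)

  D≡2^g*2^g : D ≡ 2 ^ g * 2 ^ g
  D≡2^g*2^g = ^-*-distrib 2 2 g

  2^g≤D : 2 ^ g ≤ D
  2^g≤D = ≤-trans (m≤m*n (2 ^ g) (2 ^ g) {{m^n≢0 2 g}}) (≤-reflexive (sym D≡2^g*2^g))

  r⁴l≤n : ∀ {n} → 4 ^ l ≤ n → 2¹³ * (r * (r * (r * r))) * l ≤ n
  r⁴l≤n lo = ≤-trans c₂ (≤-trans 2^g≤D (≤-trans (^-monoʳ-≤ 4 (≤-trans (m≤m*n g r) gr≤l)) lo))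

-- Few vertices

falling-ratio : ∀ s q m → falling q m * suc s ^ m ≤ falling (suc s * q) m
falling-ratio s q zero    = ≤-refl
falling-ratio s q (suc m) = begin
  falling q (suc m) * (r * r ^ m)  ≡⟨ cong (_* (r * r ^ m)) (falling-last q m) ⟩
  falling q m * (q ∸ m) * (r * r ^ m)  ≡⟨ eq (falling q m) (q ∸ m) r (r ^ m) ⟩
  falling q m * r ^ m * ((q ∸ m) * r)  ≤⟨ *-mono-≤ (falling-ratio s q m) factor ⟩
  falling (r * q) m * (r * q ∸ m)  ≡⟨ sym (falling-last (r * q) m) ⟩
  falling (r * q) (suc m)  ∎
  where
  open ≤-Reasoning
  r = suc s
  eq : ∀ a b c d → a * b * (c * d) ≡ a * d * (b * c)
  eq = solve-∀
  factor : (q ∸ m) * r ≤ r * q ∸ m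
  factor = ≤-trans (≤-reflexive (trans (*-distribʳ-∸ r q m) (cong (_∸ m * r) (*-comm q r)))) (∸-monoʳ-≤ (r * q) (m≤m*n m r))

-- Compared with independent colours, the factors from the h-th on gain 1 - 1 / (1 + y) each.
falling-gain : ∀ s q h y → suc s * q ≤ s * h * suc y → ∀ j →
  falling q (j + h) * suc s ^ (j + h) * suc y ^ j ≤ falling (suc s * q) (j + h) * y ^ j
falling-gain s q h y large zero = *-monoˡ-≤ 1 (falling-ratio s q h)
falling-gain s q h y large (suc j) = begin
  falling q (suc a) * (r * r ^ a) * (Y * Y ^ j)  ≡⟨ cong (λ z → z * (r * r ^ a) * (Y * Y ^ j)) (falling-last q a) ⟩
  falling q a * (q ∸ a) * (r * r ^ a) * (Y * Y ^ j)  ≡⟨ eq (falling q a) (q ∸ a) r (r ^ a) Y (Y ^ j) ⟩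
  falling q a * r ^ a * Y ^ j * ((q ∸ a) * (r * Y))  ≤⟨ *-mono-≤ (falling-gain s q h y large j) (factor (≤-total q a)) ⟩
  falling (r * q) a * y ^ j * ((r * q ∸ a) * y)  ≡⟨ eq′ (falling (r * q) a) (y ^ j) (r * q ∸ a) y ⟩
  falling (r * q) a * (r * q ∸ a) * (y * y ^ j)  ≡⟨ cong (_* (y * y ^ j)) (sym (falling-last (r * q) a)) ⟩
  falling (r * q) (suc a) * (y * y ^ j)  ∎
  where
  open ≤-Reasoning
  r = suc s
  a = j + h
  Y = suc y
  eq : ∀ a b c d e f → a * b * (c * d) * (e * f) ≡ a * d * f * (b * (c * e))
  eq = solve-∀
  eq′ : ∀ a b c d → a * b * (c * d) ≡ a * c * (d * b)
  eq′ = solve-∀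
  factor : q ≤ a ⊎ a ≤ q → (q ∸ a) * (r * Y) ≤ (r * q ∸ a) * y
  factor (inj₁ q≤a) = ≤-trans (≤-reflexive (cong (_* (r * Y)) (m≤n⇒m∸n≡0 q≤a))) z≤n
  factor (inj₂ a≤q) with m≤n⇒∃[o]m+o≡n a≤q
  ... | d , eqd = begin
    (q ∸ a) * (r * Y)  ≡⟨ cong (_* (r * Y)) (trans (cong (_∸ a) (sym eqd)) (m+n∸m≡n a d)) ⟩
    d * (r * Y)  ≡⟨ e₁ d s y ⟩
    r * d * y + r * d  ≤⟨ +-monoʳ-≤ (r * d * y) rd≤ ⟩
    r * d * y + s * a * y  ≡⟨ e₂ d s a y ⟩
    (s * a + r * d) * y  ≡⟨ cong (_* y) (sym sub) ⟩
    (r * q ∸ a) * y  ∎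
    where
    e₁ : ∀ d s y → d * (suc s * suc y) ≡ suc s * d * y + suc s * d
    e₁ = solve-∀
    e₂ : ∀ d s a y → suc s * d * y + s * a * y ≡ (s * a + suc s * d) * y
    e₂ = solve-∀
    e₃ : ∀ d s a → suc s * (a + d) ≡ a + (s * a + suc s * d)
    e₃ = solve-∀
    sub : r * q ∸ a ≡ s * a + r * d
    sub = trans (cong (λ z → r * z ∸ a) (sym eqd)) (trans (cong (_∸ a) (e₃ d s a)) (m+n∸m≡n a _))
    rd≤ : r * d ≤ s * a * y
    rd≤ = +-cancelˡ-≤ (s * a) (r * d) (s * a * y) (begin
      s * a + r * d  ≤⟨ m≤n+m _ a ⟩
      a + (s * a + r * d)  ≡⟨ sym (e₃ d s a) ⟩
      r * (a + d)  ≡⟨ cong (r *_) eqd ⟩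
      r * q  ≤⟨ large ⟩
      s * h * Y  ≤⟨ *-monoˡ-≤ Y (*-monoʳ-≤ s (m≤n+m h j)) ⟩
      s * a * Y  ≡⟨ *-suc (s * a) y ⟩
      s * a + s * a * y  ∎)

2*y^Y≤Y^Y : ∀ y → 2 * y ^ suc y ≤ suc y ^ suc y
2*y^Y≤Y^Y y = ≤-trans (≤-reflexive (cong (y ^ suc y +_) (+-identityʳ _)))
  (≤-trans (+-monoʳ-≤ (y ^ suc y) (*-monoˡ-≤ (y ^ y) (n≤1+n y))) (bernoulli y y))

2^c-gain : ∀ c y j → c * suc y ≤ j → 2 ^ c * y ^ j ≤ suc y ^ j
2^c-gain c y j le with m≤n⇒∃[o]m+o≡n le
... | d , refl = begin
  2 ^ c * y ^ (c * Y + d)  ≡⟨ cong (2 ^ c *_) (^-distribˡ-+-* y (c * Y) d) ⟩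
  2 ^ c * (y ^ (c * Y) * y ^ d)  ≡⟨ sym (*-assoc (2 ^ c) _ _) ⟩
  2 ^ c * y ^ (c * Y) * y ^ d  ≡⟨ cong (λ z → 2 ^ c * z * y ^ d) (trans (cong (y ^_) (*-comm c Y)) (sym (^-*-assoc y Y c))) ⟩
  2 ^ c * (y ^ Y) ^ c * y ^ d  ≡⟨ cong (_* y ^ d) (sym (^-*-distrib 2 (y ^ Y) c)) ⟩
  (2 * y ^ Y) ^ c * y ^ d  ≤⟨ *-mono-≤ (^-monoˡ-≤ c (2*y^Y≤Y^Y y)) (^-monoˡ-≤ d (n≤1+n y)) ⟩
  (Y ^ Y) ^ c * Y ^ d  ≡⟨ cong (_* Y ^ d) (trans (^-*-assoc Y Y c) (cong (Y ^_) (*-comm Y c))) ⟩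
  Y ^ (c * Y) * Y ^ d  ≡⟨ sym (^-distribˡ-+-* Y (c * Y) d) ⟩
  Y ^ (c * Y + d)  ∎
  where open ≤-Reasoning
        Y = suc y

-- About half of the `n` factors are sacrificed so that each of the others gains. Since (1 -
-- 1/(1+y))^(1+y) ≤ 1/2, the gain reaches 2^(2l+2) = 4^(l+1) > n if `j` is at least `2 * l + 2`
-- times `suc y`; so `suc y` is taken as `h` divided by that number, rounded down.
small-parameters : ∀ n l s N → 2 ≤ l → 25 * l ≤ n → 16 * l * N ≤ n * n * s →
                   ∃ λ h → ∃ λ j → ∃ λ y → j + h ≡ n × N ≤ s * h * suc y × (2 * l + 2) * suc y ≤ j
small-parameters n l s N 2≤l 25l≤n small = h , j , y , trans (+-comm j h) (⌊n/2⌋+⌈n/2⌉≡n n) , N≤ , cY≤j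
  where
  open ≤-Reasoning
  h = ⌊ n /2⌋
  j = ⌈ n /2⌉
  c = 2 * l + 2
  instance c≢0 : NonZero c
           c≢0 = >-nonZero (≤-trans (s≤s z≤n) (m≤n+m 2 (2 * l)))
  n≤ : n ≤ 2 * h + 1
  n≤ = ≤-trans (≤-reflexive (sym (⌊n/2⌋+⌈n/2⌉≡n n))) (≤-trans (+-monoʳ-≤ h (⌊n/2⌋-mono (n≤1+n (suc n)))) (half n))
    where
    half : ∀ n → ⌊ n /2⌋ + ⌊ suc (suc n) /2⌋ ≤ 2 * ⌊ n /2⌋ + 1
    half n = ≤-reflexive (eq ⌊ n /2⌋)
      where eq : ∀ h → h + suc h ≡ 2 * h + 1
            eq = solve-∀
  12l≤h : 12 * l ≤ h
  12l≤h = ≮⇒≥ (λ lt → <-irrefl refl (begin-strict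
    25 * l  ≤⟨ ≤-trans 25l≤n n≤ ⟩
    2 * h + 1  <⟨ ≤-reflexive (eq h) ⟩
    2 * suc h  ≤⟨ *-monoʳ-≤ 2 lt ⟩
    2 * (12 * l)  ≡⟨ sym (*-assoc 2 12 l) ⟩
    24 * l  ≤⟨ *-monoˡ-≤ l (n≤1+n 24) ⟩
    25 * l  ∎))
    where eq : ∀ h → suc (2 * h + 1) ≡ 2 * suc h
          eq = solve-∀
  c≤3l : c ≤ 3 * l
  c≤3l = ≤-trans (+-monoʳ-≤ (2 * l) 2≤l) (≤-reflexive (eq l))
    where eq : ∀ l → 2 * l + l ≡ 3 * l
          eq = solve-∀
  4c≤h : 4 * c ≤ h
  4c≤h = ≤-trans (*-monoʳ-≤ 4 c≤3l) (≤-trans (≤-reflexive (sym (*-assoc 4 3 l))) 12l≤h)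
  c≤h : c ≤ h
  c≤h = ≤-trans (m≤n*m c 4) 4c≤h
  1≤h : 1 ≤ h
  1≤h = ≤-trans (>-nonZero⁻¹ c) c≤h
  Y = h / c
  y = pred Y
  Y≡ : suc y ≡ Y
  Y≡ = suc-pred Y {{>-nonZero (m≥n⇒m/n>0 c≤h)}}
  cY≤h : c * suc y ≤ h
  cY≤h = ≤-trans (≤-reflexive (trans (cong (c *_) Y≡) (*-comm c Y))) (m/n*n≤m h c)
  cY≤j : c * suc y ≤ j
  cY≤j = ≤-trans cY≤h (⌊n/2⌋≤⌈n/2⌉ n)
  h<cY+c : suc h ≤ c * suc y + c
  h<cY+c = ≤-trans (<[1+m/n]*n h c) (≤-reflexive (trans (cong (λ z → suc z * c) (sym Y≡)) (eq c (suc y))))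
    where eq : ∀ c Y → suc Y * c ≡ c * Y + c
          eq = solve-∀
  n²≤ : n * n ≤ 16 * l * (h * suc y)
  n²≤ = *-cancelˡ-≤ 3 (+-cancelʳ-≤ (16 * (h * c)) _ _ (begin
    3 * (n * n) + 16 * (h * c)  ≤⟨ +-monoˡ-≤ (16 * (h * c)) (*-monoʳ-≤ 3 (*-mono-≤ n≤ n≤)) ⟩
    3 * ((2 * h + 1) * (2 * h + 1)) + 16 * (h * c)  ≡⟨ e₁ h c ⟩
    12 * (h * h) + 12 * h + 3 + 4 * (h * (4 * c))  ≤⟨ +-monoʳ-≤ (12 * (h * h) + 12 * h + 3) (*-monoʳ-≤ 4 (*-monoʳ-≤ h 4c≤h)) ⟩
    12 * (h * h) + 12 * h + 3 + 4 * (h * h)  ≤⟨ +-monoˡ-≤ (4 * (h * h)) (+-monoʳ-≤ (12 * (h * h) + 12 * h) (≤-trans (n≤1+n 3) (*-monoʳ-≤ 4 1≤h))) ⟩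
    12 * (h * h) + 12 * h + 4 * h + 4 * (h * h)  ≡⟨ e₂ h ⟩
    16 * (h * suc h)  ≤⟨ *-monoʳ-≤ 16 (*-monoʳ-≤ h h<cY+c) ⟩
    16 * (h * (c * suc y + c))  ≡⟨ e₃ h c (suc y) ⟩
    16 * (h * suc y) * c + 16 * (h * c)  ≤⟨ +-monoˡ-≤ (16 * (h * c)) (*-monoʳ-≤ (16 * (h * suc y)) c≤3l) ⟩
    16 * (h * suc y) * (3 * l) + 16 * (h * c)  ≡⟨ cong (_+ 16 * (h * c)) (e₄ (h * suc y) l) ⟩
    3 * (16 * l * (h * suc y)) + 16 * (h * c)  ∎))
    where
    e₁ : ∀ h c → 3 * ((2 * h + 1) * (2 * h + 1)) + 16 * (h * c) ≡ 12 * (h * h) + 12 * h + 3 + 4 * (h * (4 * c))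
    e₁ = solve-∀
    e₂ : ∀ h → 12 * (h * h) + 12 * h + 4 * h + 4 * (h * h) ≡ 16 * (h * suc h)
    e₂ = solve-∀
    e₃ : ∀ h c Y → 16 * (h * (c * Y + c)) ≡ 16 * (h * Y) * c + 16 * (h * c)
    e₃ = solve-∀
    e₄ : ∀ a l → 16 * a * (3 * l) ≡ 3 * (16 * l * a)
    e₄ = solve-∀
  N≤ : N ≤ s * h * suc y
  N≤ = *-cancelˡ-≤ (16 * l) {{m*n≢0 16 l {{_}} {{>-nonZero (≤-trans (s≤s z≤n) 2≤l)}}}} (begin
    16 * l * N  ≤⟨ small ⟩
    n * n * s  ≤⟨ *-monoˡ-≤ s n²≤ ⟩
    16 * l * (h * suc y) * s  ≡⟨ eq (16 * l) h (suc y) s ⟩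
    16 * l * (s * h * suc y)  ∎)
    where eq : ∀ a h Y s → a * (h * Y) * s ≡ a * (s * h * Y)
          eq = solve-∀

falling-small : ∀ s q n l → 2 ≤ l → 25 * l ≤ n → 16 * l * (suc s * q) ≤ n * n * s →
                falling q n * suc s ^ n * 2 ^ (2 * l + 2) ≤ falling (suc s * q) n
falling-small s q n l 2≤l 25l≤n small = by (small-parameters n l s (suc s * q) 2≤l 25l≤n small)
  where
  open ≤-Reasoning
  c = 2 * l + 2
  eq : ∀ a b c → a * b * c ≡ a * c * b
  eq = solve-∀
  eq′ : ∀ a b c → a * b * c ≡ a * (c * b)
  eq′ = solve-∀
  by : (∃ λ h → ∃ λ j → ∃ λ y → j + h ≡ n × suc s * q ≤ s * h * suc y × c * suc y ≤ j) →
       falling q n * suc s ^ n * 2 ^ c ≤ falling (suc s * q) n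
  by (h , j , y , refl , N≤ , cY≤j) = *-cancelʳ-≤ _ _ (suc y ^ j) {{m^n≢0 (suc y) j}} (begin
    F * 2 ^ c * suc y ^ j  ≡⟨ eq F (2 ^ c) (suc y ^ j) ⟩
    F * suc y ^ j * 2 ^ c  ≤⟨ *-monoˡ-≤ (2 ^ c) (falling-gain s q h y N≤ j) ⟩
    G * y ^ j * 2 ^ c  ≡⟨ eq′ G (y ^ j) (2 ^ c) ⟩
    G * (2 ^ c * y ^ j)  ≤⟨ *-monoʳ-≤ G (2^c-gain c y j cY≤j) ⟩
    G * suc y ^ j  ∎)
    where
    F = falling q (j + h) * suc s ^ (j + h)
    G = falling (suc s * q) (j + h)

falling>0 : ∀ k m → m ≤ k → 1 ≤ falling k m
falling>0 k       zero    _  = ≤-refl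
falling>0 (suc k) (suc m) le = *-mono-≤ (s≤s (z≤n {k})) (falling>0 k m (s≤s⁻¹ le))

EquitableFor : ∀ {N} → ℕ → ℕ → List (Subset N) → Set
EquitableFor {N} r q es = ∃ λ (f : Fin N → Fin r) →
  (∀ {e} → e ∈ₗ es → ∀ i → ¬ (∀ v → v ∈ e → f v ≡ i)) × (∀ k → ∑ (fins N) (λ v → ind (f v ≟F k)) ≡ q)

∑-fins-const : ∀ r q → ∑ (fins r) (λ _ → q) ≡ r * q
∑-fins-const r q = trans (∑-const (fins r) q) (cong (_* q) (length-fins r))

-- With independent colours the expected number of monochromatic edges would be at most n. Equal
-- class sizes improve this by the factor `4 ^ suc l`, which exceeds n.
small-case : ∀ {N} s q n′ l (es : List (Subset N)) → N ≡ suc s * q → (∀ {e} → e ∈ₗ es → ∣ e ∣ ≡ suc n′) →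
  2 ≤ l → 25 * l ≤ suc n′ → suc n′ < 4 ^ suc l → 16 * l * N ≤ suc n′ * suc n′ * s →
  length es ≤ suc n′ * suc s ^ n′ → EquitableFor (suc s) q es
small-case {N} s q n′ l es refl sizes 2≤l 25l≤n n< small E≤ =
  by (balanced N (λ _ → q) ds (∑-fins-const (suc s) q) (potential es refl))
  where
  ds = concatMap (λ e → map (e ,_) (fins (suc s))) es
  by : (∃ λ (f : Fin N → Fin (suc s)) → (∀ k → ∑ (fins N) (λ v → ind (f v ≟F k)) ≡ q) ×
          (∀ {S i} → (S , i) ∈ₗ ds → ¬ (∀ v → v ∈ S → f v ≡ i))) → EquitableFor (suc s) q es
  by (f , counts , avoid) = f , (λ e∈ i → avoid (∈-concatMap⁺ (λ e → map (e ,_) (fins (suc s))) (lose e∈ (∈-map⁺ (_ ,_) (∈-fins i))))) , counts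
  n = suc n′
  r = suc s
  potential : ∀ es′ → es′ ≡ es → ∑ (concatMap (λ e → map (e ,_) (fins r)) es′) (weight (λ _ → q)) < N !
  potential [] _ = 1≤n! N
  -- The edge `e` at hand shows `n ≤ N`, needed for splitting `N !`.
  potential es′@(e ∷ _) refl = begin-strict
    ∑ (concatMap (λ e → map (e ,_) (fins r)) es) (weight (λ _ → q))
      ≡⟨ trans (∑-concatMap (λ e → map (e ,_) (fins r)) es (weight (λ _ → q))) (∑-cong es (λ e → trans (∑-map (e ,_) (fins r) (weight (λ _ → q))) (∑-fins-const r _))) ⟩
    ∑ es (λ e → r * (falling q ∣ e ∣ * (N ∸ ∣ e ∣) !))
      ≤⟨ ∑-mono es (λ e∈ → ≤-reflexive (cong (λ z → r * (falling q z * (N ∸ z) !)) (sizes e∈))) ⟩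
    ∑ es (λ _ → r * (falling q n * (N ∸ n) !))
      ≡⟨ trans (∑-const es _) (eq (length es) r (falling q n) ((N ∸ n) !)) ⟩
    length es * r * falling q n * (N ∸ n) !
      <⟨ *-monoˡ-< ((N ∸ n) !) {{(N ∸ n) !≢0}} key ⟩
    falling N n * (N ∸ n) !
      ≡⟨ falling-! N n n≤N ⟩
    N ! ∎
    where
    open ≤-Reasoning
    eq : ∀ a b c d → a * (b * (c * d)) ≡ a * b * c * d
    eq = solve-∀
    n≤N : n ≤ N
    n≤N = ≤-trans (≤-reflexive (sym (sizes (here refl)))) (∣p∣≤n e)
    4^≡ : 4 ^ suc l ≡ 2 ^ (2 * l + 2)
    4^≡ = trans (^-*-assoc 2 2 (suc l)) (cong (2 ^_) (eq₂ l))
      where eq₂ : ∀ l → 2 * suc l ≡ 2 * l + 2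
            eq₂ = solve-∀
    Er< : length es * r < r ^ n * 2 ^ (2 * l + 2)
    Er< = begin-strict
      length es * r  ≤⟨ *-monoˡ-≤ r E≤ ⟩
      n * r ^ n′ * r  ≡⟨ eq₃ n (r ^ n′) r ⟩
      r ^ n * n  <⟨ *-monoʳ-< (r ^ n) {{m^n≢0 r n}} (<-≤-trans n< (≤-reflexive 4^≡)) ⟩
      r ^ n * 2 ^ (2 * l + 2)  ∎
      where eq₃ : ∀ a b c → a * b * c ≡ c * b * a
            eq₃ = solve-∀
    key : length es * r * falling q n < falling N n
    -- The strict inequality `Er<` may be multiplied only by a positive number; if `falling q n` is
    -- 0, no class can contain an edge and the left side vanishes.
    key with falling q n ≟ 0
    ... | yes z = ≤-trans (s≤s (≤-reflexive (trans (cong (length es * r *_) z) (*-zeroʳ (length es * r))))) (falling>0 N n n≤N)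
    ... | no nz = <-≤-trans (*-monoˡ-< (falling q n) {{≢-nonZero nz}} Er<)
                    (≤-trans (≤-reflexive (eq₄ (r ^ n) (2 ^ (2 * l + 2)) (falling q n))) (falling-small s q n l 2≤l 25l≤n small))
      where eq₄ : ∀ a b c → a * b * c ≡ c * a * b
            eq₄ = solve-∀

-- Many vertices

private
  ^>0 : ∀ a k → 1 ≤ a → 1 ≤ a ^ k
  ^>0 a k 1≤a = m^n>0 a {{>-nonZero 1≤a}} k

  cancelʳ : ∀ {a b} c → 1 ≤ c → a * c ≤ b * c → a ≤ b
  cancelʳ c 1≤c = *-cancelʳ-≤ _ _ c {{>-nonZero 1≤c}}

suc≤2^ : ∀ s → suc s ≤ 2 ^ s
suc≤2^ zero    = ≤-refl
suc≤2^ (suc s) = begin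
  suc (suc s)  ≡⟨ +-comm 1 (suc s) ⟩
  suc s + 1  ≤⟨ +-monoʳ-≤ (suc s) (s≤s z≤n) ⟩
  suc s + suc s  ≤⟨ +-mono-≤ (suc≤2^ s) (suc≤2^ s) ⟩
  2 ^ s + 2 ^ s  ≡⟨ cong (2 ^ s +_) (sym (+-identityʳ _)) ⟩
  2 ^ suc s  ∎
  where open ≤-Reasoning

growth-iterated : ∀ X σ j g e → 1 ≤ X → 2 * (σ * j) ≤ X → e ≤ j * g → (X + σ) ^ e ≤ 2 ^ g * X ^ e
growth-iterated X σ j g e 1≤X small e≤ with m≤n⇒∃[o]m+o≡n e≤
... | d , eqd = cancelʳ (X ^ d) (^>0 X d 1≤X) (begin
  (X + σ) ^ e * X ^ d  ≤⟨ *-monoʳ-≤ ((X + σ) ^ e) (^-monoˡ-≤ d (m≤m+n X σ)) ⟩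
  (X + σ) ^ e * (X + σ) ^ d  ≡⟨ trans (sym (^-distribˡ-+-* (X + σ) e d)) (cong ((X + σ) ^_) eqd) ⟩
  (X + σ) ^ (j * g)  ≡⟨ sym (^-*-assoc (X + σ) j g) ⟩
  ((X + σ) ^ j) ^ g  ≤⟨ ^-monoˡ-≤ g (growth≤2 X σ j 1≤X small) ⟩
  (2 * X ^ j) ^ g  ≡⟨ ^-*-distrib 2 (X ^ j) g ⟩
  2 ^ g * (X ^ j) ^ g  ≡⟨ cong (2 ^ g *_) (trans (^-*-assoc X j g) (trans (cong (X ^_) (sym eqd)) (^-distribˡ-+-* X e d))) ⟩
  2 ^ g * (X ^ e * X ^ d)  ≡⟨ sym (*-assoc (2 ^ g) _ _) ⟩
  2 ^ g * X ^ e * X ^ d  ∎)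
  where open ≤-Reasoning

-- The expected number of short edges is at most 2 n² r / (T D). One factor n is the choice of the
-- first vertex, the other stems from the bound on |E|; `T` outweighs both, and `D` the rest.
short-numeric : ∀ S P r K lam n n′ D W T → 1 ≤ r → 1 ≤ K → 1 ≤ T →
  S * (r * K) ^ n′ ≤ P * (n * (lam ^ n′ * W)) → T * lam ^ n′ ≤ K ^ n′ → W * D ≤ 2 * n * (r * r ^ n′) →
  n * n ≤ 16 * T → 256 * r ≤ D → 8 * S ≤ P
short-numeric S P r K lam n n′ D W T 1≤r 1≤K 1≤T h₁ h₂ h₃ h₄ h₅ =
  cancelʳ (32 * r) (≤-trans 1≤r (m≤n*m r 32)) (begin
    8 * S * (32 * r)  ≡⟨ e₀ S r ⟩
    S * (256 * r)  ≤⟨ *-monoʳ-≤ S h₅ ⟩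
    S * D  ≤⟨ SD ⟩
    P * (32 * r)  ∎)
  where
  open ≤-Reasoning
  e₀ : ∀ S r → 8 * S * (32 * r) ≡ S * (256 * r)
  e₀ S r = trans (sym (*-assoc (8 * S) 32 r)) (trans (cong (_* r) (trans (*-assoc 8 S 32) (trans (cong (8 *_) (*-comm S 32)) (sym (*-assoc 8 32 S))))) (trans (cong (_* r) (*-comm 256 S)) (*-assoc S 256 r)))
  a = r ^ n′
  b = K ^ n′
  SD : S * D ≤ P * (32 * r)
  SD = cancelʳ (a * b * T) (*-mono-≤ (*-mono-≤ (^>0 r n′ 1≤r) (^>0 K n′ 1≤K)) 1≤T) (begin
    S * D * (a * b * T)  ≡⟨ e₁ S D a b T ⟩
    S * (a * b) * (T * D)  ≡⟨ cong (λ z → S * z * (T * D)) (sym (^-*-distrib r K n′)) ⟩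
    S * (r * K) ^ n′ * (T * D)  ≤⟨ *-monoˡ-≤ (T * D) h₁ ⟩
    P * (n * (lam ^ n′ * W)) * (T * D)  ≡⟨ e₂ P n (lam ^ n′) W T D ⟩
    P * n * (T * lam ^ n′) * (W * D)  ≤⟨ *-mono-≤ (*-monoʳ-≤ (P * n) h₂) h₃ ⟩
    P * n * b * (2 * n * (r * a))  ≡⟨ e₃ P n b r a ⟩
    P * (2 * r * (a * b)) * (n * n)  ≤⟨ *-monoʳ-≤ (P * (2 * r * (a * b))) h₄ ⟩
    P * (2 * r * (a * b)) * (16 * T)  ≡⟨ e₄ P r (a * b) T ⟩
    P * (32 * r) * (a * b * T)  ∎)
    where
    e₁ : ∀ S D a b T → S * D * (a * b * T) ≡ S * (a * b) * (T * D)
    e₁ = solve-∀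
    e₂ : ∀ P n m W T D → P * (n * (m * W)) * (T * D) ≡ P * n * (T * m) * (W * D)
    e₂ = solve-∀
    e₃ : ∀ P n b r a → P * n * b * (2 * n * (r * a)) ≡ P * (2 * r * (a * b)) * (n * n)
    e₃ = solve-∀
    e₄ : ∀ P r c T → P * (2 * r * c) * (16 * T) ≡ P * (32 * r) * (c * T)
    e₄ = solve-∀

-- The expected number is at most 2 (2E)^r (6l/n)^s / (s! r^(r n′)). The bound on |E| turns this
-- into 2 * 6^s r^r / (50^r s!), and r^r / s! ≤ 4^r r ≤ 4 * 8^s leaves 8 * 48^s / 50^r ≤ 8/50.
long-chain-numeric : ∀ R P r s K L n n′ l W E Y z → 1 ≤ K → 1 ≤ n → r ≡ suc s → L ≡ r * K →
  R * (L ^ (r * n′ + s) * r ^ (r * n′)) ≤ P * Y * (L + s) ^ (r * n′) * W ^ r →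
  Y * s ! ≤ (z + s) ^ s → (z + s) * n ≤ 6 * l * L → 2 * (1 * (r * n′)) ≤ K → W ≤ 2 * E →
  (100 * E) ^ r * l ^ s ≤ n ^ s * r ^ (r * suc n′) → r ^ r ≤ 4 ^ r * r ! → 4 * R ≤ P
long-chain-numeric R P r s K .(r * K) n n′ l W E Y z 1≤K 1≤n req refl h₀ h₁ h₂ h₃ h₄ h₅ h₆ = final
  where
  open ≤-Reasoning
  L = r * K
  a = r ^ (r * n′)
  b = K ^ (r * n′)
  1≤r : 1 ≤ r
  1≤r = ≤-trans (s≤s z≤n) (≤-reflexive (sym req))
  L^≡ : L ^ (r * n′) ≡ a * b
  L^≡ = ^-*-distrib r K (r * n′)
  base≤ : (L + s) ^ (r * n′) ≤ a * (2 * b)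
  base≤ = begin
    (L + s) ^ (r * n′)  ≤⟨ ^-monoˡ-≤ (r * n′) (≤-trans (+-monoʳ-≤ L (≤-trans (n≤1+n s) (≤-reflexive (sym req)))) (≤-reflexive (e r K))) ⟩
    (r * (K + 1)) ^ (r * n′)  ≡⟨ ^-*-distrib r (K + 1) (r * n′) ⟩
    a * (K + 1) ^ (r * n′)  ≤⟨ *-monoʳ-≤ a (growth≤2 K 1 (r * n′) 1≤K h₃) ⟩
    a * (2 * b)  ∎
    where e : ∀ r K → r * K + r ≡ r * (K + 1)
          e = solve-∀
  step₁ : R * (a * L ^ s) ≤ 2 * P * Y * W ^ r
  step₁ = cancelʳ (a * b) (*-mono-≤ (^>0 r (r * n′) 1≤r) (^>0 K (r * n′) 1≤K)) (begin
    R * (a * L ^ s) * (a * b)  ≡⟨ e₁ R a (L ^ s) b ⟩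
    R * (a * b * L ^ s * a)  ≡⟨ cong (λ w → R * (w * a)) (trans (cong (_* L ^ s) (sym L^≡)) (sym (^-distribˡ-+-* L (r * n′) s))) ⟩
    R * (L ^ (r * n′ + s) * a)  ≤⟨ h₀ ⟩
    P * Y * (L + s) ^ (r * n′) * W ^ r  ≤⟨ *-monoˡ-≤ (W ^ r) (*-monoʳ-≤ (P * Y) base≤) ⟩
    P * Y * (a * (2 * b)) * W ^ r  ≡⟨ e₂ P Y a b (W ^ r) ⟩
    2 * P * Y * W ^ r * (a * b)  ∎)
    where
    e₁ : ∀ R a c b → R * (a * c) * (a * b) ≡ R * (a * b * c * a)
    e₁ = solve-∀
    e₂ : ∀ P Y a b w → P * Y * (a * (2 * b)) * w ≡ 2 * P * Y * w * (a * b)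
    e₂ = solve-∀
  step₂ : R * a * s ! * n ^ s ≤ 2 * P * (6 ^ s * l ^ s) * W ^ r
  step₂ = cancelʳ (L ^ s) (^>0 L s (*-mono-≤ 1≤r 1≤K)) (begin
    R * a * s ! * n ^ s * L ^ s  ≡⟨ e₁ R a (s !) (n ^ s) (L ^ s) ⟩
    R * (a * L ^ s) * (s ! * n ^ s)  ≤⟨ *-monoˡ-≤ (s ! * n ^ s) step₁ ⟩
    2 * P * Y * W ^ r * (s ! * n ^ s)  ≡⟨ e₂ P Y (W ^ r) (s !) (n ^ s) ⟩
    2 * P * W ^ r * (Y * s ! * n ^ s)  ≤⟨ *-monoʳ-≤ (2 * P * W ^ r) (*-monoˡ-≤ (n ^ s) h₁) ⟩
    2 * P * W ^ r * ((z + s) ^ s * n ^ s)  ≡⟨ cong (2 * P * W ^ r *_) (sym (^-*-distrib (z + s) n s)) ⟩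
    2 * P * W ^ r * ((z + s) * n) ^ s  ≤⟨ *-monoʳ-≤ (2 * P * W ^ r) (^-monoˡ-≤ s h₂) ⟩
    2 * P * W ^ r * (6 * l * L) ^ s  ≡⟨ cong (2 * P * W ^ r *_) (trans (^-*-distrib (6 * l) L s) (cong (_* L ^ s) (^-*-distrib 6 l s))) ⟩
    2 * P * W ^ r * (6 ^ s * l ^ s * L ^ s)  ≡⟨ e₃ (2 * P) (W ^ r) (6 ^ s * l ^ s) (L ^ s) ⟩
    2 * P * (6 ^ s * l ^ s) * W ^ r * L ^ s  ∎)
    where
    e₁ : ∀ R a f m c → R * a * f * m * c ≡ R * (a * c) * (f * m)
    e₁ = solve-∀
    e₂ : ∀ P Y w f m → 2 * P * Y * w * (f * m) ≡ 2 * P * w * (Y * f * m)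
    e₂ = solve-∀
    e₃ : ∀ p w x c → p * w * (x * c) ≡ p * x * w * c
    e₃ = solve-∀
  W^≤ : W ^ r * 50 ^ r ≤ (100 * E) ^ r
  W^≤ = ≤-trans (≤-reflexive (sym (^-*-distrib W 50 r))) (^-monoˡ-≤ r (≤-trans (*-monoˡ-≤ 50 h₄) (≤-reflexive (e E))))
    where e : ∀ E → 2 * E * 50 ≡ 100 * E
          e E = trans (cong (_* 50) (*-comm 2 E)) (trans (*-assoc E 2 50) (*-comm E 100))
  step₃ : R * s ! * 50 ^ r ≤ 2 * P * 6 ^ s * r ^ r
  step₃ = cancelʳ (a * n ^ s) (*-mono-≤ (^>0 r (r * n′) 1≤r) (^>0 n s 1≤n)) (begin
    R * s ! * 50 ^ r * (a * n ^ s)  ≡⟨ e₁ R (s !) (50 ^ r) a (n ^ s) ⟩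
    R * a * s ! * n ^ s * 50 ^ r  ≤⟨ *-monoˡ-≤ (50 ^ r) step₂ ⟩
    2 * P * (6 ^ s * l ^ s) * W ^ r * 50 ^ r  ≡⟨ e₂ (2 * P) (6 ^ s) (l ^ s) (W ^ r) (50 ^ r) ⟩
    2 * P * 6 ^ s * (W ^ r * 50 ^ r * l ^ s)  ≤⟨ *-monoʳ-≤ (2 * P * 6 ^ s) (*-monoˡ-≤ (l ^ s) W^≤) ⟩
    2 * P * 6 ^ s * ((100 * E) ^ r * l ^ s)  ≤⟨ *-monoʳ-≤ (2 * P * 6 ^ s) h₅ ⟩
    2 * P * 6 ^ s * (n ^ s * r ^ (r * suc n′))  ≡⟨ cong (λ w → 2 * P * 6 ^ s * (n ^ s * w)) (trans (cong (r ^_) (*-suc r n′)) (^-distribˡ-+-* r r (r * n′))) ⟩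
    2 * P * 6 ^ s * (n ^ s * (r ^ r * a))  ≡⟨ e₃ (2 * P * 6 ^ s) (n ^ s) (r ^ r) a ⟩
    2 * P * 6 ^ s * r ^ r * (a * n ^ s)  ∎)
    where
    e₁ : ∀ R f c a m → R * f * c * (a * m) ≡ R * a * f * m * c
    e₁ = solve-∀
    e₂ : ∀ p x y w c → p * (x * y) * w * c ≡ p * x * (w * c * y)
    e₂ = solve-∀
    e₃ : ∀ p m q a → p * (m * (q * a)) ≡ p * q * (a * m)
    e₃ = solve-∀
  r!≡ : r ! ≡ r * s !
  r!≡ rewrite req = refl
  step₄ : R * 50 ^ r ≤ 2 * P * 6 ^ s * (4 ^ r * r)
  step₄ = cancelʳ (s !) (1≤n! s) (begin
    R * 50 ^ r * s !  ≡⟨ e₁ R (50 ^ r) (s !) ⟩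
    R * s ! * 50 ^ r  ≤⟨ step₃ ⟩
    2 * P * 6 ^ s * r ^ r  ≤⟨ *-monoʳ-≤ (2 * P * 6 ^ s) (≤-trans h₆ (≤-reflexive (cong (4 ^ r *_) r!≡))) ⟩
    2 * P * 6 ^ s * (4 ^ r * (r * s !))  ≡⟨ e₂ (2 * P * 6 ^ s) (4 ^ r) r (s !) ⟩
    2 * P * 6 ^ s * (4 ^ r * r) * s !  ∎)
    where
    e₁ : ∀ a b c → a * b * c ≡ a * c * b
    e₁ = solve-∀
    e₂ : ∀ a b c d → a * (b * (c * d)) ≡ a * (b * c) * d
    e₂ = solve-∀
  step₅ : R * 50 ≤ 8 * P
  step₅ = cancelʳ (50 ^ s) (^>0 50 s (s≤s z≤n)) (begin
    R * 50 * 50 ^ s  ≡⟨ trans (*-assoc R 50 (50 ^ s)) (cong (λ k → R * 50 ^ k) (sym req)) ⟩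
    R * 50 ^ r  ≤⟨ step₄ ⟩
    2 * P * 6 ^ s * (4 ^ r * r)  ≤⟨ *-monoʳ-≤ (2 * P * 6 ^ s) (*-monoʳ-≤ (4 ^ r) (≤-trans (≤-reflexive req) (suc≤2^ s))) ⟩
    2 * P * 6 ^ s * (4 ^ r * 2 ^ s)  ≡⟨ cong (λ k → 2 * P * 6 ^ s * (4 ^ k * 2 ^ s)) req ⟩
    2 * P * 6 ^ s * (4 * 4 ^ s * 2 ^ s)  ≡⟨ e P (6 ^ s) (4 ^ s) (2 ^ s) ⟩
    8 * P * (6 ^ s * 4 ^ s * 2 ^ s)  ≡⟨ cong (8 * P *_) (trans (cong (_* 2 ^ s) (sym (^-*-distrib 6 4 s))) (sym (^-*-distrib 24 2 s))) ⟩
    8 * P * 48 ^ s  ≤⟨ *-monoʳ-≤ (8 * P) (^-monoˡ-≤ s (≤-trans (n≤1+n 48) (n≤1+n 49))) ⟩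
    8 * P * 50 ^ s  ∎)
    where e : ∀ P x y z → 2 * P * x * (4 * y * z) ≡ 8 * P * (x * y * z)
          e = solve-∀
  final : 4 * R ≤ P
  final = *-cancelˡ-≤ 8 (begin
    8 * (4 * R)  ≡⟨ sym (*-assoc 8 4 R) ⟩
    32 * R  ≤⟨ *-monoˡ-≤ R (m≤m+n 32 18) ⟩
    50 * R  ≡⟨ *-comm 50 R ⟩
    R * 50  ≤⟨ step₅ ⟩
    8 * P  ∎)

-- Each edge contributes at most 2nr / D and each of the `k` links at most 6l / n; the tolerance
-- contributes `2 ^ g`. Pairing links with edges gives (12lr / D)^k ≤ 1, and the unpaired edge
-- leaves 2nr `2 ^ g` / D with `D ≡ 2 ^ g * 2 ^ g`.
aligned-numeric : ∀ C P m k K L r n n′ l g D W Y z σ h base → 1 ≤ K → 1 ≤ n → 1 ≤ r → m ≡ suc k → L ≡ r * K →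
  C * (L ^ (m * n′ + k) * m ^ (m * n′)) ≤ P * Y * base ^ (m * n′) * W ^ m →
  base ≤ m * K + σ → Y * k ! ≤ (z + k) ^ k → (z + k) * n ≤ 6 * l * L →
  2 * (σ * (m * h)) ≤ m * K → n′ ≤ h * g → W * D ≤ 2 * n * (r * r ^ n′) →
  D ≡ 2 ^ g * 2 ^ g → 12 * (l * r) ≤ D → C * 2 ^ g ≤ P * (2 * (n * r))
aligned-numeric C P m k K .(r * K) r n n′ l g D W Y z σ h base 1≤K 1≤n 1≤r meq refl h₀ h₁ h₂ h₃ h₄ h₅ h₆ h₇ h₈ = final
  where
  open ≤-Reasoning
  L = r * K
  c = m ^ (m * n′)
  b = K ^ (m * n′)
  a = r ^ (m * n′)
  1≤m : 1 ≤ m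
  1≤m = ≤-trans (s≤s z≤n) (≤-reflexive (sym meq))
  1≤D : 1 ≤ D
  1≤D = ≤-trans (*-mono-≤ (^>0 2 g (s≤s z≤n)) (^>0 2 g (s≤s z≤n))) (≤-reflexive (sym h₇))
  base≤ : base ^ (m * n′) ≤ 2 ^ g * (c * b)
  base≤ = begin
    base ^ (m * n′)  ≤⟨ ^-monoˡ-≤ (m * n′) h₁ ⟩
    (m * K + σ) ^ (m * n′)  ≤⟨ growth-iterated (m * K) σ (m * h) g (m * n′) (*-mono-≤ 1≤m 1≤K) h₄ (≤-trans (*-monoʳ-≤ m h₅) (≤-reflexive (sym (*-assoc m h g)))) ⟩
    2 ^ g * (m * K) ^ (m * n′)  ≡⟨ cong (2 ^ g *_) (^-*-distrib m K (m * n′)) ⟩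
    2 ^ g * (c * b)  ∎
  step₁ : C * (a * L ^ k) ≤ P * Y * 2 ^ g * W ^ m
  step₁ = cancelʳ (b * c) (*-mono-≤ (^>0 K (m * n′) 1≤K) (^>0 m (m * n′) 1≤m)) (begin
    C * (a * L ^ k) * (b * c)  ≡⟨ e₁ C a (L ^ k) b c ⟩
    C * (a * b * L ^ k * c)  ≡⟨ cong (λ w → C * (w * c)) (trans (cong (_* L ^ k) (sym (^-*-distrib r K (m * n′)))) (sym (^-distribˡ-+-* L (m * n′) k))) ⟩
    C * (L ^ (m * n′ + k) * c)  ≤⟨ h₀ ⟩
    P * Y * base ^ (m * n′) * W ^ m  ≤⟨ *-monoˡ-≤ (W ^ m) (*-monoʳ-≤ (P * Y) base≤) ⟩
    P * Y * (2 ^ g * (c * b)) * W ^ m  ≡⟨ e₂ (P * Y) (2 ^ g) c b (W ^ m) ⟩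
    P * Y * 2 ^ g * W ^ m * (b * c)  ∎)
    where
    e₁ : ∀ R a c b d → R * (a * c) * (b * d) ≡ R * (a * b * c * d)
    e₁ = solve-∀
    e₂ : ∀ p x a b w → p * (x * (a * b)) * w ≡ p * x * w * (b * a)
    e₂ = solve-∀
  Y≤ : Y ≤ (z + k) ^ k
  Y≤ = ≤-trans (m≤m*n Y (k !) {{k !≢0}}) h₂
  step₂ : C * a * n ^ k ≤ P * (6 * l) ^ k * 2 ^ g * W ^ m
  step₂ = cancelʳ (L ^ k) (^>0 L k (*-mono-≤ 1≤r 1≤K)) (begin
    C * a * n ^ k * L ^ k  ≡⟨ e₁ C a (n ^ k) (L ^ k) ⟩
    C * (a * L ^ k) * n ^ k  ≤⟨ *-monoˡ-≤ (n ^ k) step₁ ⟩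
    P * Y * 2 ^ g * W ^ m * n ^ k  ≡⟨ e₂ P Y (2 ^ g) (W ^ m) (n ^ k) ⟩
    P * 2 ^ g * W ^ m * (Y * n ^ k)  ≤⟨ *-monoʳ-≤ (P * 2 ^ g * W ^ m) (*-monoˡ-≤ (n ^ k) Y≤) ⟩
    P * 2 ^ g * W ^ m * ((z + k) ^ k * n ^ k) ≡⟨ cong (P * 2 ^ g * W ^ m *_) (sym (^-*-distrib (z + k) n k)) ⟩
    P * 2 ^ g * W ^ m * ((z + k) * n) ^ k  ≤⟨ *-monoʳ-≤ (P * 2 ^ g * W ^ m) (^-monoˡ-≤ k h₃) ⟩
    P * 2 ^ g * W ^ m * (6 * l * L) ^ k  ≡⟨ cong (P * 2 ^ g * W ^ m *_) (^-*-distrib (6 * l) L k) ⟩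
    P * 2 ^ g * W ^ m * ((6 * l) ^ k * L ^ k) ≡⟨ e₃ P (2 ^ g) (W ^ m) ((6 * l) ^ k) (L ^ k) ⟩
    P * (6 * l) ^ k * 2 ^ g * W ^ m * L ^ k  ∎)
    where
    e₁ : ∀ R a m c → R * a * m * c ≡ R * (a * c) * m
    e₁ = solve-∀
    e₂ : ∀ P Y x w m → P * Y * x * w * m ≡ P * x * w * (Y * m)
    e₂ = solve-∀
    e₃ : ∀ p x w y c → p * x * w * (y * c) ≡ p * y * x * w * c
    e₃ = solve-∀
  WD≤ : W ^ m * D ^ m ≤ (2 * (n * r)) ^ m * a
  WD≤ = begin
    W ^ m * D ^ m  ≡⟨ sym (^-*-distrib W D m) ⟩
    (W * D) ^ m  ≤⟨ ^-monoˡ-≤ m h₆ ⟩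
    (2 * n * (r * r ^ n′)) ^ m  ≡⟨ cong (_^ m) (e n r (r ^ n′)) ⟩
    (2 * (n * r) * r ^ n′) ^ m  ≡⟨ ^-*-distrib (2 * (n * r)) (r ^ n′) m ⟩
    (2 * (n * r)) ^ m * (r ^ n′) ^ m ≡⟨ cong ((2 * (n * r)) ^ m *_) (trans (^-*-assoc r n′ m) (cong (r ^_) (*-comm n′ m))) ⟩
    (2 * (n * r)) ^ m * a  ∎
    where e : ∀ n r p → 2 * n * (r * p) ≡ 2 * (n * r) * p
          e = solve-∀
  step₃ : C * n ^ k * D ^ m ≤ P * (6 * l) ^ k * 2 ^ g * (2 * (n * r)) ^ m
  step₃ = cancelʳ a (^>0 r (m * n′) 1≤r) (begin
    C * n ^ k * D ^ m * a  ≡⟨ e₁ C (n ^ k) (D ^ m) a ⟩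
    C * a * n ^ k * D ^ m  ≤⟨ *-monoˡ-≤ (D ^ m) step₂ ⟩
    P * (6 * l) ^ k * 2 ^ g * W ^ m * D ^ m  ≡⟨ *-assoc (P * (6 * l) ^ k * 2 ^ g) (W ^ m) (D ^ m) ⟩
    P * (6 * l) ^ k * 2 ^ g * (W ^ m * D ^ m)  ≤⟨ *-monoʳ-≤ (P * (6 * l) ^ k * 2 ^ g) WD≤ ⟩
    P * (6 * l) ^ k * 2 ^ g * ((2 * (n * r)) ^ m * a)  ≡⟨ sym (*-assoc (P * (6 * l) ^ k * 2 ^ g) _ a) ⟩
    P * (6 * l) ^ k * 2 ^ g * (2 * (n * r)) ^ m * a  ∎)
    where
    e₁ : ∀ R a m c → R * a * m * c ≡ R * c * a * m
    e₁ = solve-∀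
  split : (6 * l) ^ k * (2 * (n * r)) ^ k ≡ n ^ k * (12 * (l * r)) ^ k
  split = trans (sym (^-*-distrib (6 * l) (2 * (n * r)) k)) (trans (cong (_^ k) (e l n r)) (^-*-distrib n (12 * (l * r)) k))
    where e : ∀ l n r → 6 * l * (2 * (n * r)) ≡ n * (12 * (l * r))
          e = solve-∀
  step₄ : C * D ≤ P * 2 ^ g * (2 * (n * r))
  step₄ = cancelʳ (n ^ k * D ^ k) (*-mono-≤ (^>0 n k 1≤n) (^>0 D k 1≤D)) (begin
    C * D * (n ^ k * D ^ k)  ≡⟨ e₁ C D (n ^ k) (D ^ k) ⟩
    C * n ^ k * D ^ suc k  ≡⟨ cong (λ i → C * n ^ k * D ^ i) (sym meq) ⟩
    C * n ^ k * D ^ m  ≤⟨ step₃ ⟩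
    P * (6 * l) ^ k * 2 ^ g * (2 * (n * r)) ^ m  ≡⟨ cong (λ i → P * (6 * l) ^ k * 2 ^ g * (2 * (n * r)) ^ i) meq ⟩
    P * (6 * l) ^ k * 2 ^ g * (2 * (n * r) * (2 * (n * r)) ^ k)  ≡⟨ e₂ P ((6 * l) ^ k) (2 ^ g) (2 * (n * r)) ((2 * (n * r)) ^ k) ⟩
    P * 2 ^ g * (2 * (n * r)) * ((6 * l) ^ k * (2 * (n * r)) ^ k) ≡⟨ cong (P * 2 ^ g * (2 * (n * r)) *_) split ⟩
    P * 2 ^ g * (2 * (n * r)) * (n ^ k * (12 * (l * r)) ^ k)  ≤⟨ *-monoʳ-≤ (P * 2 ^ g * (2 * (n * r))) (*-monoʳ-≤ (n ^ k) (^-monoˡ-≤ k h₈)) ⟩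
    P * 2 ^ g * (2 * (n * r)) * (n ^ k * D ^ k)  ∎)
    where
    e₁ : ∀ C D a b → C * D * (a * b) ≡ C * a * (D * b)
    e₁ = solve-∀
    e₂ : ∀ P x y u v → P * x * y * (u * v) ≡ P * y * u * (x * v)
    e₂ = solve-∀
  final : C * 2 ^ g ≤ P * (2 * (n * r))
  final = cancelʳ (2 ^ g) (^>0 2 g (s≤s z≤n)) (begin
    C * 2 ^ g * 2 ^ g  ≡⟨ trans (*-assoc C (2 ^ g) (2 ^ g)) (cong (C *_) (sym h₇)) ⟩
    C * D  ≤⟨ step₄ ⟩
    P * 2 ^ g * (2 * (n * r))  ≡⟨ e P (2 ^ g) (2 * (n * r)) ⟩
    P * (2 * (n * r)) * 2 ^ g  ∎)
    where e : ∀ a b c → a * b * c ≡ a * c * b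
          e = solve-∀

-- There are `2 * s` thresholds to watch, so failure probability 1 / (16 s) for each gives 1/8 in
-- total.
deviation-numeric : ∀ F P A δ θ L s → 1 ≤ A → 1 ≤ L → θ ≤ L →
  F * (A * δ * (A * δ)) ≤ P * (A * (θ * L)) → 16 * s * (L * L) ≤ A * (δ * δ) → F * (16 * s) ≤ P
deviation-numeric F P A δ θ L s 1≤A 1≤L θ≤L h₁ h₂ = cancelʳ (A * (L * L)) (*-mono-≤ 1≤A (*-mono-≤ 1≤L 1≤L)) (begin
  F * (16 * s) * (A * (L * L))  ≡⟨ e₁ F (16 * s) A (L * L) ⟩
  F * A * (16 * s * (L * L))  ≤⟨ *-monoʳ-≤ (F * A) h₂ ⟩
  F * A * (A * (δ * δ))  ≡⟨ e₂ F A δ ⟩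
  F * (A * δ * (A * δ))  ≤⟨ h₁ ⟩
  P * (A * (θ * L))  ≤⟨ *-monoʳ-≤ P (*-monoʳ-≤ A (*-monoˡ-≤ L θ≤L)) ⟩
  P * (A * (L * L))  ∎)
  where
  open ≤-Reasoning
  e₁ : ∀ F s A L → F * s * (A * L) ≡ F * A * (s * L)
  e₁ = solve-∀
  e₂ : ∀ F A d → F * A * (A * (d * d)) ≡ F * (A * d * (A * d))
  e₂ = solve-∀

-- Existence of good weights when there are many vertices

extremum : (_⊑_ : ℕ → ℕ → Set) → (∀ a b → a ⊑ b ⊎ b ⊑ a) → (∀ {a b c} → a ⊑ b → b ⊑ c → a ⊑ c) →
           ∀ {N} (e : Subset N) (f : Fin N → ℕ) → ∃ (_∈ e) → ∃ λ u → u ∈ e × (∀ w → w ∈ e → f u ⊑ f w)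
extremum _⊑_ total trans⊑ {suc N} (b ∷ e) f (v , v∈) = by (any? (_∈? e)) (zero ∈? (b ∷ e))
  where
  refl⊑ : ∀ a → a ⊑ a
  refl⊑ a with total a a
  ... | inj₁ p = p
  ... | inj₂ p = p
  none : ¬ ∃ (_∈ e) → ∀ w → suc w ∈ (b ∷ e) → ∀ {A : Set} → A
  none ¬t w w∈ = ⊥-elim (¬t (w , drop-there w∈))
  by : Dec (∃ (_∈ e)) → Dec (zero ∈ (b ∷ e)) → ∃ λ u → u ∈ (b ∷ e) × (∀ w → w ∈ (b ∷ e) → f u ⊑ f w)
  by (no ¬t) (no ¬z) = ⊥-elim (nope v v∈)
    where nope : ∀ v → v ∈ (b ∷ e) → ⊥
          nope zero    v∈ = ¬z v∈
          nope (suc v) v∈ = ¬t (v , drop-there v∈)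
  by (no ¬t) (yes z) = zero , z , λ { zero _ → refl⊑ (f zero) ; (suc w) w∈ → none ¬t w w∈ }
  by (yes t) dz with extremum _⊑_ total trans⊑ e (f ∘ suc) t
  ... | u , u∈ , least with dz
  ...   | no ¬z = suc u , there u∈ , λ { zero w∈ → ⊥-elim (¬z w∈) ; (suc w) w∈ → least w (drop-there w∈) }
  ...   | yes z with total (f zero) (f (suc u))
  ...     | inj₁ le = zero , z , λ { zero _ → refl⊑ (f zero) ; (suc w) w∈ → trans⊑ le (least w (drop-there w∈)) }
  ...     | inj₂ ge = suc u , there u∈ , λ { zero _ → ge ; (suc w) w∈ → least w (drop-there w∈) }

∣p∣>0⇒nonempty : ∀ {N} (p : Subset N) → 1 ≤ ∣ p ∣ → ∃ (_∈ p)
∣p∣>0⇒nonempty (inside ∷ p)  _  = zero , here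
∣p∣>0⇒nonempty (outside ∷ p) le = let (v , v∈) = ∣p∣>0⇒nonempty p le in suc v , there v∈

simplex≤ : ∀ lam b m z → Gaps.simplex lam b m z ≤ (z + m) ^ m
simplex≤ lam b m zero    = z≤n
simplex≤ lam b m (suc z) = ^-monoˡ-≤ m (n≤1+n (z + m))

-- The numerical facts are collected as parameters so that the combinatorics stays free of the
-- choice of constants. Weights range over `r` ideal blocks of length `K`; every edge is to have
-- spread `lam = K - w`; `δ` is the tolerance at block boundaries; the reservoir has `M` vertices
-- per colour.
module ManyVertices
  {N : ℕ} (s q n′ l g h M K w lam δ T E : ℕ) (N≡ : N ≡ suc s * q)
  (es : List (Subset N)) (sizes : ∀ {e} → e ∈ₗ es → ∣ e ∣ ≡ suc (suc n′))
  (1≤s : 1 ≤ s) (K≡ : K ≡ lam + w) (1≤lam : 1 ≤ lam) (w≤lam : w ≤ lam)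
  (wide : suc s * w + (δ + δ) < K) (M<q : M < q) (1≤T : 1 ≤ T)
  (R : Subset N) (∣R∣≡ : ∣ R ∣ ≡ suc s * M) (∣R∣<n : suc s * M < suc (suc n′))
  (ΦR≤ : ∑ es (λ e → (2 * suc s) ^ ∣ e ∩ R ∣) ≤ 2 * E)
  (E-root : E * (2 ^ g * 2 ^ g) ≤ suc (suc n′) * (suc s * suc s ^ n′))
  (E-bound : (100 * E) ^ suc s * l ^ s ≤ suc (suc n′) ^ s * suc s ^ (suc s * suc n′))
  (num-short : T * lam ^ n′ ≤ K ^ n′)
  (num-n² : suc (suc n′) * suc (suc n′) ≤ 16 * T)
  (num-D : 256 * suc s ≤ 2 ^ g * 2 ^ g)
  (num-D′ : 12 * (l * suc s) ≤ 2 ^ g * 2 ^ g)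
  (num-K : 2 * (1 * (suc s * n′)) ≤ K)
  (num-links : (suc s * w + (δ + δ) + suc s) * suc (suc n′) ≤ 6 * l * (suc s * K))
  (num-σ : 2 * ((δ + δ + suc s) * h) ≤ K)
  (num-h : n′ ≤ h * g)
  (num-dev : 16 * s * (suc s * K * (suc s * K)) ≤ suc s * (q ∸ M) * (δ * δ))
  (num-M : 16 * (suc s * (s * (2 * (suc (suc n′) * suc s)))) ≤ suc M * 2 ^ g)
  where

  r n L q′ ρ D P : ℕ
  r = suc s
  n = suc (suc n′)
  L = r * K
  q′ = q ∸ M
  ρ = 2 * r
  D = 2 ^ g * 2 ^ g
  P = L ^ N

  1≤K : 1 ≤ K
  1≤K = ≤-trans (s≤s z≤n) wide
  1≤L : 1 ≤ L
  1≤L = *-mono-≤ {1} {r} (s≤s z≤n) 1≤K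
  1≤q′ : 1 ≤ q′
  1≤q′ = m<n⇒0<n∸m M<q
  1≤P : 1 ≤ P
  1≤P = m^n>0 L {{>-nonZero 1≤L}} N
  lam≤K : lam ≤ K
  lam≤K = ≤-trans (m≤m+n lam w) (≤-reflexive (sym K≡))
  K≤2lam : K ≤ 2 * lam
  K≤2lam = ≤-trans (≤-reflexive K≡) (+-monoʳ-≤ lam (≤-trans w≤lam (≤-reflexive (sym (+-identityʳ lam)))))
  L≤ρlam : L ≤ ρ * lam
  L≤ρlam = ≤-trans (*-monoʳ-≤ r K≤2lam) (≤-reflexive (eq r lam))
    where eq : ∀ r a → r * (2 * a) ≡ 2 * r * a
          eq = solve-∀
  lam≤L : lam ≤ L
  lam≤L = ≤-trans lam≤K (m≤n*m K r)
  1≤ρ : 1 ≤ ρ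
  1≤ρ = s≤s z≤n

  A : Subset N
  A = ∁ R

  ∣A∣≡ : ∣ A ∣ ≡ r * q′
  ∣A∣≡ = trans (∣∁p∣≡n∸∣p∣ R) (trans (cong₂ _∸_ N≡ ∣R∣≡) (sym (*-distribˡ-∸ r q M)))

  -- For a trimmed edge `e ─ R` this is `∣ e ∩ R ∣`. Each missing vertex may cost the factor
  -- `L / lam`, at most `ρ = 2 * r`, so that `W` is the potential bounded by the reservoir.
  τ : Subset N → ℕ
  τ e = n ∸ ∣ e ∣

  es′ : List (Subset N)
  es′ = map (_─ R) es

  size-τ : ∀ e → n′ + 2 ≤ ∣ e ∣ + τ e
  size-τ e = ≤-trans (≤-reflexive (+-comm n′ 2)) (m≤n+m∸n n ∣ e ∣)

  W : ℕ
  W = ∑ es′ (λ e → ρ ^ τ e)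

  W≤2E : W ≤ 2 * E
  W≤2E = ≤-trans (≤-reflexive (∑-map (_─ R) es (λ e → ρ ^ τ e))) (≤-trans (∑-mono es (λ {e} e∈ → ≤-reflexive (cong (ρ ^_) (τ≡ e∈)))) ΦR≤)
    where
    τ≡ : ∀ {e} → e ∈ₗ es → τ (e ─ R) ≡ ∣ e ∩ R ∣
    τ≡ {e} e∈ = trans (cong (_∸ ∣ e ─ R ∣) (trans (sym (sizes e∈)) (sym (∣─∣+∣∩∣ e R)))) (m+n∸m≡n (∣ e ─ R ∣) (∣ e ∩ R ∣))

  WD≤ : W * D ≤ 2 * n * (r * r ^ n′)
  WD≤ = ≤-trans (*-monoˡ-≤ D W≤2E) (≤-trans (≤-reflexive (*-assoc 2 E D)) (≤-trans (*-monoʳ-≤ 2 E-root) (≤-reflexive (sym (*-assoc 2 n (r * r ^ n′))))))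

  trimmed-size : ∀ {e} → e ∈ₗ es′ → ∣ e ∣ ≤ n × 1 ≤ ∣ e ∣
  trimmed-size e∈ with ∈-map⁻ (_─ R) e∈
  ... | e₀ , e₀∈ , refl = ≤-trans (m≤m+n _ ∣ e₀ ∩ R ∣) (≤-reflexive (trans (∣─∣+∣∩∣ e₀ R) (sizes e₀∈)))
                        , +-cancelʳ-≤ (∣ e₀ ∩ R ∣) 1 (∣ e₀ ─ R ∣) (≤-trans (s≤s (≤-trans (p⊆q⇒∣p∣≤∣q∣ (λ v∈ → proj₂ (x∈p∩q⁻ e₀ R v∈))) (≤-reflexive ∣R∣≡)))
                            (≤-trans ∣R∣<n (≤-reflexive (sym (trans (∣─∣+∣∩∣ e₀ R) (sizes e₀∈))))))

  module SE = ShortEdges {N} L lam n′ ρ τ 1≤L lam≤L 1≤ρ L≤ρlam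
  module CS = ChainSum {N} L lam n′ ρ τ 1≤L 1≤lam 1≤ρ L≤ρlam es′ (λ {e} _ → size-τ e)

  shorts longs alarms aligned : Vec ℕ N → ℕ
  shorts x = ∑ es′ (λ e → ind (SE.short? x e))
  longs x = ∑ (tuples es′ (suc s)) (λ t → ind (Weighted.chainIn? x lam 0 (pred L) t))

  -- A boundary lies too low if too many vertices weigh less than `k * K - δ`, and too high if too
  -- few weigh at most `k * K + δ`; the successor in `θ₂` converts "at most" into the strict
  -- comparison of `below`. The deviation `d` is on the scale of counts multiplied by `L`.
  θ₁ θ₂ : ℕ → ℕ
  θ₁ k = (k * K ∸ δ) ⊓ L
  θ₂ k = suc (k * K + δ) ⊓ L

  d : ℕ
  d = ∣ A ∣ * δ

  low? : ∀ k x → Dec (Deviation.Far L (θ₁ k) (m⊓n≤n _ L) A d x)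
  low? k x = Deviation.far? L (θ₁ k) (m⊓n≤n _ L) A d x
  high? : ∀ k x → Dec (Deviation.Far L (θ₂ k) (m⊓n≤n _ L) A d x)
  high? k x = Deviation.far? L (θ₂ k) (m⊓n≤n _ L) A d x

  alarms x = ∑ (range 1 s) (λ k → ind (low? k x) + ind (high? k x))
  aligned x = ∑ (range 0 (suc s)) λ i → ∑ (range 1 s) λ m → ∑ (tuples es′ m) λ t →
                ind (Weighted.chainIn? x lam (i * K ∸ δ) ((i + m) * K + δ) t)

  Ω : List (Vec ℕ N)
  Ω = words L N

  shorts-rare : 8 * ∑ Ω shorts ≤ P
  shorts-rare = short-numeric (∑ Ω shorts) P r K lam n n′ D W T (s≤s z≤n) 1≤K 1≤T (begin
      ∑ Ω shorts * L ^ n′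
        ≡⟨ cong (_* L ^ n′) (∑-swap Ω es′ _) ⟩
      ∑ es′ (λ e → ∑ Ω (λ x → ind (SE.short? x e))) * L ^ n′
        ≡⟨ sym (∑-*ʳ es′ (L ^ n′) _) ⟩
      ∑ es′ (λ e → ∑ Ω (λ x → ind (SE.short? x e)) * L ^ n′)
        ≤⟨ ∑-mono es′ (λ {e} e∈ → ≤-trans (SE.short-edge e (size-τ e)) (*-monoʳ-≤ P (*-monoˡ-≤ (lam ^ n′ * ρ ^ τ e) (proj₁ (trimmed-size e∈))))) ⟩
      ∑ es′ (λ e → P * (n * (lam ^ n′ * ρ ^ τ e)))
        ≡⟨ trans (∑-*ˡ es′ P _) (cong (P *_) (trans (∑-*ˡ es′ n _) (cong (n *_) (∑-*ˡ es′ (lam ^ n′) _)))) ⟩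
      P * (n * (lam ^ n′ * W)) ∎)
    num-short WD≤ num-n² num-D
    where open ≤-Reasoning

  longs-rare : 4 * ∑ Ω longs ≤ P
  longs-rare = long-chain-numeric (∑ Ω longs) P r s K L n n′ l W E (length (Gaps.links lam (pred L) 0 s)) (r * w) 1≤K (s≤s z≤n) refl refl
    (≤-trans (CS.expectation s 0 (pred L) (≤-reflexive suc-b))
             (≤-reflexive (cong (λ z → P * length (Gaps.links lam (pred L) 0 s) * (z + s) ^ (r * n′) * W ^ r) suc-b)))
    (≤-trans (Gaps.length-links lam (pred L) 0 s) (≤-trans (simplex≤ lam (pred L) s _) (≤-reflexive (cong (λ z → (z + s) ^ s) room))))
    (≤-trans (*-monoˡ-≤ n (+-mono-≤ (m≤m+n (r * w) (δ + δ)) (n≤1+n s))) num-links)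
    num-K W≤2E E-bound (r^r≤4^r*r! r)
    where
    suc-b : suc (pred L) ≡ L
    suc-b = suc-pred L {{>-nonZero 1≤L}}
    room : suc (pred L) ∸ (0 + r * lam) ≡ r * w
    room = trans (cong (_∸ r * lam) (trans suc-b (trans (cong (r *_) K≡) (*-distribˡ-+ r lam w)))) (m+n∸m≡n (r * lam) (r * w))

  span : ∀ i m → suc ((i + m) * K + δ) ∸ (i * K ∸ δ) ≤ m * K + suc (δ + δ)
  span i m = m≤n+o⇒m∸n≤o (suc ((i + m) * K + δ)) (i * K ∸ δ) (begin
    suc ((i + m) * K + δ)  ≡⟨ e₁ i m K δ ⟩
    i * K + (m * K + suc δ)  ≤⟨ +-monoˡ-≤ (m * K + suc δ) (m≤n+m∸n (i * K) δ) ⟩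
    δ + (i * K ∸ δ) + (m * K + suc δ)  ≡⟨ e₂ δ (i * K ∸ δ) (m * K) ⟩
    i * K ∸ δ + (m * K + suc (δ + δ))  ∎)
    where
    open ≤-Reasoning
    e₁ : ∀ i m K d → suc ((i + m) * K + d) ≡ i * K + (m * K + suc d)
    e₁ = solve-∀
    e₂ : ∀ d a b → d + a + (b + suc d) ≡ a + (b + suc (d + d))
    e₂ = solve-∀

  aligned-one : ∀ i k → suc k ≤ s →
    ∑ Ω (λ x → ∑ (tuples es′ (suc k)) λ t → ind (Weighted.chainIn? x lam (i * K ∸ δ) ((i + suc k) * K + δ) t)) * 2 ^ g ≤ P * (2 * (n * r))
  aligned-one i k m≤s = aligned-numeric (∑ Ω (λ x → ∑ (tuples es′ (suc k)) λ t → ind (Weighted.chainIn? x lam a b t))) P m k K L r n n′ l g D W (length (Gaps.links lam b a k)) (m * w + suc (δ + δ)) (δ + δ + r) h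
      (suc b ∸ a + k) 1≤K (s≤s z≤n) (s≤s z≤n) refl refl
      (CS.expectation k a b fits) base≤
      (≤-trans (Gaps.length-links lam b a k) (≤-trans (simplex≤ lam b k _) (^-monoˡ-≤ k (+-monoˡ-≤ k room))))
      (≤-trans (*-monoˡ-≤ n count≤) num-links) σ≤ num-h WD≤ refl num-D′
    where
    open ≤-Reasoning
    m = suc k
    a = i * K ∸ δ
    b = (i + m) * K + δ
    k<r : suc k ≤ r
    k<r = m≤n⇒m≤1+n m≤s
    fits : suc b ∸ a ≤ L
    fits = begin
      suc b ∸ a  ≤⟨ span i m ⟩
      m * K + suc (δ + δ)  ≤⟨ +-mono-≤ (*-monoˡ-≤ K m≤s) (≤-trans (s≤s (m≤n+m (δ + δ) (r * w))) wide) ⟩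
      s * K + K  ≡⟨ +-comm (s * K) K ⟩
      L  ∎
    base≤ : suc b ∸ a + k ≤ m * K + (δ + δ + r)
    base≤ = begin
      suc b ∸ a + k  ≤⟨ +-monoˡ-≤ k (span i m) ⟩
      m * K + suc (δ + δ) + k  ≡⟨ e (m * K) (δ + δ) k ⟩
      m * K + (δ + δ + suc k)  ≤⟨ +-monoʳ-≤ (m * K) (+-monoʳ-≤ (δ + δ) k<r) ⟩
      m * K + (δ + δ + r)  ∎
      where e : ∀ a b k → a + suc b + k ≡ a + (b + suc k)
            e = solve-∀
    room : suc b ∸ (a + m * lam) ≤ m * w + suc (δ + δ)
    room = begin
      suc b ∸ (a + m * lam)  ≡⟨ sym (∸-+-assoc (suc b) a (m * lam)) ⟩
      suc b ∸ a ∸ m * lam  ≤⟨ ∸-monoˡ-≤ (m * lam) (span i m) ⟩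
      m * K + suc (δ + δ) ∸ m * lam  ≡⟨ cong (λ z → z + suc (δ + δ) ∸ m * lam) (trans (cong (m *_) K≡) (*-distribˡ-+ m lam w)) ⟩
      m * lam + m * w + suc (δ + δ) ∸ m * lam ≡⟨ trans (cong (_∸ m * lam) (+-assoc (m * lam) (m * w) _)) (m+n∸m≡n (m * lam) _) ⟩
      m * w + suc (δ + δ)  ∎
    count≤ : m * w + suc (δ + δ) + k ≤ r * w + (δ + δ) + r
    count≤ = begin
      m * w + suc (δ + δ) + k  ≡⟨ e (m * w) (δ + δ) k ⟩
      m * w + (δ + δ) + suc k  ≤⟨ +-mono-≤ (+-monoˡ-≤ (δ + δ) (*-monoˡ-≤ w k<r)) k<r ⟩
      r * w + (δ + δ) + r  ∎
      where e : ∀ a b k → a + suc b + k ≡ a + b + suc k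
            e = solve-∀
    σ≤ : 2 * ((δ + δ + r) * (m * h)) ≤ m * K
    σ≤ = ≤-trans (≤-reflexive (e (δ + δ + r) m h)) (*-monoʳ-≤ m num-σ)
      where e : ∀ σ m h → 2 * (σ * (m * h)) ≡ m * (2 * (σ * h))
            e = solve-∀

  aligned-few : 16 * ∑ Ω aligned ≤ suc M * P
  aligned-few = *-cancelʳ-≤ _ _ (2 ^ g) {{m^n≢0 2 g}} (begin
    16 * ∑ Ω aligned * 2 ^ g  ≡⟨ *-assoc 16 (∑ Ω aligned) (2 ^ g) ⟩
    16 * (∑ Ω aligned * 2 ^ g)  ≤⟨ *-monoʳ-≤ 16 total ⟩
    16 * (r * (s * (P * (2 * (n * r)))))  ≡⟨ cong (16 *_) (e₁ r s P (2 * (n * r))) ⟩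
    16 * (r * (s * (2 * (n * r))) * P)  ≡⟨ sym (*-assoc 16 (r * (s * (2 * (n * r)))) P) ⟩
    16 * (r * (s * (2 * (n * r)))) * P  ≤⟨ *-monoˡ-≤ P num-M ⟩
    suc M * 2 ^ g * P  ≡⟨ e₂ (suc M) (2 ^ g) P ⟩
    suc M * P * 2 ^ g  ∎)
    where
    open ≤-Reasoning
    e₁ : ∀ r s p x → r * (s * (p * x)) ≡ r * (s * x) * p
    e₁ = solve-∀
    e₂ : ∀ a b c → a * b * c ≡ a * c * b
    e₂ = solve-∀
    G : ℕ → ℕ → ℕ
    G i m = ∑ Ω (λ x → ∑ (tuples es′ m) λ t → ind (Weighted.chainIn? x lam (i * K ∸ δ) ((i + m) * K + δ) t))
    one : ∀ i m → 1 ≤ m → m ≤ s → G i m * 2 ^ g ≤ P * (2 * (n * r))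
    one i (suc k) _ m≤s = aligned-one i k m≤s
    total : ∑ Ω aligned * 2 ^ g ≤ r * (s * (P * (2 * (n * r))))
    total = begin
      ∑ Ω aligned * 2 ^ g
        ≡⟨ cong (_* 2 ^ g) (trans (∑-swap Ω (range 0 (suc s)) _) (∑-cong (range 0 (suc s)) (λ i → ∑-swap Ω (range 1 s) _))) ⟩
      (∑ (range 0 (suc s)) λ i → ∑ (range 1 s) λ m → G i m) * 2 ^ g
        ≡⟨ trans (sym (∑-*ʳ (range 0 (suc s)) (2 ^ g) (λ i → ∑ (range 1 s) (G i)))) (∑-cong (range 0 (suc s)) (λ i → sym (∑-*ʳ (range 1 s) (2 ^ g) (G i)))) ⟩
      (∑ (range 0 (suc s)) λ i → ∑ (range 1 s) λ m → G i m * 2 ^ g)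
        ≤⟨ ∑-mono (range 0 (suc s)) (λ {i} _ → ∑-mono (range 1 s) (λ {m} m∈ → one i m (proj₁ (∈-range⁻ 1 s m∈)) (s≤s⁻¹ (proj₂ (∈-range⁻ 1 s m∈))))) ⟩
      (∑ (range 0 (suc s)) λ i → ∑ (range 1 s) λ m → P * (2 * (n * r)))
        ≡⟨ trans (∑-const (range 0 (suc s)) _) (cong₂ _*_ (length-range 0 (suc s)) (trans (∑-const (range 1 s) _) (cong (_* (P * (2 * (n * r)))) (length-range 1 s)))) ⟩
      r * (s * (P * (2 * (n * r)))) ∎

  alarms-rare : 8 * ∑ Ω alarms ≤ P
  alarms-rare = *-cancelʳ-≤ _ _ (2 * s) {{m*n≢0 2 s {{_}} {{>-nonZero 1≤s}}}} (begin
    8 * ∑ Ω alarms * (2 * s)  ≡⟨ e₁ (∑ Ω alarms) s ⟩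
    ∑ Ω alarms * (16 * s)  ≡⟨ cong (_* (16 * s)) (∑-swap Ω (range 1 s) _) ⟩
    ∑ (range 1 s) (λ k → ∑ Ω (λ x → ind (low? k x) + ind (high? k x))) * (16 * s)
                                            ≡⟨ sym (∑-*ʳ (range 1 s) (16 * s) _) ⟩
    ∑ (range 1 s) (λ k → ∑ Ω (λ x → ind (low? k x) + ind (high? k x)) * (16 * s))
                                            ≤⟨ ∑-mono (range 1 s) (λ {k} _ → one k) ⟩
    ∑ (range 1 s) (λ _ → P + P)  ≡⟨ trans (∑-const (range 1 s) (P + P)) (cong (_* (P + P)) (length-range 1 s)) ⟩
    s * (P + P)  ≡⟨ e₂ s P ⟩
    P * (2 * s)  ∎)
    where
    open ≤-Reasoning
    e₁ : ∀ a s → 8 * a * (2 * s) ≡ a * (16 * s)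
    e₁ = solve-∀
    e₂ : ∀ s P → s * (P + P) ≡ P * (2 * s)
    e₂ = solve-∀
    1≤A : 1 ≤ ∣ A ∣
    1≤A = ≤-trans (*-mono-≤ {1} {r} (s≤s z≤n) 1≤q′) (≤-reflexive (sym ∣A∣≡))
    dev : 16 * s * (L * L) ≤ ∣ A ∣ * (δ * δ)
    dev = ≤-trans num-dev (≤-reflexive (cong (_* (δ * δ)) (sym ∣A∣≡)))
    far : ∀ θ (θ≤L : θ ≤ L) → ∑ Ω (λ x → ind (Deviation.far? L θ θ≤L A d x)) * (16 * s) ≤ P
    far θ θ≤L = deviation-numeric (∑ Ω (λ x → ind (Deviation.far? L θ θ≤L A d x))) P ∣ A ∣ δ θ L s 1≤A 1≤L θ≤L (Deviation.chebyshev L θ θ≤L A d) dev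
    one : ∀ k → ∑ Ω (λ x → ind (low? k x) + ind (high? k x)) * (16 * s) ≤ P + P
    one k = ≤-trans (≤-reflexive (trans (cong (_* (16 * s)) (∑-+ Ω (λ x → ind (low? k x)) (λ x → ind (high? k x)))) (*-distribʳ-+ (16 * s) (∑ Ω (λ x → ind (low? k x))) (∑ Ω (λ x → ind (high? k x))))))
                    (+-mono-≤ (far (θ₁ k) (m⊓n≤n _ L)) (far (θ₂ k) (m⊓n≤n _ L)))

  good-weights : ∃ λ x → x ∈ₗ Ω × shorts x ≡ 0 × longs x ≡ 0 × alarms x ≡ 0 × 2 * aligned x ≤ M
  good-weights = pick (∑-<⇒∃ Ω {F} {λ _ → suc M} average)
    where
    open ≤-Reasoning
    F : Vec ℕ N → ℕ
    -- The factor `suc M` forces the three counts to vanish as soon as `F x < suc M`, and then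
    -- `2 * aligned x ≤ M`. Relative to `suc M` the averages are at most 1/8, 1/4, 1/8 and 1/8.
    F x = suc M * (shorts x + longs x + alarms x) + 2 * aligned x
    ∑F : ∑ Ω F ≡ suc M * (∑ Ω shorts + ∑ Ω longs + ∑ Ω alarms) + 2 * ∑ Ω aligned
    ∑F = trans (∑-+ Ω _ _) (cong₂ _+_ (trans (∑-*ˡ Ω (suc M) _) (cong (suc M *_) (trans (∑-+ Ω _ alarms) (cong (_+ ∑ Ω alarms) (∑-+ Ω shorts longs))))) (∑-*ˡ Ω 2 aligned))
    average : ∑ Ω F < ∑ Ω (λ _ → suc M)
    average = *-cancelˡ-< 8 _ _ (begin-strict
      8 * ∑ Ω F  ≡⟨ cong (8 *_) ∑F ⟩
      8 * (suc M * (S + C + V) + 2 * Z)  ≡⟨ e₁ (suc M) S C V Z ⟩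
      suc M * (8 * S + 2 * (4 * C) + 8 * V) + 16 * Z ≤⟨ +-mono-≤ (*-monoʳ-≤ (suc M) (+-mono-≤ (+-mono-≤ shorts-rare (*-monoʳ-≤ 2 longs-rare)) alarms-rare)) aligned-few ⟩
      suc M * (P + 2 * P + P) + suc M * P  ≡⟨ e₂ (suc M) P ⟩
      5 * (P * suc M)  <⟨ *-monoˡ-< (P * suc M) {{m*n≢0 P (suc M) {{>-nonZero 1≤P}}}} {5} {8} (s≤s (s≤s (s≤s (s≤s (s≤s (s≤s z≤n)))))) ⟩
      8 * (P * suc M)  ≡⟨ cong (8 *_) (sym (∑-words-const L N (suc M))) ⟩
      8 * ∑ Ω (λ _ → suc M)  ∎)
      where
      S = ∑ Ω shorts
      C = ∑ Ω longs
      V = ∑ Ω alarms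
      Z = ∑ Ω aligned
      e₁ : ∀ m S C V Z → 8 * (m * (S + C + V) + 2 * Z) ≡ m * (8 * S + 2 * (4 * C) + 8 * V) + 16 * Z
      e₁ = solve-∀
      e₂ : ∀ m P → m * (P + 2 * P + P) + m * P ≡ 5 * (P * m)
      e₂ = solve-∀
    pick : (∃ λ x → x ∈ₗ Ω × F x < suc M) → ∃ λ x → x ∈ₗ Ω × shorts x ≡ 0 × longs x ≡ 0 × alarms x ≡ 0 × 2 * aligned x ≤ M
    pick (x , x∈ , lt) = x , x∈ , m+n≡0⇒m≡0 (shorts x) sl , m+n≡0⇒n≡0 (shorts x) sl , m+n≡0⇒n≡0 (shorts x + longs x) all0
                       , s≤s⁻¹ (≤-<-trans (m≤n+m (2 * aligned x) (suc M * (shorts x + longs x + alarms x))) lt)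
      where
      all0 : shorts x + longs x + alarms x ≡ 0
      all0 = n≤0⇒n≡0 (≮⇒≥ (λ pos → <⇒≱ lt (≤-trans (m≤m*n (suc M) (shorts x + longs x + alarms x) {{>-nonZero pos}}) (m≤m+n _ (2 * aligned x)))))
      sl : shorts x + longs x ≡ 0
      sl = m+n≡0⇒m≡0 (shorts x + longs x) all0

  vanishes : ∀ {B : Set} {Q : B → Set} (bs : List B) (Q? : ∀ y → Dec (Q y)) →
             ∑ bs (λ y → ind (Q? y)) ≡ 0 → ∀ {y} → y ∈ₗ bs → ¬ Q y
  vanishes bs Q? ∑≡0 {y} y∈ Qy = <⇒≱ (≤-reflexive (sym (ind-yes (Q? y) Qy))) (≤-trans (∑-∈ (λ y → ind (Q? y)) y∈) (≤-reflexive ∑≡0))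

  module GoodWeights (x : Vec ℕ N) (x∈ : x ∈ₗ Ω) (no-shorts : shorts x ≡ 0) (no-longs : longs x ≡ 0)
               (no-alarms : alarms x ≡ 0) (few : 2 * aligned x ≤ M) where

    open Weighted x lam using (First; Last)

    instance q′≢0 : NonZero q′
             q′≢0 = >-nonZero 1≤q′

    module Rk = Ranking x A s q′ ∣A∣≡
    open Rk using (ν; rank)

    X : Fin N → ℕ
    X = lookup x

    X<L : ∀ v → X v < L
    X<L = words-< L N x∈

    L*kq′ : ∀ k → L * (k * q′) ≡ ∣ A ∣ * (k * K)
    L*kq′ k = trans (eq r K k q′) (cong (_* (k * K)) (sym ∣A∣≡))
      where eq : ∀ r K k q → r * K * (k * q) ≡ r * q * (k * K)
            eq = solve-∀

    quiet : ∀ k → 1 ≤ k → k ≤ s → ind (low? k x) + ind (high? k x) ≡ 0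
    quiet k 1≤k k≤s = n≤0⇒n≡0 (≤-trans (∑-∈ (λ k → ind (low? k x) + ind (high? k x)) (∈-range⁺ 1 s 1≤k (s≤s k≤s))) (≤-reflexive no-alarms))

    not-low : ∀ k → 1 ≤ k → k ≤ s → ¬ Deviation.Far L (θ₁ k) (m⊓n≤n _ L) A d x
    not-low k 1≤k k≤s far = 0≢1+n (trans (sym (m+n≡0⇒m≡0 (ind (low? k x)) (quiet k 1≤k k≤s))) (ind-yes (low? k x) far))

    not-high : ∀ k → 1 ≤ k → k ≤ s → ¬ Deviation.Far L (θ₂ k) (m⊓n≤n _ L) A d x
    not-high k 1≤k k≤s far = 0≢1+n (trans (sym (m+n≡0⇒n≡0 (ind (low? k x)) (quiet k 1≤k k≤s))) (ind-yes (high? k x) far))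

    sK≤L : ∀ {k} → k ≤ s → k * K ≤ L
    sK≤L k≤s = *-monoˡ-≤ K (m≤n⇒m≤1+n k≤s)

    ν-lower : ∀ v k → k ≤ ν v → k * K ≤ X v + δ
    ν-lower v zero    _  = z≤n
    ν-lower v k@(suc _) k≤ν = ≮⇒≥ contra
      where
      open ≤-Reasoning
      k≤s : k ≤ s
      k≤s = ≤-trans k≤ν (Rk.ν≤s v)
      contra : ¬ (X v + δ < k * K)
      contra lt = not-low k (s≤s z≤n) k≤s (inj₁ (begin
        ∣ A ∣ * θ₁ k + ∣ A ∣ * δ  ≡⟨ sym (*-distribˡ-+ ∣ A ∣ (θ₁ k) δ) ⟩
        ∣ A ∣ * (θ₁ k + δ)  ≡⟨ cong (∣ A ∣ *_) (trans (cong (_+ δ) θ≡) (m∸n+n≡m δ≤)) ⟩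
        ∣ A ∣ * (k * K)  ≡⟨ sym (L*kq′ k) ⟩
        L * (k * q′)  ≤⟨ *-monoʳ-≤ L (≤-trans (Rk.ν≥⇒rank v k k≤ν) (Rk.rank≤below L (θ₁ k) (m⊓n≤n _ L) v Xθ)) ⟩
        L * Deviation.below L (θ₁ k) (m⊓n≤n _ L) A x ∎))
        where
        δ≤ : δ ≤ k * K
        δ≤ = ≤-trans (m≤n+m δ (X v)) (<⇒≤ lt)
        θ≡ : θ₁ k ≡ k * K ∸ δ
        θ≡ = m≤n⇒m⊓n≡m (≤-trans (m∸n≤m (k * K) δ) (sK≤L k≤s))
        Xθ : X v < θ₁ k
        Xθ = ≤-trans (m+n≤o⇒m≤o∸n (suc (X v)) lt) (≤-reflexive (sym θ≡))

    ν-upper : ∀ v k → ν v < k → X v ≤ k * K + δ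
    ν-upper v k ν<k = by (k ≤? s)
      where
      open ≤-Reasoning
      by : Dec (k ≤ s) → X v ≤ k * K + δ
      by (no k≰s)  = ≤-trans (<⇒≤ (X<L v)) (≤-trans (*-monoˡ-≤ K (≰⇒> k≰s)) (m≤m+n _ δ))
      by (yes k≤s) = ≮⇒≥ (λ lt → not-high k (≤-trans (s≤s z≤n) ν<k) k≤s (inj₂ (begin
        L * Deviation.below L (θ₂ k) (m⊓n≤n _ L) A x + ∣ A ∣ * δ
          ≤⟨ +-monoˡ-≤ (∣ A ∣ * δ) (*-monoʳ-≤ L (≤-trans (Rk.below≤rank L (θ₂ k) (m⊓n≤n _ L) v (≤-trans (m⊓n≤m _ L) lt)) (<⇒≤ (Rk.ν<⇒rank v k k≤s ν<k)))) ⟩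
        L * (k * q′) + ∣ A ∣ * δ  ≡⟨ cong (_+ ∣ A ∣ * δ) (L*kq′ k) ⟩
        ∣ A ∣ * (k * K) + ∣ A ∣ * δ  ≡⟨ sym (*-distribˡ-+ ∣ A ∣ (k * K) δ) ⟩
        ∣ A ∣ * (k * K + δ)  ≤⟨ *-monoʳ-≤ ∣ A ∣ (n≤1+n (k * K + δ)) ⟩
        ∣ A ∣ * suc (k * K + δ)  ≡⟨ cong (∣ A ∣ *_) (sym (m≤n⇒m⊓n≡m (≤-trans lt (<⇒≤ (X<L v))))) ⟩
        ∣ A ∣ * θ₂ k  ∎)))

    wide′ : ∀ i → i ≤ s → i * K + δ + δ < suc i * lam
    wide′ i i≤s = +-cancelʳ-< (suc i * w) (i * K + δ + δ) (suc i * lam) (begin-strict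
      i * K + δ + δ + suc i * w  ≡⟨ e (i * K) δ (suc i * w) ⟩
      i * K + (suc i * w + (δ + δ))  ≤⟨ +-monoʳ-≤ (i * K) (+-monoˡ-≤ (δ + δ) (*-monoˡ-≤ w (s≤s i≤s))) ⟩
      i * K + (r * w + (δ + δ))  <⟨ +-monoʳ-< (i * K) wide ⟩
      i * K + K  ≡⟨ +-comm (i * K) K ⟩
      suc i * K  ≡⟨ trans (cong (suc i *_) K≡) (*-distribˡ-+ (suc i) lam w) ⟩
      suc i * lam + suc i * w  ∎)
      where
      open ≤-Reasoning
      e : ∀ a d b → a + d + d + b ≡ a + (b + (d + d))
      e = solve-∀

    first-exists : ∀ {e} → e ∈ₗ es′ → ∃ (First e)
    first-exists {e} e∈ = extremum _≤_ ≤-total ≤-trans e (keyOf x) (∣p∣>0⇒nonempty e (proj₂ (trimmed-size e∈)))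

    last-exists : ∀ {e} → e ∈ₗ es′ → ∃ (Last e)
    last-exists {e} e∈ = extremum _≥_ (λ a b → ≤-total b a) (λ p q → ≤-trans q p) e (keyOf x) (∣p∣>0⇒nonempty e (proj₂ (trimmed-size e∈)))

    long : ∀ {e} → e ∈ₗ es′ → ∀ {u v} → First e u → Last e v → X u + lam ≤ X v
    long {e} e∈ {u} {v} f l = ≮⇒≥ (λ lt → vanishes es′ (SE.short? x) no-shorts e∈ (u , v , f , l , lt))

    no-chain : ∀ t → All (_∈ₗ es′) t → length t ≡ suc s → ∀ u v → ¬ Weighted.Chain x lam u v t
    no-chain t all len u v c = vanishes (tuples es′ (suc s)) (Weighted.chainIn? x lam 0 (pred L)) no-longs
      (subst (λ m → t ∈ₗ tuples es′ m) len (∈-tuples all)) (u , v , c , z≤n , suc[m]≤n⇒m≤pred[n] (X<L v))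

    module RC = Recolour (keyOf x) X lam es′ s K δ ν Rk.ν≤s lam≤K ν-lower ν-upper
      (λ v → ≤-trans (<⇒≤ (X<L v)) (m≤m+n L δ)) wide′ first-exists last-exists long no-chain

    changed≤M : ∑ (fins N) (λ v → ind (RC.changed? v)) ≤ M
    changed≤M = ≤-trans (RC.changed-count (keyOf-injective x)) few

    c : Fin N → Fin r
    c v = fromℕ< (s≤s (RC.colour≤s v))

    toℕ-c : ∀ v → toℕ (c v) ≡ RC.colour v
    toℕ-c v = toℕ-fromℕ< (s≤s (RC.colour≤s v))

    -- A class consists of vertices of its own block, at most `q′`, and of changed vertices, at most
    -- `M`. The `M` places per colour reserved by the reservoir are exactly what the changes may use
    -- up.
    class≤q : ∀ k → ∑ (fins N) (λ v → ind ((v ∈? A) ×-dec (c v ≟F k))) ≤ q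
    class≤q k = begin
      ∑ (fins N) (λ v → ind ((v ∈? A) ×-dec (c v ≟F k)))
        ≤⟨ ∑-mono (fins N) (λ {v} _ → ind-bound ((v ∈? A) ×-dec (c v ≟F k)) (λ (v∈ , eq) → charge v v∈ eq (RC.changed? v))) ⟩
      ∑ (fins N) (λ v → ind ((v ∈? A) ×-dec (ν v ≟ toℕ k)) + ind (RC.changed? v))
        ≡⟨ ∑-+ (fins N) (λ v → ind ((v ∈? A) ×-dec (ν v ≟ toℕ k))) (λ v → ind (RC.changed? v)) ⟩
      ∑ (fins N) (λ v → ind ((v ∈? A) ×-dec (ν v ≟ toℕ k))) + ∑ (fins N) (λ v → ind (RC.changed? v))
        ≤⟨ +-mono-≤ (Rk.class-size (toℕ k)) changed≤M ⟩
      q′ + M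
        ≡⟨ m∸n+n≡m (<⇒≤ M<q) ⟩
      q ∎
      where
      open ≤-Reasoning
      charge : ∀ v → v ∈ A → c v ≡ k → (ch : Dec (RC.Changed v)) → 1 ≤ ind ((v ∈? A) ×-dec (ν v ≟ toℕ k)) + ind ch
      charge v v∈ eq (yes _)  = m≤n+m 1 _
      charge v v∈ eq (no ¬ch) = ≤-trans (≤-reflexive (sym (ind-yes ((v ∈? A) ×-dec (ν v ≟ toℕ k)) (v∈ , νv)))) (m≤m+n _ 0)
        where
        νv : ν v ≡ toℕ k
        νv = trans (sym (decidable-stable (RC.colour v ≟ ν v) ¬ch)) (trans (sym (toℕ-c v)) (cong toℕ eq))

    equitable : EquitableFor r q es
    equitable = by (fill N A c (λ _ → q) class≤q (trans (∑-fins-const r q) (sym N≡)))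
      where
      by : (∃ λ (f : Fin N → Fin r) → (∀ v → v ∈ A → f v ≡ c v) × (∀ k → ∑ (fins N) (λ v → ind (f v ≟F k)) ≡ q)) → EquitableFor r q es
      by (f , agree , counts) = f , proper , counts
        where
        proper : ∀ {e} → e ∈ₗ es → ∀ i → ¬ (∀ v → v ∈ e → f v ≡ i)
        proper {e} e∈ i mono = RC.proper (∈-map⁺ (_─ R) e∈) (toℕ i) (λ v v∈ →
          trans (sym (toℕ-c v)) (cong toℕ (trans (sym (agree v (x∉p⇒x∈∁p (x∈p─q⇒x∉q e R v∈)))) (mono v (p─q⊆p e R v∈)))))

  equitable : EquitableFor r q es
  equitable = let (x , x∈ , a , b , c , d) = good-weights in GoodWeights.equitable x x∈ a b c d

-- Choice of the parameters and the inequalities between them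

bernoulli-step : ∀ a w m → a ^ suc m + suc m * (w * a ^ m) ≤ (a + w) ^ suc m
bernoulli-step a w zero    = ≤-reflexive (eq a w)
  where eq : ∀ a w → a * 1 + 1 * (w * 1) ≡ (a + w) * 1
        eq = solve-∀
bernoulli-step a w (suc m) = begin
  a * (a * p) + suc (suc m) * (w * (a * p))  ≤⟨ m≤m+n _ (w * (suc m * (w * p))) ⟩
  a * (a * p) + suc (suc m) * (w * (a * p)) + w * (suc m * (w * p)) ≡⟨ eq a w m p ⟩
  (a + w) * (a * p + suc m * (w * p))  ≤⟨ *-monoʳ-≤ (a + w) (bernoulli-step a w m) ⟩
  (a + w) ^ suc (suc m)  ∎
  where open ≤-Reasoning
        p = a ^ m
        eq : ∀ a w m p → a * (a * p) + suc (suc m) * (w * (a * p)) + w * (suc m * (w * p)) ≡ (a + w) * (a * p + suc m * (w * p))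
        eq = solve-∀

doubling : ∀ a w j → a + w ≤ w * suc j → 2 * a ^ suc j ≤ (a + w) ^ suc j
doubling a w j le = begin
  2 * a ^ suc j  ≡⟨ cong (a ^ suc j +_) (+-identityʳ _) ⟩
  a ^ suc j + a * a ^ j  ≤⟨ +-monoʳ-≤ (a ^ suc j) (*-monoˡ-≤ (a ^ j) (≤-trans (m≤m+n a w) le)) ⟩
  a ^ suc j + w * suc j * a ^ j  ≡⟨ cong (a ^ suc j +_) (eq w (suc j) (a ^ j)) ⟩
  a ^ suc j + suc j * (w * a ^ j)  ≤⟨ bernoulli-step a w j ⟩
  (a + w) ^ suc j  ∎
  where open ≤-Reasoning
        eq : ∀ w j p → w * j * p ≡ j * (w * p)
        eq = solve-∀

doubling-iterated : ∀ a w j c e → a + w ≤ w * suc j → c * suc j ≤ e → 2 ^ c * a ^ e ≤ (a + w) ^ e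
doubling-iterated a w j c e le ce with m≤n⇒∃[o]m+o≡n ce
... | d , refl = begin
  2 ^ c * a ^ (c * j₁ + d)  ≡⟨ cong (2 ^ c *_) (^-distribˡ-+-* a (c * j₁) d) ⟩
  2 ^ c * (a ^ (c * j₁) * a ^ d)  ≡⟨ sym (*-assoc (2 ^ c) _ _) ⟩
  2 ^ c * a ^ (c * j₁) * a ^ d  ≡⟨ cong (λ z → 2 ^ c * z * a ^ d) (trans (cong (a ^_) (*-comm c j₁)) (sym (^-*-assoc a j₁ c))) ⟩
  2 ^ c * (a ^ j₁) ^ c * a ^ d  ≡⟨ cong (_* a ^ d) (sym (^-*-distrib 2 (a ^ j₁) c)) ⟩
  (2 * a ^ j₁) ^ c * a ^ d  ≤⟨ *-mono-≤ (^-monoˡ-≤ c (doubling a w j le)) (^-monoˡ-≤ d (m≤m+n a w)) ⟩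
  ((a + w) ^ j₁) ^ c * (a + w) ^ d  ≡⟨ cong (_* (a + w) ^ d) (trans (^-*-assoc (a + w) j₁ c) (cong ((a + w) ^_) (*-comm j₁ c))) ⟩
  (a + w) ^ (c * j₁) * (a + w) ^ d  ≡⟨ sym (^-distribˡ-+-* (a + w) (c * j₁) d) ⟩
  (a + w) ^ (c * j₁ + d)  ∎
  where open ≤-Reasoning
        j₁ = suc j

module Numbers
  (r s n n′ l g M q : ℕ) (r≡ : r ≡ suc s) (n≡ : n ≡ suc (suc n′)) (1≤s : 1 ≤ s) (1≤l : 1 ≤ l) (1≤g : 1 ≤ g) (1≤M : 1 ≤ M)
  (gr≤l : g * r ≤ l) (c₂ : 32 * (r * (r * r)) * (256 * (r * l)) ≤ 2 ^ g) (c₃ : 256 * (r * l) ≤ n)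
  (g² : 64 * (64 * 64) * (r * r * l) ≤ g * g)
  (M≤ : M * (256 * (r * l)) ≤ n) (n<M : n < suc M * (256 * (r * l)))
  (big : n * n * s ≤ 16 * l * (r * q)) where

  open ≤-Reasoning

  -- The lattice is fine enough, `K` being a multiple of `r * n`, for rounding to cost only bounded
  -- factors in the `n′`-th powers. `w` is `K` times 5 l / n. `δ` is, up to a constant, as large as
  -- the factor `2 ^ g` permits, and `h` is about n / g: in `num-σ` each run of `h` factors at most
  -- doubles, and `g` runs cover all `n′`.
  K w lam δ h : ℕ
  K = 16 * (r * n)
  w = 80 * (r * l)
  lam = K ∸ w
  δ = g * r
  instance g≢0 : NonZero g
           g≢0 = >-nonZero 1≤g
  h = suc (n / g)

  1≤r : 1 ≤ r
  1≤r = ≤-trans (s≤s z≤n) (≤-reflexive (sym r≡))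
  1≤n : 1 ≤ n
  1≤n = ≤-trans (s≤s z≤n) (≤-reflexive (sym n≡))
  r*l≥ : 1 ≤ r * l
  r*l≥ = *-mono-≤ 1≤r 1≤l
  s≤r : s ≤ r
  s≤r = ≤-trans (n≤1+n s) (≤-reflexive (sym r≡))

  scaled : ∀ c → c ≤ 256 → c * (r * l) ≤ n
  scaled c c≤ = ≤-trans (*-monoˡ-≤ (r * l) c≤) c₃

  l≤rl : l ≤ r * l
  l≤rl = ≤-trans (≤-reflexive (sym (*-identityˡ l))) (*-monoˡ-≤ l 1≤r)

  2w≤K : w + w ≤ K
  2w≤K = begin
    w + w  ≡⟨ e r l ⟩
    16 * (10 * (r * l))  ≤⟨ *-monoʳ-≤ 16 (≤-trans (scaled 10 (≤ᵇ⇒≤ 10 256 _)) (≤-trans (≤-reflexive (sym (*-identityˡ n))) (*-monoˡ-≤ n 1≤r))) ⟩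
    16 * (r * n)  ∎
    where e : ∀ r l → 80 * (r * l) + 80 * (r * l) ≡ 16 * (10 * (r * l))
          e = solve-∀
  K≡ : K ≡ lam + w
  K≡ = sym (m∸n+n≡m (≤-trans (m≤m+n w w) 2w≤K))
  w≤lam : w ≤ lam
  w≤lam = m+n≤o⇒m≤o∸n w 2w≤K
  1≤w : 1 ≤ w
  1≤w = ≤-trans r*l≥ (m≤n*m (r * l) 80)
  1≤lam : 1 ≤ lam
  1≤lam = ≤-trans 1≤w w≤lam

  core : r * w + (δ + δ) + r ≤ 83 * (r * (r * l))
  core = begin
    r * w + (δ + δ) + r  ≤⟨ +-mono-≤ (+-monoʳ-≤ (r * w) (+-mono-≤ δ≤ δ≤)) r≤ ⟩
    r * w + (r * (r * l) + r * (r * l)) + r * (r * l)  ≡⟨ e r l ⟩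
    83 * (r * (r * l))  ∎
    where
    e : ∀ r l → r * (80 * (r * l)) + (r * (r * l) + r * (r * l)) + r * (r * l) ≡ 83 * (r * (r * l))
    e = solve-∀
    δ≤ : δ ≤ r * (r * l)
    δ≤ = ≤-trans gr≤l (≤-trans l≤rl (≤-trans (≤-reflexive (sym (*-identityˡ (r * l)))) (*-monoˡ-≤ (r * l) 1≤r)))
    r≤ : r ≤ r * (r * l)
    r≤ = ≤-trans (≤-reflexive (sym (*-identityʳ r))) (*-monoʳ-≤ r r*l≥)

  core′ : 83 * (r * (r * l)) ≤ K
  core′ = begin
    83 * (r * (r * l))  ≤⟨ *-monoˡ-≤ (r * (r * l)) (≤ᵇ⇒≤ 83 96 _) ⟩
    96 * (r * (r * l))  ≡⟨ e r l ⟩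
    16 * (r * (6 * (r * l)))  ≤⟨ *-monoʳ-≤ 16 (*-monoʳ-≤ r (scaled 6 (≤ᵇ⇒≤ 6 256 _))) ⟩
    16 * (r * n)  ∎
    where e : ∀ r l → 96 * (r * (r * l)) ≡ 16 * (r * (6 * (r * l)))
          e = solve-∀

  wide : r * w + (δ + δ) < K
  wide = ≤-trans (≤-trans (≤-reflexive (+-comm 1 _)) (+-monoʳ-≤ (r * w + (δ + δ)) 1≤r)) (≤-trans core core′)

  num-links : (r * w + (δ + δ) + r) * n ≤ 6 * l * (r * K)
  num-links = begin
    (r * w + (δ + δ) + r) * n  ≤⟨ *-monoˡ-≤ n core ⟩
    83 * (r * (r * l)) * n  ≤⟨ *-monoˡ-≤ n (*-monoˡ-≤ (r * (r * l)) (≤ᵇ⇒≤ 83 96 _)) ⟩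
    96 * (r * (r * l)) * n  ≡⟨ e r l n ⟩
    6 * l * (r * (16 * (r * n)))  ∎
    where e : ∀ r l n → 96 * (r * (r * l)) * n ≡ 6 * l * (r * (16 * (r * n)))
          e = solve-∀

  n′≤n : n′ ≤ n
  n′≤n = ≤-trans (n≤1+n n′) (≤-trans (n≤1+n (suc n′)) (≤-reflexive (sym n≡)))

  num-K : 2 * (1 * (r * n′)) ≤ K
  num-K = begin
    2 * (1 * (r * n′))  ≡⟨ cong (2 *_) (*-identityˡ (r * n′)) ⟩
    2 * (r * n′)  ≤⟨ *-mono-≤ (≤ᵇ⇒≤ 2 16 _) (*-monoʳ-≤ r n′≤n) ⟩
    16 * (r * n)  ∎

  g≤n : g ≤ n
  g≤n = ≤-trans (≤-trans (≤-trans (≤-reflexive (sym (*-identityʳ g))) (*-monoʳ-≤ g 1≤r)) (≤-trans gr≤l l≤rl)) (≤-trans (≤-reflexive (sym (*-identityˡ (r * l)))) (scaled 1 (≤ᵇ⇒≤ 1 256 _)))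

  num-h : n′ ≤ h * g
  num-h = ≤-trans n′≤n (<⇒≤ (<[1+m/n]*n n g))

  num-σ : 2 * ((δ + δ + r) * h) ≤ K
  num-σ = begin
    2 * ((δ + δ + r) * h)  ≤⟨ *-monoʳ-≤ 2 (*-monoˡ-≤ h (+-monoʳ-≤ (δ + δ) (≤-trans (≤-reflexive (sym (*-identityˡ r))) (*-monoˡ-≤ r 1≤g)))) ⟩
    2 * ((δ + δ + δ) * h)  ≡⟨ e₁ g r h ⟩
    6 * (r * (g * h))  ≤⟨ *-monoʳ-≤ 6 (*-monoʳ-≤ r gh≤) ⟩
    6 * (r * (2 * n))  ≡⟨ e₂ r n ⟩
    12 * (r * n)  ≤⟨ *-monoˡ-≤ (r * n) (≤ᵇ⇒≤ 12 16 _) ⟩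
    16 * (r * n)  ∎
    where
    e₁ : ∀ g r h → 2 * ((g * r + g * r + g * r) * h) ≡ 6 * (r * (g * h))
    e₁ = solve-∀
    e₂ : ∀ r n → 6 * (r * (2 * n)) ≡ 12 * (r * n)
    e₂ = solve-∀
    gh≤ : g * h ≤ 2 * n
    gh≤ = begin
      g * suc (n / g)  ≡⟨ *-suc g (n / g) ⟩
      g + g * (n / g)  ≤⟨ +-mono-≤ g≤n (≤-trans (≤-reflexive (*-comm g (n / g))) (m/n*n≤m n g)) ⟩
      n + n  ≡⟨ cong (n +_) (sym (+-identityʳ n)) ⟩
      2 * n  ∎

  num-short : 2 ^ (4 * l) * lam ^ n′ ≤ K ^ n′
  num-short = subst (λ z → 2 ^ (4 * l) * lam ^ n′ ≤ z ^ n′) (sym K≡) (doubling-iterated lam w j (4 * l) n′ enough steps)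
    where
    instance 5l≢0 : NonZero (5 * l)
             5l≢0 = >-nonZero (≤-trans 1≤l (m≤n*m l 5))
    -- Runs of `suc j`, about n / (5 l), factors double the power, and `4 * l` runs fit into `n′`.
    -- The difference between 5 and 4 absorbs the rounding and the two vertices by which `n′` falls
    -- short of `n`.
    j = n / (5 * l)
    enough : lam + w ≤ w * suc j
    enough = begin
      lam + w  ≡⟨ sym K≡ ⟩
      16 * (r * n)  ≤⟨ *-monoʳ-≤ 16 (*-monoʳ-≤ r (<⇒≤ (<[1+m/n]*n n (5 * l)))) ⟩
      16 * (r * (suc j * (5 * l)))  ≡⟨ e r (suc j) l ⟩
      80 * (r * l) * suc j  ∎
      where e : ∀ r j l → 16 * (r * (j * (5 * l))) ≡ 80 * (r * l) * j
            e = solve-∀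
    steps : 4 * l * suc j ≤ n′
    steps = *-cancelˡ-≤ 5 (+-cancelʳ-≤ 10 _ _ (begin
      5 * (4 * l * suc j) + 10  ≡⟨ e₁ l j ⟩
      4 * (j * (5 * l)) + (20 * l + 10 * 1) ≤⟨ +-mono-≤ (*-monoʳ-≤ 4 (m/n*n≤m n (5 * l))) (+-monoʳ-≤ (20 * l) (*-monoʳ-≤ 10 1≤l)) ⟩
      4 * n + (20 * l + 10 * l)  ≡⟨ cong (4 * n +_) (e₂ l) ⟩
      4 * n + 30 * l  ≤⟨ +-monoʳ-≤ (4 * n) (≤-trans (*-monoʳ-≤ 30 l≤rl) (scaled 30 (≤ᵇ⇒≤ 30 256 _))) ⟩
      4 * n + n  ≡⟨ cong (λ z → 4 * z + z) n≡ ⟩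
      4 * suc (suc n′) + suc (suc n′)  ≡⟨ e₃ n′ ⟩
      5 * n′ + 10  ∎))
      where
      e₁ : ∀ l j → 5 * (4 * l * suc j) + 10 ≡ 4 * (j * (5 * l)) + (20 * l + 10 * 1)
      e₁ = solve-∀
      e₂ : ∀ l → 20 * l + 10 * l ≡ 30 * l
      e₂ = solve-∀
      e₃ : ∀ m → 4 * suc (suc m) + suc (suc m) ≡ 5 * m + 10
      e₃ = solve-∀

  H≤2^g : 256 * (r * l) ≤ 2 ^ g
  H≤2^g = ≤-trans (m≤n*m (256 * (r * l)) (32 * (r * (r * r))) {{>-nonZero (≤-trans (*-mono-≤ 1≤r (*-mono-≤ 1≤r 1≤r)) (m≤n*m (r * (r * r)) 32))}}) c₂

  2^g≤D : 2 ^ g ≤ 2 ^ g * 2 ^ g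
  2^g≤D = m≤m*n (2 ^ g) (2 ^ g) {{m^n≢0 2 g}}

  num-D : 256 * r ≤ 2 ^ g * 2 ^ g
  num-D = ≤-trans (*-monoʳ-≤ 256 (≤-trans (≤-reflexive (sym (*-identityʳ r))) (*-monoʳ-≤ r 1≤l))) (≤-trans H≤2^g 2^g≤D)

  num-D′ : 12 * (l * r) ≤ 2 ^ g * 2 ^ g
  num-D′ = ≤-trans (≤-trans (≤-reflexive (cong (12 *_) (*-comm l r))) (*-monoˡ-≤ (r * l) (≤ᵇ⇒≤ 12 256 _))) (≤-trans H≤2^g 2^g≤D)

  num-M : 16 * (r * (s * (2 * (n * r)))) ≤ suc M * 2 ^ g
  num-M = begin
    16 * (r * (s * (2 * (n * r))))  ≤⟨ *-monoʳ-≤ 16 (*-monoʳ-≤ r (*-monoˡ-≤ (2 * (n * r)) s≤r)) ⟩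
    16 * (r * (r * (2 * (n * r))))  ≡⟨ e₁ r n ⟩
    32 * (r * (r * r)) * n  ≤⟨ *-monoʳ-≤ (32 * (r * (r * r))) (<⇒≤ n<M) ⟩
    32 * (r * (r * r)) * (suc M * (256 * (r * l)))  ≡⟨ e₂ (32 * (r * (r * r))) (suc M) (256 * (r * l)) ⟩
    suc M * (32 * (r * (r * r)) * (256 * (r * l)))  ≤⟨ *-monoʳ-≤ (suc M) c₂ ⟩
    suc M * 2 ^ g  ∎
    where
    e₁ : ∀ r n → 16 * (r * (r * (2 * (n * r)))) ≡ 32 * (r * (r * r)) * n
    e₁ = solve-∀
    e₂ : ∀ a b c → a * (b * c) ≡ b * (a * c)
    e₂ = solve-∀

  n²r≤ : n * n * r ≤ 32 * l * (r * q)
  n²r≤ = begin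
    n * n * r  ≤⟨ *-monoʳ-≤ (n * n) r≤2s ⟩
    n * n * (2 * s)  ≡⟨ e₁ (n * n) s ⟩
    2 * (n * n * s)  ≤⟨ *-monoʳ-≤ 2 big ⟩
    2 * (16 * l * (r * q))  ≡⟨ e₂ l (r * q) ⟩
    32 * l * (r * q)  ∎
    where
    r≤2s : r ≤ 2 * s
    r≤2s = ≤-trans (≤-reflexive r≡) (≤-trans (+-monoˡ-≤ s 1≤s) (≤-reflexive (cong (s +_) (sym (+-identityʳ s)))))
    e₁ : ∀ a s → a * (2 * s) ≡ 2 * (a * s)
    e₁ = solve-∀
    e₂ : ∀ l N → 2 * (16 * l * N) ≡ 32 * l * N
    e₂ = solve-∀

  B : ℕ
  B = 4 * (r * (r * (n * M)))

  1≤B : 1 ≤ B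
  1≤B = ≤-trans (*-mono-≤ 1≤r (*-mono-≤ 1≤r (*-mono-≤ 1≤n 1≤M))) (m≤n*m (r * (r * (n * M))) 4)

  reservoir-cost : 2 * (2 * r * n * (r * M)) ≤ B
  reservoir-cost = ≤-reflexive (e r n M)
    where e : ∀ r n M → 2 * (2 * r * n * (r * M)) ≡ 4 * (r * (r * (n * M)))
          e = solve-∀

  -- The left side is at most 5 r² n M, while by `n²r≤` there are at least n² r / (32 l) vertices.
  -- So M ≤ n / (160 r l) suffices, and `M` was taken as n / (256 r l) rounded down.
  reservoir-fits : r * M + B ≤ r * q
  reservoir-fits = *-cancelˡ-≤ (32 * l) {{m*n≢0 32 l {{_}} {{>-nonZero 1≤l}}}} (begin
    32 * l * (r * M + B)  ≤⟨ *-monoʳ-≤ (32 * l) (+-monoˡ-≤ B rM≤) ⟩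
    32 * l * (r * (r * (n * M)) + B)  ≡⟨ e₁ l r n M ⟩
    M * (160 * (r * l)) * (n * r)  ≤⟨ *-monoˡ-≤ (n * r) (*-monoʳ-≤ M (*-monoˡ-≤ (r * l) (≤ᵇ⇒≤ 160 256 _))) ⟩
    M * (256 * (r * l)) * (n * r)  ≤⟨ *-monoˡ-≤ (n * r) M≤ ⟩
    n * (n * r)  ≡⟨ sym (*-assoc n n r) ⟩
    n * n * r  ≤⟨ n²r≤ ⟩
    32 * l * (r * q)  ∎)
    where
    rM≤ : r * M ≤ r * (r * (n * M))
    rM≤ = *-monoʳ-≤ r (≤-trans (m≤n*m M (r * n) {{>-nonZero (*-mono-≤ 1≤r 1≤n)}}) (≤-reflexive (*-assoc r n M)))
    e₁ : ∀ l r n M → 32 * l * (r * (r * (n * M)) + 4 * (r * (r * (n * M)))) ≡ M * (160 * (r * l)) * (n * r)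
    e₁ = solve-∀

  M<q : M < q
  M<q = *-cancelˡ-< r M q (<-≤-trans (m<m+n (r * M) 1≤B) reservoir-fits)

  rM<n : r * M < n
  rM<n = begin-strict
    r * M  <⟨ m<m+n (r * M) (*-mono-≤ 1≤r 1≤M) ⟩
    r * M + r * M  ≡⟨ e r M ⟩
    M * (2 * r)  ≤⟨ *-monoʳ-≤ M (*-mono-≤ (≤ᵇ⇒≤ 2 256 _) (≤-trans (≤-reflexive (sym (*-identityʳ r))) (*-monoʳ-≤ r 1≤l))) ⟩
    M * (256 * (r * l))  ≤⟨ M≤ ⟩
    n  ∎
    where e : ∀ r M → r * M + r * M ≡ M * (2 * r)
          e = solve-∀

  rest-large : n * n * r ≤ 64 * l * (r * (q ∸ M))
  rest-large = +-cancelʳ-≤ (64 * l * (r * M)) _ _ (begin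
    n * n * r + 64 * l * (r * M)  ≤⟨ +-monoʳ-≤ (n * n * r) drop ⟩
    n * n * r + n * n * r  ≤⟨ +-mono-≤ n²r≤ n²r≤ ⟩
    32 * l * (r * q) + 32 * l * (r * q)  ≡⟨ e₁ l (r * q) ⟩
    64 * l * (r * q)  ≡⟨ cong (λ z → 64 * l * (r * z)) (sym (m∸n+n≡m (<⇒≤ M<q))) ⟩
    64 * l * (r * (q ∸ M + M))  ≡⟨ e₂ (64 * l) r (q ∸ M) M ⟩
    64 * l * (r * (q ∸ M)) + 64 * l * (r * M)  ∎)
    where
    e₁ : ∀ l N → 32 * l * N + 32 * l * N ≡ 64 * l * N
    e₁ = solve-∀
    e₂ : ∀ c r a b → c * (r * (a + b)) ≡ c * (r * a) + c * (r * b)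
    e₂ = solve-∀
    e₃ : ∀ l r M → 64 * l * (r * M) ≡ M * (64 * (r * l))
    e₃ = solve-∀
    drop : 64 * l * (r * M) ≤ n * n * r
    drop = begin
      64 * l * (r * M)  ≡⟨ e₃ l r M ⟩
      M * (64 * (r * l))  ≤⟨ *-monoʳ-≤ M (*-monoˡ-≤ (r * l) (≤ᵇ⇒≤ 64 256 _)) ⟩
      M * (256 * (r * l))  ≤⟨ M≤ ⟩
      n  ≤⟨ m≤m*n n (n * r) {{>-nonZero (*-mono-≤ 1≤n 1≤r)}} ⟩
      n * (n * r)  ≡⟨ sym (*-assoc n n r) ⟩
      n * n * r  ∎

  -- One factor 16 belongs to the union bound, two to the square of `K`, and 64 to `rest-large`;
  -- together they are the 2¹⁸ of `g²`. This is the inequality that demands log n to be of order r⁴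
  -- at least.
  num-dev : 16 * s * (r * K * (r * K)) ≤ r * (q ∸ M) * (δ * δ)
  num-dev = begin
    16 * s * (r * K * (r * K))  ≤⟨ *-monoˡ-≤ (r * K * (r * K)) (*-monoʳ-≤ 16 s≤r) ⟩
    16 * r * (r * K * (r * K))  ≡⟨ e₁ r n 16 ⟩
    16 * (16 * 16) * (r * (r * (r * r))) * (n * n * r)  ≤⟨ *-monoʳ-≤ (16 * (16 * 16) * (r * (r * (r * r)))) rest-large ⟩
    16 * (16 * 16) * (r * (r * (r * r))) * (64 * l * X)  ≡⟨ e₂ (16 * (16 * 16)) r 64 l X ⟩
    X * (r * r) * (64 * (16 * (16 * 16)) * (r * r * l))  ≤⟨ *-monoʳ-≤ (X * (r * r)) g² ⟩
    X * (r * r) * (g * g)  ≡⟨ e₃ X r g ⟩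
    X * (g * r * (g * r))  ∎
    where
    X = r * (q ∸ M)
    e₁ : ∀ r n c → c * r * (r * (c * (r * n)) * (r * (c * (r * n)))) ≡ c * (c * c) * (r * (r * (r * r))) * (n * n * r)
    e₁ = solve-∀
    e₂ : ∀ c r d l X → c * (r * (r * (r * r))) * (d * l * X) ≡ X * (r * r) * (d * c * (r * r * l))
    e₂ = solve-∀
    e₃ : ∀ X r g → X * (r * r) * (g * g) ≡ X * (g * r * (g * r))
    e₃ = solve-∀

-- The two cases and the conclusion

module Regime (s n′ l : ℕ) (1≤s : 1 ≤ s) (c₁ : 2²⁰ * suc s ^ 4 ≤ l)
              (lo : 4 ^ l ≤ suc (suc n′)) (hi : suc (suc n′) < 4 ^ suc l) where

  r n : ℕ
  r = suc s
  n = suc (suc n′)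

  open Scale r l c₁ public

  unfold : 2¹³ * (r * (r * (r * r))) * l ≡ 32 * (r * (r * r)) * (256 * (r * l))
  unfold = trans (cong (λ c → c * (r * (r * (r * r))) * l) 2¹³≡32*256) (eq 32 256 r l)
    where eq : ∀ a b r l → a * b * (r * (r * (r * r))) * l ≡ a * (r * (r * r)) * (b * (r * l))
          eq = solve-∀

  c₂′ : 32 * (r * (r * r)) * (256 * (r * l)) ≤ 2 ^ g
  c₂′ = ≤-trans (≤-reflexive (sym unfold)) c₂

  c₃ : 256 * (r * l) ≤ n
  c₃ = ≤-trans (m≤n*m (256 * (r * l)) (32 * (r * (r * r)))) (≤-trans (≤-reflexive (sym unfold)) (r⁴l≤n lo))

  g²′ : 64 * (64 * 64) * (r * r * l) ≤ g * g
  g²′ = subst (λ c → c * (r * r * l) ≤ g * g) 2¹⁸≡64*64*64 g²-large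

  25l≤n : 25 * l ≤ n
  25l≤n = ≤-trans (*-mono-≤ (≤ᵇ⇒≤ 25 256 _) (m≤n*m l r)) c₃

  2≤l : 2 ≤ l
  2≤l = ≤-trans (≤-trans (≤ᵇ⇒≤ 2 17 _) 17≤g) (≤-trans (m≤m*n g r) gr≤l)

  n²≤ : n * n ≤ 16 * 2 ^ (4 * l)
  n²≤ = ≤-trans (*-mono-≤ (<⇒≤ hi) (<⇒≤ hi)) (≤-reflexive (trans (eq (4 ^ l)) (cong (16 *_) (trans (sym (^-*-distrib 4 4 l)) (^-*-assoc 2 4 l)))))
    where
    eq : ∀ a → 4 * a * (4 * a) ≡ 16 * (a * a)
    eq = solve-∀

  large-case : ∀ {N} q (es : List (Subset N)) → N ≡ r * q → (∀ {e} → e ∈ₗ es → ∣ e ∣ ≡ n) →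
    (100 * length es) ^ r * l ^ s ≤ n ^ s * r ^ (r * suc n′) → n * n * s ≤ 16 * l * (r * q) → EquitableFor r q es
  large-case {N} q es N≡ sizes bound big = by (Reservoir.reservoir es n (2 * r) Nm.B (s≤s z≤n) Nm.1≤B (λ e∈ → ≤-reflexive (sizes e∈)) (r * M)
      (≤-trans Nm.reservoir-fits (≤-reflexive (sym N≡))) Nm.reservoir-cost)
    where
    instance H≢0 : NonZero (256 * (r * l))
             H≢0 = >-nonZero (*-mono-≤ (≤ᵇ⇒≤ 1 256 _) (*-mono-≤ {1} {r} (s≤s z≤n) 1≤l))
    M = n / (256 * (r * l))
    module Nm = Numbers r s n n′ l g M q refl refl 1≤s 1≤l 1≤g (m≥n⇒m/n>0 c₃) gr≤l c₂′ c₃ g²′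
                  (m/n*n≤m n (256 * (r * l))) (<[1+m/n]*n n (256 * (r * l))) big
    root : length es * (2 ^ g * 2 ^ g) ≤ n * (r * r ^ n′)
    root = ≤-trans (≤-reflexive (cong (length es *_) (sym D≡2^g*2^g)))
      (edges-root (length es) D n (r * r ^ n′) s l 1≤l (≤-trans bound (≤-reflexive (cong (n ^ s *_) (trans (cong (r ^_) (*-comm r (suc n′))) (sym (^-*-assoc r (suc n′) r)))))) (D-root lo))
    by : (∃ λ R → ∣ R ∣ ≡ r * M × ∑ es (λ e → (2 * r) ^ ∣ e ∩ R ∣) ≤ 2 * length es) → EquitableFor r q es
    by (R , ∣R∣≡ , Φ≤) = ManyVertices.equitable s q n′ l g Nm.h M Nm.K Nm.w Nm.lam Nm.δ (2 ^ (4 * l)) (length es) N≡ es sizes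
      1≤s Nm.K≡ Nm.1≤lam Nm.w≤lam Nm.wide Nm.M<q (m^n>0 2 (4 * l)) R ∣R∣≡ Nm.rM<n Φ≤ root bound
      Nm.num-short n²≤ Nm.num-D Nm.num-D′ Nm.num-K Nm.num-links Nm.num-σ Nm.num-h Nm.num-dev Nm.num-M

  equitable : ∀ {N} q (es : List (Subset N)) → N ≡ r * q → (∀ {e} → e ∈ₗ es → ∣ e ∣ ≡ n) →
    (100 * length es) ^ r * l ^ s ≤ n ^ s * r ^ (r * suc n′) → EquitableFor r q es
  equitable {N} q es N≡ sizes bound = by (16 * l * N ≤? n * n * s)
    where
    edges≤ : length es ≤ n * r ^ suc n′
    edges≤ = ≤-trans (m≤m*n (length es) D {{m^n≢0 4 g}})
      (edges-root (length es) D n (r * r ^ n′) s l 1≤l (≤-trans bound (≤-reflexive (cong (n ^ s *_) (trans (cong (r ^_) (*-comm r (suc n′))) (sym (^-*-assoc r (suc n′) r)))))) (D-root lo))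
    by : Dec (16 * l * N ≤ n * n * s) → EquitableFor r q es
    by (yes small) = small-case s q (suc n′) l es N≡ sizes 2≤l 25l≤n hi small edges≤
    by (no big) = large-case q es N≡ sizes bound (≤-trans (<⇒≤ (≰⇒> big)) (≤-reflexive (cong (16 * l *_) N≡)))

log₄ : ∀ n → 1 ≤ n → ∃ λ l → 4 ^ l ≤ n × n < 4 ^ suc l
log₄ n 1≤n = go n (≤-trans (suc≤2^ n) (^-monoˡ-≤ n (≤ᵇ⇒≤ 2 4 _)))
  where
  go : ∀ k → n < 4 ^ k → ∃ λ l → 4 ^ l ≤ n × n < 4 ^ suc l
  go zero    n< = ⊥-elim (<⇒≱ n< 1≤n)
  go (suc k) n< = by (4 ^ k ≤? n)
    where
    by : Dec (4 ^ k ≤ n) → ∃ λ l → 4 ^ l ≤ n × n < 4 ^ suc l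
    by (yes le) = k , le , n<
    by (no gt)  = go k (≰⇒> gt)

l₀ : ℕ
l₀ = 2²⁰ * (4 * 2²⁰) ^ 4

-- From r⁵ ≤ 4 l: if r ≥ 4 * 2²⁰, one factor r pays for the constant; otherwise `2²⁰ * r ^ 4` is at
-- most `l₀`, which is defined for this purpose.
scale-bound : ∀ r n l → l₀ ≤ l → 1 ≤ l → n < 4 ^ suc l → 2 ^ (r ^ 5) ≤ 2 * n → 2²⁰ * r ^ 4 ≤ l
scale-bound r n l l₀≤l 1≤l n< le = by (≤-total (4 * 2²⁰) r)
  where
  open ≤-Reasoning
  r⁵≤ : r ^ 5 ≤ 4 * l
  r⁵≤ = ≤-trans (s≤s⁻¹ (≰⇒> (λ ge → <⇒≱ (begin-strict
      2 ^ (r ^ 5)  ≤⟨ le ⟩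
      2 * n  <⟨ *-monoʳ-< 2 n< ⟩
      2 * 4 ^ suc l  ≡⟨ cong (2 *_) (^-*-assoc 2 2 (suc l)) ⟩
      2 ^ suc (2 * suc l)  ∎) (^-monoʳ-≤ 2 ge)))) (≤-trans (≤-reflexive (e l)) (≤-trans (+-monoʳ-≤ (2 * l) (*-monoʳ-≤ 2 1≤l)) (≤-reflexive (e′ l))))
    where
    e : ∀ l → 2 * suc l ≡ 2 * l + 2 * 1
    e = solve-∀
    e′ : ∀ l → 2 * l + 2 * l ≡ 4 * l
    e′ = solve-∀
  by : 4 * 2²⁰ ≤ r ⊎ r ≤ 4 * 2²⁰ → 2²⁰ * r ^ 4 ≤ l
  by (inj₁ large) = *-cancelˡ-≤ 4 (≤-trans (≤-reflexive (sym (*-assoc 4 2²⁰ (r ^ 4)))) (≤-trans (*-monoˡ-≤ (r ^ 4) large) r⁵≤))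
  by (inj₂ small) = ≤-trans (*-monoʳ-≤ 2²⁰ (^-monoˡ-≤ 4 small)) l₀≤l

theorem1 :
    ∃ λ (n₀ : ℕ) →
      ∀ (n : ℕ) → n₀ ≤ n →
      ∀ (r : ℕ) → 1 ≤ r →
      (Σ ℚ λ t → (ℕ→ℚ (r ^ 5) <ℚ t) × (t ≤ln n)) →
      ∀ (N : ℕ) (H : Hypergraph N) →
      Uniform n H →
      r ∣ N →
      (∀ (t : ℚ) → 0ℚ ≤ℚ t → t ≤ln n →
         (ℕ→ℚ ((100 * numEdges H) ^ r) *ℚ (t ^ℚ (r ∸ 1)))
           ≤ℚ ℕ→ℚ ((n ^ (r ∸ 1)) * (r ^ (r * (n ∸ 1))))) →
      EquitablyColorable r H
theorem1 = 4 ^ l₀ , λ n n₀≤n r 1≤r r<ln N H uniform r∣N few → main n n₀≤n r 1≤r r<ln N H uniform r∣N few (log₄ n (≤-trans (m^n>0 4 l₀) n₀≤n))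
  where
  main : ∀ n → 4 ^ l₀ ≤ n → ∀ r → 1 ≤ r → (Σ ℚ λ t → (ℕ→ℚ (r ^ 5) <ℚ t) × (t ≤ln n)) →
    ∀ N (H : Hypergraph N) → Uniform n H → r ∣ N →
    (∀ (t : ℚ) → 0ℚ ≤ℚ t → t ≤ln n →
      (ℕ→ℚ ((100 * numEdges H) ^ r) *ℚ (t ^ℚ (r ∸ 1))) ≤ℚ ℕ→ℚ ((n ^ (r ∸ 1)) * (r ^ (r * (n ∸ 1))))) →
    (∃ λ l → 4 ^ l ≤ n × n < 4 ^ suc l) → EquitablyColorable r H
  main n n₀≤n (suc zero) _ _ N H uniform _ few (l , lo , _) = (λ _ → zero) , all-proper (edges H) none , λ { zero zero → m≤m+n _ 1 }
    where
    -- For a single colour the hypothesis reads 100 |E| ≤ 1, so there are no edges at all.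
    none : length (edges H) ≡ 0
    none = n<1⇒n≡0 (*-cancelˡ-< 100 (length (edges H)) 1 (≤-<-trans (begin
      100 * length (edges H)  ≡⟨ sym (trans (*-identityʳ _) (^-identityʳ (100 * length (edges H)))) ⟩
      (100 * length (edges H)) ^ 1 * l ^ 0  ≤⟨ bound-at l n ((100 * length (edges H)) ^ 1) (n ^ 0 * 1 ^ (1 * (n ∸ 1))) 0 lo few ⟩
      n ^ 0 * 1 ^ (1 * (n ∸ 1))  ≡⟨ trans (*-identityˡ _) (^-zeroˡ (1 * (n ∸ 1))) ⟩
      1  ∎) (≤ᵇ⇒≤ 2 100 _)))
      where open ≤-Reasoning
    all-proper : ∀ es → length es ≡ 0 → All (λ e → ¬ Monochromatic {N} {1} (λ _ → zero) e) es
    all-proper [] _ = []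
  main n n₀≤n (suc s@(suc _)) _ (t , r<t , t≤) N H uniform (divides q N≡) few (l , lo , hi) = conclude n refl
    where
    l₀≤l : l₀ ≤ l
    l₀≤l = s≤s⁻¹ (≰⇒> (λ ge → <⇒≱ (≤-<-trans n₀≤n hi) (^-monoʳ-≤ 4 ge)))
    1≤l : 1 ≤ l
    1≤l = ≤-trans (*-mono-≤ 1≤2²⁰ (m^n>0 (4 * 2²⁰) {{m*n≢0 4 2²⁰ {{_}} {{>-nonZero 1≤2²⁰}}}} 4)) l₀≤l
      where 1≤2²⁰ : 1 ≤ 2²⁰
            1≤2²⁰ = ≤-trans (s≤s z≤n) 17≤2²⁰
    c₁ : 2²⁰ * suc s ^ 4 ≤ l
    c₁ = scale-bound (suc s) n l l₀≤l 1≤l hi (ln-lower (suc s ^ 5) n t r<t t≤)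
    conclude : ∀ m → m ≡ n → EquitablyColorable (suc s) H
    conclude zero          refl = ⊥-elim (<⇒≱ (m^n>0 4 l) lo)
    conclude (suc zero)    refl = ⊥-elim (<⇒≱ (≤-trans (≤ᵇ⇒≤ 2 4 _) (^-monoʳ-≤ 4 1≤l)) lo)
    conclude (suc (suc n′)) refl = by (Regime.equitable s n′ l (s≤s z≤n) c₁ lo hi q (edges H) (trans N≡ (*-comm q (suc s)))
        (λ e∈ → lookupAll uniform e∈) (bound-at l n ((100 * length (edges H)) ^ suc s) (n ^ s * suc s ^ (suc s * suc n′)) s lo few))
      where
      by : EquitableFor (suc s) q (edges H) → EquitablyColorable (suc s) H
      by (f , proper , counts) = f , tabulateAll (λ e∈ (i , mono) → proper e∈ i mono)
        , λ i j → ≤-trans (≤-reflexive (trans (size i) (sym (size j)))) (m≤m+n _ 1)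
        where
        size : ∀ i → ∣ colorClass f i ∣ ≡ q
        size i = trans (∣colorClass∣ f i) (counts i)
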